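{- Let $\mu$ be a strict partition. Then for every integer $n\ge0$, $$\sum_{|\lambda/\mu|=n}\frac{2^{|\lambda|-\ell(\lambda)-|\mu|+\ell(\mu)}f_{\lambda/\mu}H_\mu}{H_{\lambda}}\Bigl(\sum_{\square\in\lambda}\binom{c_{\square}}{2}-\sum_{\square\in\mu}\binom{c_{\square}}{2}\Bigr)=\binom{n}{2}+n|\mu|,$$ where the sum ranges over all strict partitions $\lambda\supseteq\mu$ with $|\lambda|-|\mu|=n$.
   Context: A strict partition is a finite strictly decreasing sequence of positive integers $\lambda=(\lambda_1>\lambda_2>\cdots>\lambda_\ell)$ (the empty sequence $\emptyset$ is allowed); $|\lambda|=\sum_i\lambda_i$ is its size, $\ell(\lambda)=\ell$ its length, and $\lambda_i=0$ for $i>\ell(\lambda)$. The (shifted Young) diagram of $\lambda$ is the set of boxes $(i,j)$ with $1\le i\le \ell(\lambda)$ and $i+1\le j\le i+\lambda_i$ (row $i$, column $j$); $\lambda$ is identified with its diagram. The content of a box $\square=(i,j)$ is $c_\square=j-i$. The hook length $h_\square$ of $\square=(i,j)\in\lambda$ is the number of boxes of $\lambda$ in row $i$ strictly to the right of $\square$, plus the number of boxes $(i',j)\in\lambda$ with $i'>i$, plus $1$, plus $\lambda_j$. $H_\lambda=\prod_{\square\in\lambda}h_\square$ ($H_\emptyset=1$). For strict partitions write $\lambda\supseteq\mu$ if $\lambda_i\ge\mu_i$ for all $i$; then $\lambda/\mu$ denotes the set of boxes of $\lambda$ not in $\mu$, and $|\lambda/\mu|=|\lambda|-|\mu|$. $f_{\lambda/\mu}$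 is the number of standard shifted Young tableaux of shape $\lambda/\mu$, i.e. bijective fillings of the boxes of $\lambda/\mu$ with $1,\dots,|\lambda/\mu|$ increasing from left to right along rows and from top to bottom along columns ($f_{\mu/\mu}=1$). -}

module Defs where

open import Data.Empty using (⊥)
open import Data.Fin as Fin using (Fin; finToFun)
import Data.Fin.Properties as Fin
open import Data.List
  using (List; []; _∷_; _++_; allFin; applyUpTo; concatMap; filter; foldr; length; lookup; map)
open import Data.List.Membership.Propositional using (_∈_)
open import Data.List.Membership.Propositional.Properties
  using (∈-++⁺ˡ; ∈-++⁺ʳ; ∈-map⁺; ∈-map⁻; ∈-filter⁺; ∈-filter⁻)
open import Data.List.Relation.Unary.All as All using (All; []; _∷_)
import Data.List.Relation.Unary.All.Properties as All
open import Data.List.Relation.Unary.Any using (here; there)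
open import Data.List.Relation.Unary.Linked as Linked using (Linked; []; [-]; _∷_)
open import Data.List.Relation.Unary.Unique.Propositional using (Unique; []; _∷_)
import Data.List.Relation.Unary.Unique.Propositional.Properties as Unique
open import Data.Nat as ℕ using (ℕ; zero; suc; _+_; _∸_; _≤_; _<_; _>_; NonZero; z≤n; s≤s)
open import Data.Nat.Combinatorics using (_C_)
open import Data.Nat.ListAction using (sum; product)
open import Data.Nat.ListAction.Properties using (product≢0)
import Data.Nat.Properties as ℕ
open import Data.Product using (∃; _×_; _,_; proj₁; proj₂)
open import Data.Product.Properties using (≡-dec)
open import Data.Rational as ℚ using (ℚ; 0ℚ)
open import Data.Sum using (inj₁; inj₂)
open import Function using (_⇔_; mk⇔; Bijective; Injective; Surjective)
open import Relation.Binary.PropositionalEquality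
  using (_≡_; refl; sym; cong; cong₂; subst)
open import Relation.Nullary using (Dec; yes; no)
open import Relation.Nullary.Decidable using (map′; ¬?; _×-dec_; _→-dec_)

------------------------------------------------------------------------
-- Strict partitions

record StrictPartition : Set where
  constructor mkStrict
  field
    parts      : List ℕ
    decreasing : Linked _>_ parts
    positive   : All (_> 0) parts

open StrictPartition public

private
  variable
    ν μ : StrictPartition

size : StrictPartition → ℕ
size ν = sum (parts ν)

ℓ : StrictPartition → ℕ
ℓ ν = length (parts ν)

-- Parts are numbered from 1; `part ν i` is 0 for i > ℓ ν, and index 0,
-- which names no part, is also given the value 0.
nth : List ℕ → ℕ → ℕ
nth []       _             = 0
nth (_ ∷ _)  zero          = 0
nth (x ∷ _)  (suc zero)    = x
nth (_ ∷ xs) (suc (suc i)) = nth xs (suc i)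

part : StrictPartition → ℕ → ℕ
part ν = nth (parts ν)

infix 4 _⊆_ _⊆?_

_⊆_ : StrictPartition → StrictPartition → Set
μ ⊆ ν = ∀ i → part μ i ≤ part ν i

nth-beyond : ∀ xs {i} → length xs < i → nth xs i ≡ 0
nth-beyond []       _                               = refl
nth-beyond (_ ∷ xs) {suc (suc i)} (s≤s (s≤s |xs|≤i)) = nth-beyond xs (s≤s |xs|≤i)

_⊆?_ : ∀ μ ν → Dec (μ ⊆ ν)
μ ⊆? ν = map′ to (λ μ⊆ν {i} _ → μ⊆ν i)
  (ℕ.allUpTo? (λ i → part μ i ℕ.≤? part ν i) (suc (ℓ μ)))
  where
  to : (∀ {i} → i < suc (ℓ μ) → part μ i ≤ part ν i) → μ ⊆ ν
  to h i with i ℕ.<? suc (ℓ μ)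
  ... | yes i≤ℓ = h i≤ℓ
  ... | no  i≰ℓ rewrite nth-beyond (parts μ) (ℕ.≮⇒≥ i≰ℓ) = z≤n

------------------------------------------------------------------------
-- Shifted diagrams

Box : Set
Box = ℕ × ℕ

row col : Box → ℕ
row = proj₁
col = proj₂

1⋯ : ℕ → List ℕ
1⋯ = applyUpTo suc

boxes : StrictPartition → List Box
boxes ν = concatMap (λ i → map (λ k → i , i + k) (1⋯ (part ν i))) (1⋯ (ℓ ν))

-- Every box of a shifted diagram has col > row, so ∸ does not truncate.
content : Box → ℕ
content b = col b ∸ row b

contentSum : StrictPartition → ℕ
contentSum ν = sum (map (λ b → content b C 2) (boxes ν))

arm leg : StrictPartition → Box → ℕ
arm ν b = length (filter (λ c → (row c ℕ.≟ row b) ×-dec (col b ℕ.<? col c)) (boxes ν))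
leg ν b = length (filter (λ c → (col c ℕ.≟ col b) ×-dec (row b ℕ.<? row c)) (boxes ν))

hook : StrictPartition → Box → ℕ
hook ν b = suc (arm ν b + leg ν b + part ν (col b))

H : StrictPartition → ℕ
H ν = product (map (hook ν) (boxes ν))

H-nonZero : ∀ ν → NonZero (H ν)
H-nonZero ν = product≢0 (All.map⁺ (All.universal (λ _ → _) (boxes ν)))

------------------------------------------------------------------------
-- Standard shifted tableaux

skewBoxes : StrictPartition → StrictPartition → List Box
skewBoxes ν μ = filter (λ b → ¬? (b ∈? boxes μ)) (boxes ν)
  where open import Data.List.Membership.DecPropositional (≡-dec ℕ._≟_ ℕ._≟_) using (_∈?_)

-- For a list bs of m distinct boxes, a filling T assigns to the p-th box of
-- bs the entry T p; the entries 1, …, m are represented by the elements of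
-- Fin m in their usual order.
module _ (bs : List Box) where

  Filling : Set
  Filling = Fin (length bs) → Fin (length bs)

  RowIncreasing ColumnIncreasing IsStandard : Filling → Set
  RowIncreasing T = ∀ p q →
    row (lookup bs p) ≡ row (lookup bs q) →
    col (lookup bs p) < col (lookup bs q) → T p Fin.< T q
  ColumnIncreasing T = ∀ p q →
    col (lookup bs p) ≡ col (lookup bs q) →
    row (lookup bs p) < row (lookup bs q) → T p Fin.< T q
  IsStandard T = Bijective _≡_ _≡_ T × RowIncreasing T × ColumnIncreasing T

  isStandard? : ∀ T → Dec (IsStandard T)
  isStandard? T = (injective? ×-dec surjective?) ×-dec rows? ×-dec columns?
    where
    injective? : Dec (Injective _≡_ _≡_ T)
    injective? = map′ (λ h {p} {q} → h p q) (λ h p q → h)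
      (Fin.all? λ p → Fin.all? λ q → (T p Fin.≟ T q) →-dec (p Fin.≟ q))

    surjective? : Dec (Surjective _≡_ _≡_ T)
    surjective? = map′
      (λ h y → proj₁ (h y) , λ { refl → proj₂ (h y) })
      (λ h y → proj₁ (h y) , proj₂ (h y) refl)
      (Fin.all? λ y → Fin.any? λ p → T p Fin.≟ y)

    rows? : Dec (RowIncreasing T)
    rows? = Fin.all? λ p → Fin.all? λ q →
      (row (lookup bs p) ℕ.≟ row (lookup bs q)) →-dec
      ((col (lookup bs p) ℕ.<? col (lookup bs q)) →-dec (T p Fin.<? T q))

    columns? : Dec (ColumnIncreasing T)
    columns? = Fin.all? λ p → Fin.all? λ q →
      (col (lookup bs p) ℕ.≟ col (lookup bs q)) →-dec
      ((row (lookup bs p) ℕ.<? row (lookup bs q)) →-dec (T p Fin.<? T q))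

  -- finToFun is a bijection, up to pointwise equality, from Fin (m ^ m)
  -- onto the functions Fin m → Fin m, so this runs through every filling
  -- exactly once.
  countStandard : ℕ
  countStandard = length (filter (λ k → isStandard? (finToFun k))
                                 (allFin (length bs ℕ.^ length bs)))

f : StrictPartition → StrictPartition → ℕ
f ν μ = countStandard (skewBoxes ν μ)

------------------------------------------------------------------------
-- The strict partitions ν ⊇ μ with |ν| - |μ| = n

-- The strictly decreasing lists of positive integers ≤ k.
decreasingLists : ℕ → List (List ℕ)
decreasingLists zero    = [] ∷ []
decreasingLists (suc k) = decreasingLists k ++ map (suc k ∷_) (decreasingLists k)

private
  Strict≤ : ℕ → List ℕ → Set
  Strict≤ k xs = Linked _>_ xs × All (_> 0) xs × All (_≤ k) xs

  strict≤-suc : ∀ {k xs} → Strict≤ k xs → Strict≤ (suc k) xs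
  strict≤-suc (d , p , b) = d , p , All.map ℕ.m≤n⇒m≤1+n b

  strict≤-∷ : ∀ {k xs} → Strict≤ k xs → Strict≤ (suc k) (suc k ∷ xs)
  strict≤-∷ {xs = []}    (d , p , b)     = [-] , s≤s z≤n ∷ p , ℕ.≤-refl ∷ []
  strict≤-∷ {xs = _ ∷ _} (d , p , x ∷ b) =
    s≤s x ∷ d , s≤s z≤n ∷ p , ℕ.≤-refl ∷ All.map ℕ.m≤n⇒m≤1+n (x ∷ b)

  decreasingLists-strict : ∀ k → All (Strict≤ k) (decreasingLists k)
  decreasingLists-strict zero    = ([] , [] , []) ∷ []
  decreasingLists-strict (suc k) = All.++⁺
    (All.map strict≤-suc (decreasingLists-strict k))
    (All.map⁺ (All.map strict≤-∷ (decreasingLists-strict k)))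

strictPartitions≤ : ℕ → List StrictPartition
strictPartitions≤ k =
  All.reduce (λ (d , p , _) → mkStrict _ d p) (decreasingLists-strict k)

-- A strict partition of size |μ| + n has all its parts ≤ |μ| + n.
extensions : StrictPartition → ℕ → List StrictPartition
extensions μ n =
  filter (λ ν → (μ ⊆? ν) ×-dec (size ν ℕ.≟ size μ + n)) (strictPartitions≤ (size μ + n))

parts-injective : parts ν ≡ parts μ → ν ≡ μ
parts-injective {mkStrict xs d p} {mkStrict _ d′ p′} refl = cong₂ (mkStrict xs)
  (Linked.irrelevant ℕ.<-irrelevant d d′)
  (All.irrelevant ℕ.<-irrelevant p p′)

private
  map-parts-reduce : ∀ {k xss} (ps : All (Strict≤ k) xss) →
    map parts (All.reduce (λ (d , p , _) → mkStrict _ d p) ps) ≡ xss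
  map-parts-reduce []       = refl
  map-parts-reduce (_ ∷ ps) = cong (_ ∷_) (map-parts-reduce ps)

  below : ∀ {x xs} → Linked _>_ (x ∷ xs) → All (_< x) xs
  below [-]       = []
  below (y<x ∷ d) = y<x ∷ All.map (λ z<y → ℕ.<-trans z<y y<x) (below d)

  decreasingLists-complete : ∀ k {xs} → Strict≤ k xs → xs ∈ decreasingLists k
  decreasingLists-complete zero {[]}    _ = here refl
  decreasingLists-complete zero {x ∷ _} (_ , s≤s _ ∷ _ , () ∷ _)
  decreasingLists-complete (suc k) {[]} _ =
    ∈-++⁺ˡ (decreasingLists-complete k ([] , [] , []))
  decreasingLists-complete (suc k) {x ∷ xs} (d , p₀ ∷ p , x≤ ∷ b) with ℕ.m≤n⇒m<n∨m≡n x≤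
  ... | inj₁ (s≤s x≤k) = ∈-++⁺ˡ (decreasingLists-complete k
          (d , p₀ ∷ p , x≤k ∷ All.map (λ y<x → ℕ.≤-trans (ℕ.<⇒≤ y<x) x≤k) (below d)))
  ... | inj₂ refl = ∈-++⁺ʳ (decreasingLists k) (∈-map⁺ (suc k ∷_)
          (decreasingLists-complete k (Linked.tail d , p , All.map ℕ.≤-pred (below d))))

  decreasingLists-unique : ∀ k → Unique (decreasingLists k)
  decreasingLists-unique zero    = [] ∷ []
  decreasingLists-unique (suc k) = Unique.++⁺ (decreasingLists-unique k)
    (Unique.map⁺ (λ { refl → refl }) (decreasingLists-unique k))
    λ { (xs∈ , xs∈′) → disjoint xs∈ (∈-map⁻ (suc k ∷_) xs∈′) }
    where
    disjoint : ∀ {xs} → xs ∈ decreasingLists k →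
               (∃ λ ys → ys ∈ decreasingLists k × xs ≡ suc k ∷ ys) → ⊥
    disjoint xs∈ (_ , _ , refl) with All.lookup (decreasingLists-strict k) xs∈
    ... | _ , _ , 1+k≤k ∷ _ = ℕ.1+n≰n 1+k≤k

  parts≤sum : ∀ xs → All (_≤ sum xs) xs
  parts≤sum []       = []
  parts≤sum (x ∷ xs) =
    ℕ.m≤m+n x _ ∷ All.map (λ y≤ → ℕ.≤-trans y≤ (ℕ.m≤n+m _ x)) (parts≤sum xs)

∈-extensions : ∀ μ n ν → ν ∈ extensions μ n ⇔ (μ ⊆ ν × size ν ≡ size μ + n)
∈-extensions μ n ν = mk⇔
  (λ ν∈ → proj₂ (∈-filter⁻ P? {xs = strictPartitions≤ (size μ + n)} ν∈))
  (λ { (μ⊆ν , |ν|) → ∈-filter⁺ P? (complete |ν|) (μ⊆ν , |ν|) })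
  where
  P? : ∀ ν → Dec (μ ⊆ ν × size ν ≡ size μ + n)
  P? ν = (μ ⊆? ν) ×-dec (size ν ℕ.≟ size μ + n)

  complete : size ν ≡ size μ + n → ν ∈ strictPartitions≤ (size μ + n)
  complete |ν| with ∈-map⁻ parts (subst (parts ν ∈_)
      (sym (map-parts-reduce (decreasingLists-strict (size μ + n))))
      (decreasingLists-complete (size μ + n)
        (decreasing ν , positive ν , subst (λ s → All (_≤ s) (parts ν)) |ν| (parts≤sum (parts ν)))))
  ... | _ , ν′∈ , eq = subst (_∈ _) (sym (parts-injective eq)) ν′∈

extensions-unique : ∀ μ n → Unique (extensions μ n)
extensions-unique μ n = Unique.filter⁺ _ (Unique.map⁻ (subst Unique
  (sym (map-parts-reduce (decreasingLists-strict (size μ + n))))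
  (decreasingLists-unique (size μ + n))))

------------------------------------------------------------------------
-- The summand

-- For μ ⊆ ν the exponent is non-negative, because |ν| - ℓ(ν) is the sum of
-- ν_i - 1 over the non-zero parts; hence ∸ does not truncate.
exponent : StrictPartition → StrictPartition → ℕ
exponent ν μ = (size ν + ℓ μ) ∸ (ℓ ν + size μ)

∑ : {A : Set} → List A → (A → ℚ) → ℚ
∑ xs g = foldr ℚ._+_ 0ℚ (map g xs)

infix 5 ∑
syntax ∑ xs (λ x → e) = ∑[ x ∈ xs ] e

{-# OPTIONS --safe #-}
-- Write a(y) = y(y + 1) and b(y) = y(y - 1), and put w(λ) = 2^(|λ| - ℓ(λ)) / H(λ). By the product
-- formula H(λ) = ∏ λᵢ! ∏_{i<j} (λᵢ + λⱼ)/(λᵢ - λⱼ), adding a box to row i of μ multiplies w(μ) by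
-- the coefficient cᵢ in the partial fraction decomposition
--   ∏ⱼ (z - b(μⱼ))/(z - a(μⱼ)) = ∑ᵢ cᵢ z/(z - a(μᵢ)),
-- where the term with μᵢ = 0 accounts for a new row. The content k of the added box satisfies
-- binom(k, 2) = a(μᵢ)/2, so the expansion at z = ∞ gives ∑ w(ν) = w(μ) and
-- ∑ w(ν) binom(k, 2) = |μ| w(μ), summed over the ν that cover μ. Removing the entry 1 from the
-- standard fillings reduces the theorem to these two sums by induction on n.
module Submission where

open import Defs
open import Data.Nat using (ℕ; _+_; _*_; _^_)
open import Data.Nat.Combinatorics using (_C_)
open import Data.Integer as ℤ using (+_)
open import Data.Rational as ℚ using (_/_)
open import Relation.Binary.PropositionalEquality using (_≡_)

open import Data.Bool using (true; false; if_then_else_)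
open import Data.Fin as Fin using (Fin; zero; suc; punchIn; punchOut; finToFun; funToFin)
import Data.Fin.Properties as Fin
import Data.Integer.Properties as ℤ
open import Data.List
  using (List; []; _∷_; _++_; allFin; applyUpTo; concatMap; filter; length; lookup; map; removeAt)
open import Data.List.Membership.Propositional using (_∈_; find; lose)
open import Data.List.Membership.Propositional.Properties
open import Data.List.Properties
  using (applyUpTo-∷ʳ; filter-++; filter-accept; filter-all; filter-none; filter-reject; filter-≐;
         length-++; length-map; length-removeAt; map-++; map-applyUpTo; map-cong; map-cong-local; map-∘)
open import Data.List.Relation.Binary.Permutation.Propositional
  using (_↭_; ↭-prep; ↭-refl; ↭-sym; ↭-trans; ↭⇒↭ₛ)
open import Data.List.Relation.Binary.Permutation.Propositional.Properties
  using (shift; ↭-length; ∈-resp-↭) renaming (map⁺ to ↭-map⁺)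
import Data.List.Relation.Binary.Permutation.Setoid.Properties as Permutation
open import Data.List.Relation.Binary.Pointwise as Pointwise using (Pointwise; []; _∷_)
open import Data.List.Relation.Unary.All as All using (All; []; _∷_)
import Data.List.Relation.Unary.All.Properties as All
open import Data.List.Relation.Unary.AllPairs as AllPairs using (AllPairs; []; _∷_)
import Data.List.Relation.Unary.AllPairs.Properties as AllPairs
open import Data.List.Relation.Unary.Any as Any using (here; there)
open import Data.List.Relation.Unary.Any.Properties using (lookup-index)
open import Data.List.Relation.Unary.Linked using (Linked; []; [-]; _∷_)
import Data.List.Relation.Unary.Linked.Properties as Linked
open import Data.List.Relation.Unary.Unique.Propositional using (Unique)
import Data.List.Relation.Unary.Unique.Propositional.Properties as Unique
open import Data.Nat as ℕ using (zero; suc; _∸_; _≤_; _<_; _>_; _≤?_; _<?_; _!; s≤s; z≤n)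
open import Data.Nat.Combinatorics using (nC1≡n; nCk+nC[k+1]≡[n+1]C[k+1])
open import Data.Nat.ListAction using (sum; product)
open import Data.Nat.ListAction.Properties using (product-++; sum-++; sum-↭)
import Data.Nat.Properties as ℕ
open import Data.Nat.Solver using () renaming (module +-*-Solver to ℕ-Solver)
open import Data.Product using (∃; _×_; _,_; proj₁; proj₂)
open import Data.Product.Properties using (≡-dec; ,-injectiveʳ; ,-injectiveˡ)
open import Data.List.Membership.DecPropositional (≡-dec ℕ._≟_ ℕ._≟_) using (_∈?_)
open import Data.Rational using (ℚ; 0ℚ; 1ℚ; ½)
open import Data.Rational.Properties as ℚ using (toℚᵘ-injective; toℚᵘ-fromℚᵘ; toℚᵘ-homo-+; toℚᵘ-homo-*)
open import Data.Rational.Solver using (module +-*-Solver)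
open import Data.Rational.Unnormalised as ℚᵘ using (mkℚᵘ; *≡*)
import Data.Rational.Unnormalised.Properties as ℚᵘ
open import Data.Sum using (_⊎_; inj₁; inj₂; [_,_]′)
open import Function using (_∘_; _⇔_; mk⇔; Bijective; Equivalence; Injective; Surjective)
open import Level using (0ℓ)
open import Relation.Binary.PropositionalEquality
  using (_≢_; refl; sym; trans; cong; cong₂; subst; subst₂; setoid; module ≡-Reasoning)
open import Relation.Nullary using (Dec; does; yes; no; contradiction; ¬_)
open import Relation.Nullary.Decidable using (_×-dec_; _⊎-dec_; _→-dec_; ¬?; map′)
open import Relation.Unary using (Pred; Decidable)

open +-*-Solver using (solve; _:=_; _:+_; _:*_; _:-_; con)
open ℕ-Solver using () renaming (solve to ℕ-solve; _:*_ to _⊗_; _:=_ to _≋_)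
open ≡-Reasoning

-- The partial fraction identity is never stated for rational functions. Its coefficients are built
-- part by part: putting a part x in front multiplies the decomposition by (z - b(x))/(z - a(x)),
-- which rescales the coefficients at the old poles and creates one at a(x), determined by the value
-- of the old product at a(x). So only values at points a(w) with w above all parts occur, and the
-- expansion at infinity becomes two inductions on the list of parts. The obstacle is that a row can
-- be lengthened only if the result stays strict, whereas the decomposition has a term for every
-- row. Weights are therefore defined on arbitrary lists; raising a row into a tie with the row
-- above gives weight 0, so the forbidden rows contribute nothing and never have to be excluded from
-- the algebra.

-- Natural numbers in ℚ and total reciprocals

ι : ℕ → ℚ
ι n = + n / 1

/1-homo-+ : ∀ i j → (i ℤ.+ j) / 1 ≡ i / 1 ℚ.+ j / 1
/1-homo-+ i j = toℚᵘ-injective (begin≃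
  ℚ.toℚᵘ ((i ℤ.+ j) / 1)             ≈⟨ toℚᵘ-fromℚᵘ (mkℚᵘ (i ℤ.+ j) 0) ⟩
  mkℚᵘ (i ℤ.+ j) 0                   ≈⟨ *≡* (cong (ℤ._* + 1) (cong₂ ℤ._+_ (sym (ℤ.*-identityʳ i)) (sym (ℤ.*-identityʳ j)))) ⟩
  mkℚᵘ i 0 ℚᵘ.+ mkℚᵘ j 0             ≈⟨ ℚᵘ.+-cong (toℚᵘ-fromℚᵘ (mkℚᵘ i 0)) (toℚᵘ-fromℚᵘ (mkℚᵘ j 0)) ⟨
  ℚ.toℚᵘ (i / 1) ℚᵘ.+ ℚ.toℚᵘ (j / 1) ≈⟨ toℚᵘ-homo-+ (i / 1) (j / 1) ⟨
  ℚ.toℚᵘ (i / 1 ℚ.+ j / 1)           ∎≃)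
  where open ℚᵘ.≃-Reasoning renaming (begin_ to begin≃_; _∎ to _∎≃)

/-*-cancel : ∀ i n .{{_ : ℕ.NonZero n}} → (i / n) ℚ.* ι n ≡ i / 1
/-*-cancel i n@(suc m) = toℚᵘ-injective (begin≃
  ℚ.toℚᵘ ((i / n) ℚ.* ι n)         ≈⟨ toℚᵘ-homo-* (i / n) (ι n) ⟩
  ℚ.toℚᵘ (i / n) ℚᵘ.* ℚ.toℚᵘ (ι n) ≈⟨ ℚᵘ.*-cong (toℚᵘ-fromℚᵘ (mkℚᵘ i m)) (toℚᵘ-fromℚᵘ (mkℚᵘ (+ n) 0)) ⟩
  mkℚᵘ i m ℚᵘ.* mkℚᵘ (+ n) 0       ≈⟨ *≡* (trans (ℤ.*-identityʳ _) (cong (λ k → i ℤ.* + k) (sym (ℕ.*-identityʳ n)))) ⟩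
  mkℚᵘ i 0                         ≈⟨ toℚᵘ-fromℚᵘ (mkℚᵘ i 0) ⟨
  ℚ.toℚᵘ (i / 1)                   ∎≃)
  where open ℚᵘ.≃-Reasoning renaming (begin_ to begin≃_; _∎ to _∎≃)

ι-+ : ∀ m n → ι (m + n) ≡ ι m ℚ.+ ι n
ι-+ m n = trans (cong (_/ 1) (ℤ.pos-+ m n)) (/1-homo-+ (+ m) (+ n))

ι-suc : ∀ n → ι (suc n) ≡ 1ℚ ℚ.+ ι n
ι-suc = ι-+ 1

ι-* : ∀ m n → ι (m * n) ≡ ι m ℚ.* ι n
ι-* zero    n = sym (ℚ.*-zeroˡ (ι n))
ι-* (suc m) n = begin
  ι (n + m * n)        ≡⟨ ι-+ n (m * n) ⟩
  ι n ℚ.+ ι (m * n)    ≡⟨ cong (λ q → ι n ℚ.+ q) (ι-* m n) ⟩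
  ι n ℚ.+ ι m ℚ.* ι n  ≡⟨ solve 2 (λ m n → n :+ m :* n := (con 1ℚ :+ m) :* n) refl (ι m) (ι n) ⟩
  (1ℚ ℚ.+ ι m) ℚ.* ι n ≡⟨ cong (ℚ._* ι n) (ι-suc m) ⟨
  ι (suc m) ℚ.* ι n    ∎

/1-homo-‿- : ∀ m n → (+ m ℤ.- + n) / 1 ≡ ι m ℚ.- ι n
/1-homo-‿- m n = begin
  (+ m ℤ.- + n) / 1                   ≡⟨ solve 2 (λ d n → d := d :+ n :- n) refl ((+ m ℤ.- + n) / 1) (ι n) ⟩
  (+ m ℤ.- + n) / 1 ℚ.+ ι n ℚ.- ι n   ≡⟨ cong (ℚ._- ι n) (/1-homo-+ (+ m ℤ.- + n) (+ n)) ⟨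
  ((+ m ℤ.- + n) ℤ.+ + n) / 1 ℚ.- ι n ≡⟨ cong (λ i → i / 1 ℚ.- ι n) (trans (ℤ.+-assoc (+ m) (ℤ.- + n) (+ n)) (trans (cong (λ i → + m ℤ.+ i) (ℤ.+-inverseˡ (+ n))) (ℤ.+-identityʳ (+ m)))) ⟩
  ι m ℚ.- ι n                         ∎

ι-nonZero : ∀ n .{{_ : ℕ.NonZero n}} → ι n ≢ 0ℚ
ι-nonZero n ιn≡0 = contradiction (trans (sym (/-*-cancel (+ 1) n)) (trans (cong ((+ 1 / n) ℚ.*_) ιn≡0) (ℚ.*-zeroʳ (+ 1 / n)))) ℚ.1≢0

-- Sending 0 to 0 keeps the inverse total, so the weight of an arbitrary list can be written down
-- without proofs about its denominators; such a proof is asked for only when `*-recip` cancels.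
recip : ℚ → ℚ
recip p with p ℚ.≟ 0ℚ
... | yes _   = 0ℚ
... | no  p≢0 = (ℚ.1/ p) {{ℚ.≢-nonZero p≢0}}

*-recip : ∀ {p} → p ≢ 0ℚ → p ℚ.* recip p ≡ 1ℚ
*-recip {p} p≢0 with p ℚ.≟ 0ℚ
... | yes p≡0 = contradiction p≡0 p≢0
... | no  p≢0 = ℚ.*-inverseʳ p {{ℚ.≢-nonZero p≢0}}

*-cancelʳ : ∀ {p q} r → r ≢ 0ℚ → p ℚ.* r ≡ q ℚ.* r → p ≡ q
*-cancelʳ {p} {q} r r≢0 pr≡qr = begin
  p                   ≡⟨ lemma p ⟩
  p ℚ.* r ℚ.* recip r ≡⟨ cong (ℚ._* recip r) pr≡qr ⟩
  q ℚ.* r ℚ.* recip r ≡⟨ lemma q ⟨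
  q                   ∎
  where
  lemma : ∀ s → s ≡ s ℚ.* r ℚ.* recip r
  lemma s = begin
    s                     ≡⟨ ℚ.*-identityʳ s ⟨
    s ℚ.* 1ℚ              ≡⟨ cong (s ℚ.*_) (*-recip r≢0) ⟨
    s ℚ.* (r ℚ.* recip r) ≡⟨ ℚ.*-assoc s r (recip r) ⟨
    s ℚ.* r ℚ.* recip r   ∎

*-nonZero : ∀ {p q} → p ≢ 0ℚ → q ≢ 0ℚ → p ℚ.* q ≢ 0ℚ
*-nonZero {p} {q} p≢0 q≢0 pq≡0 = p≢0 (*-cancelʳ q q≢0 (trans pq≡0 (sym (ℚ.*-zeroˡ q))))

-- Finite sums

module _ {A : Set} where

  ∑-cong : ∀ {g h : A → ℚ} {xs} → All (λ x → g x ≡ h x) xs → ∑ xs g ≡ ∑ xs h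
  ∑-cong []       = refl
  ∑-cong (p ∷ ps) = cong₂ ℚ._+_ p (∑-cong ps)

  ∑-ext : ∀ {g h : A → ℚ} xs → (∀ x → g x ≡ h x) → ∑ xs g ≡ ∑ xs h
  ∑-ext xs eq = ∑-cong (All.universal eq xs)

  ∑-*ˡ : ∀ k (g : A → ℚ) xs → ∑ xs (λ x → k ℚ.* g x) ≡ k ℚ.* ∑ xs g
  ∑-*ˡ k g []       = sym (ℚ.*-zeroʳ k)
  ∑-*ˡ k g (x ∷ xs) = trans (cong (λ q → k ℚ.* g x ℚ.+ q) (∑-*ˡ k g xs)) (sym (ℚ.*-distribˡ-+ k (g x) (∑ xs g)))

  ∑-+ : ∀ (g h : A → ℚ) xs → ∑ xs (λ x → g x ℚ.+ h x) ≡ ∑ xs g ℚ.+ ∑ xs h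
  ∑-+ g h []       = refl
  ∑-+ g h (x ∷ xs) = trans (cong (λ q → g x ℚ.+ h x ℚ.+ q) (∑-+ g h xs))
    (solve 4 (λ a b c d → a :+ b :+ (c :+ d) := a :+ c :+ (b :+ d)) refl (g x) (h x) (∑ xs g) (∑ xs h))

  ∑-map : ∀ {B : Set} (k : B → A) (g : A → ℚ) xs → ∑ (map k xs) g ≡ ∑ xs (λ x → g (k x))
  ∑-map k g []       = refl
  ∑-map k g (x ∷ xs) = cong (λ q → g (k x) ℚ.+ q) (∑-map k g xs)

-- Partial fractions

-- The functions a and b of the introduction.
↑_ ↓_ : ℕ → ℚ
↑ x = ι x ℚ.* (1ℚ ℚ.+ ι x)
↓ x = ι x ℚ.* (ι x ℚ.- 1ℚ)

infix 8 ↑_ ↓_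

-- Positivity belongs here because the new row enters `coefs` as a part 0, which must lie below `x`
-- as well.
Below : ℕ → List ℕ → Set
Below x xs = 0 < x × All (_< x) xs

-- Compares each part with all later ones rather than with the next one, as the products over pairs
-- of parts require.
data Strict : List ℕ → Set where
  []  : Strict []
  _∷_ : ∀ {x xs} → Below x xs → Strict xs → Strict (x ∷ xs)

_⊖_ : ℕ → ℕ → ℚ
x ⊖ y = recip (↑ x ℚ.- ↑ y)

-- The pairs (μᵢ , cᵢ), the last one being that of the new row (μᵢ = 0).
coefs : List ℕ → List (ℕ × ℚ)
coefs []       = (0 , 1ℚ) ∷ []
coefs (x ∷ xs) =
  (x , (↑ x ℚ.- ↓ x) ℚ.* (∑[ (y , c) ∈ coefs xs ] c ℚ.* (x ⊖ y))) ∷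
  map (λ (y , c) → y , c ℚ.* ((↓ x ℚ.- ↑ y) ℚ.* (x ⊖ y))) (coefs xs)

-- ∏ (z - ↓ yᵢ)/(z - ↑ yᵢ) at z = ↑ w
φ : List ℕ → ℕ → ℚ
φ []       w = 1ℚ
φ (y ∷ ys) w = (↑ w ℚ.- ↓ y) ℚ.* (w ⊖ y) ℚ.* φ ys w

coefs-< : ∀ {x xs} → Below x xs → All (λ (y , _) → y < x) (coefs xs)
coefs-< {xs = []}     (0<x , _)    = 0<x ∷ []
coefs-< {xs = y ∷ ys} (0<x , y< ∷ ys<) = y< ∷ All.map⁺ (coefs-< (0<x , ys<))

ι-∸ : ∀ {m n} → n ≤ m → ι (m ∸ n) ≡ ι m ℚ.- ι n
ι-∸ {m} {n} n≤m = begin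
  ι (m ∸ n)                 ≡⟨ solve 2 (λ d n → d := d :+ n :- n) refl (ι (m ∸ n)) (ι n) ⟩
  ι (m ∸ n) ℚ.+ ι n ℚ.- ι n ≡⟨ cong (ℚ._- ι n) (ι-+ (m ∸ n) n) ⟨
  ι (m ∸ n + n) ℚ.- ι n     ≡⟨ cong (λ k → ι k ℚ.- ι n) (ℕ.m∸n+n≡m n≤m) ⟩
  ι m ℚ.- ι n               ∎

ι-≢ : ∀ {m n} → n < m → ι m ℚ.- ι n ≢ 0ℚ
ι-≢ {m} {n} n<m eq = ι-nonZero (m ∸ n) {{ℕ.>-nonZero (ℕ.m<n⇒0<n∸m n<m)}} (trans (ι-∸ (ℕ.<⇒≤ n<m)) eq)

ι-+-nonZero : ∀ {m} n → 0 < m → ι m ℚ.+ ι n ≢ 0ℚ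
ι-+-nonZero {m} n 0<m eq = ι-nonZero (m + n) {{ℕ.>-nonZero (ℕ.<-≤-trans 0<m (ℕ.m≤m+n m n))}} (trans (ι-+ m n) eq)

1+ι-+-nonZero : ∀ m n → 1ℚ ℚ.+ (ι m ℚ.+ ι n) ≢ 0ℚ
1+ι-+-nonZero m n eq = ι-nonZero (suc (m + n)) (trans (ι-suc (m + n)) (trans (cong (λ q → 1ℚ ℚ.+ q) (ι-+ m n)) eq))

↑-factor : ∀ x y → ↑ x ℚ.- ↑ y ≡ (ι x ℚ.- ι y) ℚ.* (1ℚ ℚ.+ (ι x ℚ.+ ι y))
↑-factor x y = solve 2 (λ x y → x :* (con 1ℚ :+ x) :- y :* (con 1ℚ :+ y) := (x :- y) :* (con 1ℚ :+ (x :+ y))) refl (ι x) (ι y)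

↑-≢ : ∀ {x y} → y < x → ↑ x ℚ.- ↑ y ≢ 0ℚ
↑-≢ {x} {y} y<x eq = *-nonZero (ι-≢ y<x) (1+ι-+-nonZero x y) (trans (sym (↑-factor x y)) eq)

⊖-inverse : ∀ {x y} → y < x → (↑ x ℚ.- ↑ y) ℚ.* (x ⊖ y) ≡ 1ℚ
⊖-inverse y<x = *-recip (↑-≢ y<x)

-- The value at z = ∞. A coefficient of `xs` is split between its own pole and the new one in the
-- proportions (b(x) - a(y))/(a(x) - a(y)) and (a(x) - b(x))/(a(x) - a(y)), which add up to 1.
∑-coefs : ∀ {xs} → Strict xs → (∑[ (_ , c) ∈ coefs xs ] c) ≡ 1ℚ
∑-coefs [] = refl
∑-coefs {x ∷ xs} (x> ∷ xs↓) = begin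
  (↑ x ℚ.- ↓ x) ℚ.* ∑ cs (λ (y , c) → c ℚ.* (x ⊖ y)) ℚ.+ ∑ (map _ cs) proj₂
    ≡⟨ cong₂ ℚ._+_ (sym (∑-*ˡ (↑ x ℚ.- ↓ x) _ cs)) (∑-map _ _ cs) ⟩
  ∑ cs (λ (y , c) → (↑ x ℚ.- ↓ x) ℚ.* (c ℚ.* (x ⊖ y))) ℚ.+ ∑ cs (λ (y , c) → c ℚ.* ((↓ x ℚ.- ↑ y) ℚ.* (x ⊖ y)))
    ≡⟨ ∑-+ _ _ cs ⟨
  ∑ cs (λ (y , c) → (↑ x ℚ.- ↓ x) ℚ.* (c ℚ.* (x ⊖ y)) ℚ.+ c ℚ.* ((↓ x ℚ.- ↑ y) ℚ.* (x ⊖ y)))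
    ≡⟨ ∑-cong (All.map (λ {(y , c)} → term y c) (coefs-< x>)) ⟩
  ∑ cs proj₂
    ≡⟨ ∑-coefs xs↓ ⟩
  1ℚ ∎
  where
  cs = coefs xs
  term : ∀ y c → y < x → (↑ x ℚ.- ↓ x) ℚ.* (c ℚ.* (x ⊖ y)) ℚ.+ c ℚ.* ((↓ x ℚ.- ↑ y) ℚ.* (x ⊖ y)) ≡ c
  term y c y<x = begin
    (↑ x ℚ.- ↓ x) ℚ.* (c ℚ.* (x ⊖ y)) ℚ.+ c ℚ.* ((↓ x ℚ.- ↑ y) ℚ.* (x ⊖ y))
      ≡⟨ solve 5 (λ a b a′ c k → (a :- b) :* (c :* k) :+ c :* ((b :- a′) :* k) := c :* ((a :- a′) :* k)) refl (↑ x) (↓ x) (↑ y) c (x ⊖ y) ⟩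
    c ℚ.* ((↑ x ℚ.- ↑ y) ℚ.* (x ⊖ y)) ≡⟨ cong (c ℚ.*_) (⊖-inverse y<x) ⟩
    c ℚ.* 1ℚ                          ≡⟨ ℚ.*-identityʳ c ⟩
    c                                 ∎

-- The coefficient of 1/z at z = ∞. Each part x adds a(x) - b(x) = 2x times the sum of the
-- coefficients, which is 1.
∑-coefs-↑ : ∀ {xs} → Strict xs → (∑[ (y , c) ∈ coefs xs ] c ℚ.* ↑ y) ≡ ι (sum xs) ℚ.+ ι (sum xs)
∑-coefs-↑ [] = refl
∑-coefs-↑ {x ∷ xs} (x> ∷ xs↓) = begin
  (↑ x ℚ.- ↓ x) ℚ.* ∑ cs (λ (y , c) → c ℚ.* (x ⊖ y)) ℚ.* ↑ x ℚ.+ ∑ (map _ cs) (λ (y , c) → c ℚ.* ↑ y)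
    ≡⟨ cong₂ ℚ._+_ (trans (solve 3 (λ p s a → p :* s :* a := (p :* a) :* s) refl (↑ x ℚ.- ↓ x) (∑ cs (λ (y , c) → c ℚ.* (x ⊖ y))) (↑ x)) (sym (∑-*ˡ ((↑ x ℚ.- ↓ x) ℚ.* ↑ x) _ cs))) (∑-map _ _ cs) ⟩
  ∑ cs (λ (y , c) → (↑ x ℚ.- ↓ x) ℚ.* ↑ x ℚ.* (c ℚ.* (x ⊖ y))) ℚ.+ ∑ cs (λ (y , c) → c ℚ.* ((↓ x ℚ.- ↑ y) ℚ.* (x ⊖ y)) ℚ.* ↑ y)
    ≡⟨ ∑-+ _ _ cs ⟨
  ∑ cs (λ (y , c) → (↑ x ℚ.- ↓ x) ℚ.* ↑ x ℚ.* (c ℚ.* (x ⊖ y)) ℚ.+ c ℚ.* ((↓ x ℚ.- ↑ y) ℚ.* (x ⊖ y)) ℚ.* ↑ y)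
    ≡⟨ ∑-cong (All.map (λ {(y , c)} → term y c) (coefs-< x>)) ⟩
  ∑ cs (λ (y , c) → (↑ x ℚ.- ↓ x) ℚ.* c ℚ.+ c ℚ.* ↑ y)
    ≡⟨ ∑-+ _ _ cs ⟩
  ∑ cs (λ (y , c) → (↑ x ℚ.- ↓ x) ℚ.* c) ℚ.+ ∑ cs (λ (y , c) → c ℚ.* ↑ y)
    ≡⟨ cong₂ ℚ._+_ (trans (∑-*ˡ (↑ x ℚ.- ↓ x) proj₂ cs) (cong ((↑ x ℚ.- ↓ x) ℚ.*_) (∑-coefs xs↓))) (∑-coefs-↑ xs↓) ⟩
  (↑ x ℚ.- ↓ x) ℚ.* 1ℚ ℚ.+ (ι (sum xs) ℚ.+ ι (sum xs))
    ≡⟨ solve 2 (λ x s → (x :* (con 1ℚ :+ x) :- x :* (x :- con 1ℚ)) :* con 1ℚ :+ (s :+ s) := (x :+ s) :+ (x :+ s)) refl (ι x) (ι (sum xs)) ⟩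
  (ι x ℚ.+ ι (sum xs)) ℚ.+ (ι x ℚ.+ ι (sum xs))
    ≡⟨ cong₂ ℚ._+_ (ι-+ x (sum xs)) (ι-+ x (sum xs)) ⟨
  ι (sum (x ∷ xs)) ℚ.+ ι (sum (x ∷ xs)) ∎
  where
  cs = coefs xs
  term : ∀ y c → y < x → (↑ x ℚ.- ↓ x) ℚ.* ↑ x ℚ.* (c ℚ.* (x ⊖ y)) ℚ.+ c ℚ.* ((↓ x ℚ.- ↑ y) ℚ.* (x ⊖ y)) ℚ.* ↑ y ≡ (↑ x ℚ.- ↓ x) ℚ.* c ℚ.+ c ℚ.* ↑ y
  term y c y<x = begin
    (↑ x ℚ.- ↓ x) ℚ.* ↑ x ℚ.* (c ℚ.* (x ⊖ y)) ℚ.+ c ℚ.* ((↓ x ℚ.- ↑ y) ℚ.* (x ⊖ y)) ℚ.* ↑ y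
      ≡⟨ solve 5 (λ a b a′ c k → (a :- b) :* a :* (c :* k) :+ c :* ((b :- a′) :* k) :* a′ := ((a :- b) :* c :+ c :* a′) :* ((a :- a′) :* k)) refl (↑ x) (↓ x) (↑ y) c (x ⊖ y) ⟩
    ((↑ x ℚ.- ↓ x) ℚ.* c ℚ.+ c ℚ.* ↑ y) ℚ.* ((↑ x ℚ.- ↑ y) ℚ.* (x ⊖ y)) ≡⟨ cong (((↑ x ℚ.- ↓ x) ℚ.* c ℚ.+ c ℚ.* ↑ y) ℚ.*_) (⊖-inverse y<x) ⟩
    ((↑ x ℚ.- ↓ x) ℚ.* c ℚ.+ c ℚ.* ↑ y) ℚ.* 1ℚ                          ≡⟨ ℚ.*-identityʳ _ ⟩
    (↑ x ℚ.- ↓ x) ℚ.* c ℚ.+ c ℚ.* ↑ y                                   ∎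

-- Evaluation at z = a(w), where `w` exceeds all parts, so that no pole is met. Its purpose is to
-- recognise the coefficient of a part put in front: the weights produce the product, `coefs` the
-- sum.
partial-fractions : ∀ {w xs} → Strict xs → Below w xs →
  φ xs w ≡ ↑ w ℚ.* (∑[ (y , c) ∈ coefs xs ] c ℚ.* (w ⊖ y))
partial-fractions {w} [] (0<w , _) = sym (begin
  ↑ w ℚ.* (1ℚ ℚ.* (w ⊖ 0) ℚ.+ 0ℚ) ≡⟨ solve 2 (λ a k → a :* (con 1ℚ :* k :+ con 0ℚ) := (a :- con 0ℚ :* (con 1ℚ :+ con 0ℚ)) :* k) refl (↑ w) (w ⊖ 0) ⟩
  (↑ w ℚ.- ↑ 0) ℚ.* (w ⊖ 0)       ≡⟨ ⊖-inverse 0<w ⟩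
  1ℚ                              ∎)
partial-fractions {w} {x ∷ xs} (x> ∷ xs↓) (0<w , x<w ∷ xs<w) = begin
  (↑ w ℚ.- ↓ x) ℚ.* (w ⊖ x) ℚ.* φ xs w
    ≡⟨ cong ((↑ w ℚ.- ↓ x) ℚ.* (w ⊖ x) ℚ.*_) (partial-fractions xs↓ (0<w , xs<w)) ⟩
  (↑ w ℚ.- ↓ x) ℚ.* (w ⊖ x) ℚ.* (↑ w ℚ.* ∑ cs (λ (y , c) → c ℚ.* (w ⊖ y)))
    ≡⟨ solve 3 (λ p a s → p :* (a :* s) := a :* (p :* s)) refl ((↑ w ℚ.- ↓ x) ℚ.* (w ⊖ x)) (↑ w) (∑ cs (λ (y , c) → c ℚ.* (w ⊖ y))) ⟩
  ↑ w ℚ.* ((↑ w ℚ.- ↓ x) ℚ.* (w ⊖ x) ℚ.* ∑ cs (λ (y , c) → c ℚ.* (w ⊖ y)))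
    ≡⟨ cong (↑ w ℚ.*_) (begin
      (↑ w ℚ.- ↓ x) ℚ.* (w ⊖ x) ℚ.* ∑ cs (λ (y , c) → c ℚ.* (w ⊖ y))
        ≡⟨ ∑-*ˡ ((↑ w ℚ.- ↓ x) ℚ.* (w ⊖ x)) _ cs ⟨
      ∑ cs (λ (y , c) → (↑ w ℚ.- ↓ x) ℚ.* (w ⊖ x) ℚ.* (c ℚ.* (w ⊖ y)))
        ≡⟨ ∑-cong (All.map (λ {(y , c)} → term y c) (All.zip (coefs-< x> , coefs-< (0<w , xs<w)))) ⟩
      ∑ cs (λ (y , c) → (↑ x ℚ.- ↓ x) ℚ.* (w ⊖ x) ℚ.* (c ℚ.* (x ⊖ y)) ℚ.+ c ℚ.* ((↓ x ℚ.- ↑ y) ℚ.* (x ⊖ y)) ℚ.* (w ⊖ y))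
        ≡⟨ ∑-+ _ _ cs ⟩
      ∑ cs (λ (y , c) → (↑ x ℚ.- ↓ x) ℚ.* (w ⊖ x) ℚ.* (c ℚ.* (x ⊖ y))) ℚ.+ ∑ cs (λ (y , c) → c ℚ.* ((↓ x ℚ.- ↑ y) ℚ.* (x ⊖ y)) ℚ.* (w ⊖ y))
        ≡⟨ cong₂ ℚ._+_
             (trans (∑-*ˡ ((↑ x ℚ.- ↓ x) ℚ.* (w ⊖ x)) _ cs)
               (solve 3 (λ p k s → p :* k :* s := p :* s :* k) refl (↑ x ℚ.- ↓ x) (w ⊖ x) (∑ cs (λ (y , c) → c ℚ.* (x ⊖ y)))))
             (sym (∑-map _ _ cs)) ⟩
      (↑ x ℚ.- ↓ x) ℚ.* ∑ cs (λ (y , c) → c ℚ.* (x ⊖ y)) ℚ.* (w ⊖ x) ℚ.+ ∑ (map _ cs) (λ (y , c) → c ℚ.* (w ⊖ y)) ∎) ⟩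
  ↑ w ℚ.* ∑ (coefs (x ∷ xs)) (λ (y , c) → c ℚ.* (w ⊖ y)) ∎
  where
  cs = coefs xs
  term : ∀ y c → y < x × y < w →
    (↑ w ℚ.- ↓ x) ℚ.* (w ⊖ x) ℚ.* (c ℚ.* (w ⊖ y)) ≡ (↑ x ℚ.- ↓ x) ℚ.* (w ⊖ x) ℚ.* (c ℚ.* (x ⊖ y)) ℚ.+ c ℚ.* ((↓ x ℚ.- ↑ y) ℚ.* (x ⊖ y)) ℚ.* (w ⊖ y)
  term y c (y<x , y<w) = begin
    (↑ w ℚ.- ↓ x) ℚ.* (w ⊖ x) ℚ.* (c ℚ.* (w ⊖ y))
      ≡⟨ ℚ.*-identityʳ _ ⟨
    (↑ w ℚ.- ↓ x) ℚ.* (w ⊖ x) ℚ.* (c ℚ.* (w ⊖ y)) ℚ.* 1ℚ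
      ≡⟨ cong ((↑ w ℚ.- ↓ x) ℚ.* (w ⊖ x) ℚ.* (c ℚ.* (w ⊖ y)) ℚ.*_) (⊖-inverse y<x) ⟨
    (↑ w ℚ.- ↓ x) ℚ.* (w ⊖ x) ℚ.* (c ℚ.* (w ⊖ y)) ℚ.* ((↑ x ℚ.- ↑ y) ℚ.* (x ⊖ y))
      -- For the solver the reciprocals are unrelated variables, so factors equal to 1 complete both
      -- sides. What remains is (z - b)(a - a′) = (a - b)(z - a′) + (b - a′)(z - a).
      ≡⟨ solve 8 (λ z b a a′ c k l m →
           (z :- b) :* k :* (c :* l) :* ((a :- a′) :* m) :=
           (a :- b) :* k :* (c :* m) :* ((z :- a′) :* l) :+ c :* ((b :- a′) :* m) :* l :* ((z :- a) :* k))
           refl (↑ w) (↓ x) (↑ x) (↑ y) c (w ⊖ x) (w ⊖ y) (x ⊖ y) ⟩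
    (↑ x ℚ.- ↓ x) ℚ.* (w ⊖ x) ℚ.* (c ℚ.* (x ⊖ y)) ℚ.* ((↑ w ℚ.- ↑ y) ℚ.* (w ⊖ y)) ℚ.+
    c ℚ.* ((↓ x ℚ.- ↑ y) ℚ.* (x ⊖ y)) ℚ.* (w ⊖ y) ℚ.* ((↑ w ℚ.- ↑ x) ℚ.* (w ⊖ x))
      ≡⟨ cong₂ (λ p q → (↑ x ℚ.- ↓ x) ℚ.* (w ⊖ x) ℚ.* (c ℚ.* (x ⊖ y)) ℚ.* p ℚ.+ c ℚ.* ((↓ x ℚ.- ↑ y) ℚ.* (x ⊖ y)) ℚ.* (w ⊖ y) ℚ.* q) (⊖-inverse y<w) (⊖-inverse x<w) ⟩
    (↑ x ℚ.- ↓ x) ℚ.* (w ⊖ x) ℚ.* (c ℚ.* (x ⊖ y)) ℚ.* 1ℚ ℚ.+ c ℚ.* ((↓ x ℚ.- ↑ y) ℚ.* (x ⊖ y)) ℚ.* (w ⊖ y) ℚ.* 1ℚ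
      ≡⟨ cong₂ ℚ._+_ (ℚ.*-identityʳ ((↑ x ℚ.- ↓ x) ℚ.* (w ⊖ x) ℚ.* (c ℚ.* (x ⊖ y)))) (ℚ.*-identityʳ (c ℚ.* ((↓ x ℚ.- ↑ y) ℚ.* (x ⊖ y)) ℚ.* (w ⊖ y))) ⟩
    (↑ x ℚ.- ↓ x) ℚ.* (w ⊖ x) ℚ.* (c ℚ.* (x ⊖ y)) ℚ.+ c ℚ.* ((↓ x ℚ.- ↑ y) ℚ.* (x ⊖ y)) ℚ.* (w ⊖ y) ∎

-- Weights of strict partitions

-- Every row is raised, even where a tie with the row above results, so that the list runs parallel
-- to `coefs`.
bumps : List ℕ → List (List ℕ)
bumps []       = (1 ∷ []) ∷ []
bumps (x ∷ xs) = (suc x ∷ xs) ∷ map (x ∷_) (bumps xs)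

factor : ℕ → ℚ
factor x = ι (2 ^ (x ∸ 1)) ℚ.* recip (ι (x !))

interaction : ℕ → List ℕ → ℚ
interaction x []       = 1ℚ
interaction x (y ∷ ys) = (ι x ℚ.- ι y) ℚ.* recip (ι x ℚ.+ ι y) ℚ.* interaction x ys

-- Equal to 2^(|λ| - ℓ(λ)) / H(λ) when the parts are those of λ (see weight-hooks).
weight : List ℕ → ℚ
weight []       = 1ℚ
weight (x ∷ xs) = factor x ℚ.* interaction x xs ℚ.* weight xs

recip-* : ∀ {p q} → p ≢ 0ℚ → q ≢ 0ℚ → recip (p ℚ.* q) ≡ recip p ℚ.* recip q
recip-* {p} {q} p≢0 q≢0 = *-cancelʳ (p ℚ.* q) (*-nonZero p≢0 q≢0) (begin
  recip (p ℚ.* q) ℚ.* (p ℚ.* q)     ≡⟨ ℚ.*-comm (recip (p ℚ.* q)) (p ℚ.* q) ⟩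
  p ℚ.* q ℚ.* recip (p ℚ.* q)       ≡⟨ *-recip (*-nonZero p≢0 q≢0) ⟩
  1ℚ ℚ.* 1ℚ                         ≡⟨ cong₂ ℚ._*_ (*-recip p≢0) (*-recip q≢0) ⟨
  p ℚ.* recip p ℚ.* (q ℚ.* recip q) ≡⟨ solve 4 (λ p q r s → p :* r :* (q :* s) := r :* s :* (p :* q)) refl p q (recip p) (recip q) ⟩
  recip p ℚ.* recip q ℚ.* (p ℚ.* q) ∎)

-- With p/q the old factor (x - y)/(x + y), r the new denominator x + y + 1 and s the new numerator,
-- this isolates the ratio by which the factor changes when one of the two parts grows.
cross-cancel : ∀ p q r s → p ≢ 0ℚ → q ≢ 0ℚ → r ≢ 0ℚ →
  s ℚ.* recip r ≡ p ℚ.* recip q ℚ.* (s ℚ.* q ℚ.* recip (p ℚ.* r))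
cross-cancel p q r s p≢0 q≢0 r≢0 = begin
  s ℚ.* recip r
    ≡⟨ solve 1 (λ t → t := t :* con 1ℚ :* con 1ℚ) refl (s ℚ.* recip r) ⟩
  s ℚ.* recip r ℚ.* 1ℚ ℚ.* 1ℚ
    ≡⟨ cong₂ (λ u v → s ℚ.* recip r ℚ.* u ℚ.* v) (*-recip p≢0) (*-recip q≢0) ⟨
  s ℚ.* recip r ℚ.* (p ℚ.* recip p) ℚ.* (q ℚ.* recip q)
    ≡⟨ solve 6 (λ s r p p′ q q′ → s :* r :* (p :* p′) :* (q :* q′) := p :* q′ :* (s :* q :* (p′ :* r))) refl s (recip r) p (recip p) q (recip q) ⟩
  p ℚ.* recip q ℚ.* (s ℚ.* q ℚ.* (recip p ℚ.* recip r))
    ≡⟨ cong (λ u → p ℚ.* recip q ℚ.* (s ℚ.* q ℚ.* u)) (recip-* p≢0 r≢0) ⟨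
  p ℚ.* recip q ℚ.* (s ℚ.* q ℚ.* recip (p ℚ.* r)) ∎

⊖-factor : ∀ x y → x ⊖ y ≡ recip ((ι x ℚ.- ι y) ℚ.* (1ℚ ℚ.+ (ι x ℚ.+ ι y)))
⊖-factor x y = cong recip (↑-factor x y)

module _ {x y} (y<x : y < x) where

  private
    0<x : 0 < x
    0<x = ℕ.≤-<-trans z≤n y<x

    cancel : ∀ s → s ℚ.* recip (1ℚ ℚ.+ (ι x ℚ.+ ι y)) ≡
      (ι x ℚ.- ι y) ℚ.* recip (ι x ℚ.+ ι y) ℚ.* (s ℚ.* (ι x ℚ.+ ι y) ℚ.* recip ((ι x ℚ.- ι y) ℚ.* (1ℚ ℚ.+ (ι x ℚ.+ ι y))))
    cancel s = cross-cancel (ι x ℚ.- ι y) (ι x ℚ.+ ι y) (1ℚ ℚ.+ (ι x ℚ.+ ι y)) s (ι-≢ y<x) (ι-+-nonZero y 0<x) (1+ι-+-nonZero x y)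

  -- This and `bump-upper` are the origin of a and b. Raising y turns (x - y)/(x + y) into (x - y -
  -- 1)/(x + y + 1), where b(x) - a(y) = (x - y - 1)(x + y) and a(x) - a(y) = (x - y)(x + y + 1).
  bump-lower : (ι x ℚ.- ι (suc y)) ℚ.* recip (ι x ℚ.+ ι (suc y)) ≡
    (ι x ℚ.- ι y) ℚ.* recip (ι x ℚ.+ ι y) ℚ.* ((↓ x ℚ.- ↑ y) ℚ.* (x ⊖ y))
  bump-lower = begin
    (ι x ℚ.- ι (suc y)) ℚ.* recip (ι x ℚ.+ ι (suc y))
      ≡⟨ cong₂ (λ u v → u ℚ.* recip v) (cong (λ u → ι x ℚ.- u) (ι-suc y))
           (trans (cong (λ u → ι x ℚ.+ u) (ι-suc y)) (solve 2 (λ x y → x :+ (con 1ℚ :+ y) := con 1ℚ :+ (x :+ y)) refl (ι x) (ι y))) ⟩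
    (ι x ℚ.- (1ℚ ℚ.+ ι y)) ℚ.* recip (1ℚ ℚ.+ (ι x ℚ.+ ι y))
      ≡⟨ cancel (ι x ℚ.- (1ℚ ℚ.+ ι y)) ⟩
    (ι x ℚ.- ι y) ℚ.* recip (ι x ℚ.+ ι y) ℚ.* ((ι x ℚ.- (1ℚ ℚ.+ ι y)) ℚ.* (ι x ℚ.+ ι y) ℚ.* recip ((ι x ℚ.- ι y) ℚ.* (1ℚ ℚ.+ (ι x ℚ.+ ι y))))
      ≡⟨ cong₂ (λ u v → (ι x ℚ.- ι y) ℚ.* recip (ι x ℚ.+ ι y) ℚ.* (u ℚ.* v))
           (solve 2 (λ x y → x :* (x :- con 1ℚ) :- y :* (con 1ℚ :+ y) := (x :- (con 1ℚ :+ y)) :* (x :+ y)) refl (ι x) (ι y))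
           (⊖-factor x y) ⟨
    (ι x ℚ.- ι y) ℚ.* recip (ι x ℚ.+ ι y) ℚ.* ((↓ x ℚ.- ↑ y) ℚ.* (x ⊖ y)) ∎

  -- Here a(x) - b(y) = (x + 1 - y)(x + y), so raising x yields the factor of `φ` that belongs to y.
  bump-upper : (ι (suc x) ℚ.- ι y) ℚ.* recip (ι (suc x) ℚ.+ ι y) ≡
    (ι x ℚ.- ι y) ℚ.* recip (ι x ℚ.+ ι y) ℚ.* ((↑ x ℚ.- ↓ y) ℚ.* (x ⊖ y))
  bump-upper = begin
    (ι (suc x) ℚ.- ι y) ℚ.* recip (ι (suc x) ℚ.+ ι y)
      ≡⟨ cong₂ (λ u v → u ℚ.* recip v) (cong (λ u → u ℚ.- ι y) (ι-suc x))
           (trans (cong (λ u → u ℚ.+ ι y) (ι-suc x)) (ℚ.+-assoc 1ℚ (ι x) (ι y))) ⟩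
    (1ℚ ℚ.+ ι x ℚ.- ι y) ℚ.* recip (1ℚ ℚ.+ (ι x ℚ.+ ι y))
      ≡⟨ cancel (1ℚ ℚ.+ ι x ℚ.- ι y) ⟩
    (ι x ℚ.- ι y) ℚ.* recip (ι x ℚ.+ ι y) ℚ.* ((1ℚ ℚ.+ ι x ℚ.- ι y) ℚ.* (ι x ℚ.+ ι y) ℚ.* recip ((ι x ℚ.- ι y) ℚ.* (1ℚ ℚ.+ (ι x ℚ.+ ι y))))
      ≡⟨ cong₂ (λ u v → (ι x ℚ.- ι y) ℚ.* recip (ι x ℚ.+ ι y) ℚ.* (u ℚ.* v))
           (solve 2 (λ x y → x :* (con 1ℚ :+ x) :- y :* (y :- con 1ℚ) := (con 1ℚ :+ x :- y) :* (x :+ y)) refl (ι x) (ι y))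
           (⊖-factor x y) ⟨
    (ι x ℚ.- ι y) ℚ.* recip (ι x ℚ.+ ι y) ℚ.* ((↑ x ℚ.- ↓ y) ℚ.* (x ⊖ y)) ∎

-- At `x` = 0 the exponent `x ∸ 1` truncates and no power of 2 is gained: opening a new row leaves
-- |λ| - ℓ(λ) unchanged.
factor-suc : ∀ {x} → 0 < x → factor (suc x) ≡ factor x ℚ.* ((1ℚ ℚ.+ 1ℚ) ℚ.* recip (1ℚ ℚ.+ ι x))
factor-suc {x@(suc x′)} _ = begin
  ι (2 * 2 ^ x′) ℚ.* recip (ι (suc x * x !))
    ≡⟨ cong₂ (λ u v → u ℚ.* recip v) (ι-* 2 (2 ^ x′)) (ι-* (suc x) (x !)) ⟩
  ι 2 ℚ.* ι (2 ^ x′) ℚ.* recip (ι (suc x) ℚ.* ι (x !))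
    ≡⟨ cong (λ u → ι 2 ℚ.* ι (2 ^ x′) ℚ.* u) (recip-* (ι-nonZero (suc x)) (ι-nonZero (x !) {{x ℕ.!≢0}})) ⟩
  ι 2 ℚ.* ι (2 ^ x′) ℚ.* (recip (ι (suc x)) ℚ.* recip (ι (x !)))
    ≡⟨ cong (λ u → ι 2 ℚ.* ι (2 ^ x′) ℚ.* (recip u ℚ.* recip (ι (x !)))) (ι-suc x) ⟩
  ι 2 ℚ.* ι (2 ^ x′) ℚ.* (recip (1ℚ ℚ.+ ι x) ℚ.* recip (ι (x !)))
    ≡⟨ solve 4 (λ t p r s → t :* p :* (r :* s) := p :* s :* (t :* r)) refl (ι 2) (ι (2 ^ x′)) (recip (1ℚ ℚ.+ ι x)) (recip (ι (x !))) ⟩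
  ι (2 ^ x′) ℚ.* recip (ι (x !)) ℚ.* (ι 2 ℚ.* recip (1ℚ ℚ.+ ι x)) ∎

interaction-suc : ∀ {x xs} → All (_< x) xs → interaction (suc x) xs ≡ interaction x xs ℚ.* φ xs x
interaction-suc [] = refl
interaction-suc {x} {y ∷ ys} (y<x ∷ ys<x) = trans (cong₂ ℚ._*_ (bump-upper y<x) (interaction-suc ys<x))
  (solve 4 (λ p q r s → p :* q :* (r :* s) := p :* r :* (q :* s)) refl
    ((ι x ℚ.- ι y) ℚ.* recip (ι x ℚ.+ ι y)) ((↑ x ℚ.- ↓ y) ℚ.* (x ⊖ y)) (interaction x ys) (φ ys x))

-- `factor` changes by 2/(x + 1) and `interaction` by `φ xs x`, which is x(x + 1) times the sum;
-- together this is 2x = a(x) - b(x) times the sum.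
weight-bump-head : ∀ {x xs} → Below x xs → Strict xs →
  weight (suc x ∷ xs) ≡ (↑ x ℚ.- ↓ x) ℚ.* (∑[ (y , c) ∈ coefs xs ] c ℚ.* (x ⊖ y)) ℚ.* weight (x ∷ xs)
weight-bump-head {x} {xs} x> xs↓ = begin
  factor (suc x) ℚ.* interaction (suc x) xs ℚ.* weight xs
    ≡⟨ cong₂ (λ u v → u ℚ.* v ℚ.* weight xs) (factor-suc (proj₁ x>)) (trans (interaction-suc (proj₂ x>)) (cong (interaction x xs ℚ.*_) (partial-fractions xs↓ x>))) ⟩
  factor x ℚ.* ((1ℚ ℚ.+ 1ℚ) ℚ.* recip (1ℚ ℚ.+ ι x)) ℚ.* (interaction x xs ℚ.* (ι x ℚ.* (1ℚ ℚ.+ ι x) ℚ.* S)) ℚ.* weight xs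
    ≡⟨ solve 6 (λ e r i x s v → e :* ((con 1ℚ :+ con 1ℚ) :* r) :* (i :* (x :* (con 1ℚ :+ x) :* s)) :* v :=
         (x :* (con 1ℚ :+ x) :- x :* (x :- con 1ℚ)) :* s :* (e :* i :* v) :* ((con 1ℚ :+ x) :* r))
         refl (factor x) (recip (1ℚ ℚ.+ ι x)) (interaction x xs) (ι x) S (weight xs) ⟩
  (↑ x ℚ.- ↓ x) ℚ.* S ℚ.* weight (x ∷ xs) ℚ.* ((1ℚ ℚ.+ ι x) ℚ.* recip (1ℚ ℚ.+ ι x))
    ≡⟨ cong ((↑ x ℚ.- ↓ x) ℚ.* S ℚ.* weight (x ∷ xs) ℚ.*_) (*-recip λ eq → ι-nonZero (suc x) (trans (ι-suc x) eq)) ⟩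
  (↑ x ℚ.- ↓ x) ℚ.* S ℚ.* weight (x ∷ xs) ℚ.* 1ℚ
    ≡⟨ ℚ.*-identityʳ _ ⟩
  (↑ x ℚ.- ↓ x) ℚ.* S ℚ.* weight (x ∷ xs) ∎
  where S = ∑[ (y , c) ∈ coefs xs ] c ℚ.* (x ⊖ y)

-- In a shifted diagram row i starts in column i + 1, so a row of length x has the contents 1, ...,
-- x whatever its position.
rowContent : ℕ → ℕ
rowContent x = sum (map (_C 2) (1⋯ x))

partsContent : List ℕ → ℕ
partsContent xs = sum (map rowContent xs)

rowContent-suc : ∀ x → rowContent (suc x) ≡ rowContent x + suc x C 2
rowContent-suc x = begin
  sum (map (_C 2) (1⋯ (suc x)))             ≡⟨ cong (λ l → sum (map (_C 2) l)) (applyUpTo-∷ʳ suc x) ⟨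
  sum (map (_C 2) (1⋯ x ++ suc x ∷ []))     ≡⟨ cong sum (map-++ (_C 2) (1⋯ x) _) ⟩
  sum (map (_C 2) (1⋯ x) ++ suc x C 2 ∷ []) ≡⟨ sum-++ (map (_C 2) (1⋯ x)) _ ⟩
  rowContent x + (suc x C 2 + 0)            ≡⟨ cong (rowContent x ℕ.+_) (ℕ.+-identityʳ _) ⟩
  rowContent x + suc x C 2                  ∎

ι-C2 : ∀ x → ι (suc x C 2) ≡ ½ ℚ.* ↑ x
ι-C2 zero    = refl
ι-C2 (suc x) = begin
  ι (suc (suc x) C 2)                            ≡⟨ cong ι (nCk+nC[k+1]≡[n+1]C[k+1] (suc x) 1) ⟨
  ι (suc x C 1 + suc x C 2)                      ≡⟨ ι-+ (suc x C 1) (suc x C 2) ⟩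
  ι (suc x C 1) ℚ.+ ι (suc x C 2)                ≡⟨ cong₂ (λ u v → ι u ℚ.+ v) (nC1≡n (suc x)) (ι-C2 x) ⟩
  ι (suc x) ℚ.+ ½ ℚ.* ↑ x                        ≡⟨ cong (λ u → u ℚ.+ ½ ℚ.* ↑ x) (ι-suc x) ⟩
  1ℚ ℚ.+ ι x ℚ.+ ½ ℚ.* ↑ x                       ≡⟨ solve 1 (λ x → con 1ℚ :+ x :+ con ½ :* (x :* (con 1ℚ :+ x)) := con ½ :* ((con 1ℚ :+ x) :* (con 1ℚ :+ (con 1ℚ :+ x)))) refl (ι x) ⟩
  ½ ℚ.* ((1ℚ ℚ.+ ι x) ℚ.* (1ℚ ℚ.+ (1ℚ ℚ.+ ι x))) ≡⟨ cong (λ u → ½ ℚ.* (u ℚ.* (1ℚ ℚ.+ u))) (ι-suc x) ⟨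
  ½ ℚ.* ↑ suc x                                  ∎

-- `interaction-bump` strengthens the induction: when a larger part is put in front, the weight of
-- the raised list also changes through its interaction with that part.
record Bumps (xs ys : List ℕ) (yc : ℕ × ℚ) : Set where
  field
    content-bump     : partsContent ys ≡ partsContent xs + suc (proj₁ yc) C 2
    interaction-bump : ∀ {x} → Below x xs → interaction x ys ≡ interaction x xs ℚ.* ((↓ x ℚ.- ↑ proj₁ yc) ℚ.* (x ⊖ proj₁ yc))
    weight-bump      : weight ys ≡ proj₂ yc ℚ.* weight xs
open Bumps

bumps-coefs : ∀ {xs} → Strict xs → Pointwise (Bumps xs) (bumps xs) (coefs xs)
bumps-coefs [] = new ∷ []
  where
  new : Bumps [] (1 ∷ []) (0 , 1ℚ)
  new .content-bump = refl
  new .interaction-bump {x} (0<x , _) = begin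
    (ι x ℚ.- ι 1) ℚ.* recip (ι x ℚ.+ ι 1) ℚ.* 1ℚ
      ≡⟨ cong (ℚ._* 1ℚ) (bump-lower 0<x) ⟩
    (ι x ℚ.- ι 0) ℚ.* recip (ι x ℚ.+ ι 0) ℚ.* ((↓ x ℚ.- ↑ 0) ℚ.* (x ⊖ 0)) ℚ.* 1ℚ
      -- The empty row acts as a part 0, whose interaction factor (x - 0)/(x + 0) is 1.
      ≡⟨ cong (λ u → u ℚ.* ((↓ x ℚ.- ↑ 0) ℚ.* (x ⊖ 0)) ℚ.* 1ℚ) (trans (cong (ℚ._* recip (ι x ℚ.+ ι 0)) (solve 1 (λ x → x :- con 0ℚ := x :+ con 0ℚ) refl (ι x))) (*-recip (ι-+-nonZero 0 0<x))) ⟩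
    1ℚ ℚ.* ((↓ x ℚ.- ↑ 0) ℚ.* (x ⊖ 0)) ℚ.* 1ℚ
      ≡⟨ ℚ.*-identityʳ _ ⟩
    1ℚ ℚ.* ((↓ x ℚ.- ↑ 0) ℚ.* (x ⊖ 0)) ∎
  new .weight-bump = refl
bumps-coefs {x ∷ xs} (x> ∷ xs↓) = top ∷ Pointwise.map⁺ (x ∷_) _ (Pointwise.map lower (bumps-coefs xs↓))
  where
  top : Bumps (x ∷ xs) (suc x ∷ xs) (x , (↑ x ℚ.- ↓ x) ℚ.* (∑[ (y , c) ∈ coefs xs ] c ℚ.* (x ⊖ y)))
  top .content-bump = begin
    rowContent (suc x) + partsContent xs         ≡⟨ cong (_+ partsContent xs) (rowContent-suc x) ⟩
    rowContent x + suc x C 2 + partsContent xs   ≡⟨ ℕ.+-assoc (rowContent x) _ _ ⟩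
    rowContent x + (suc x C 2 + partsContent xs) ≡⟨ cong (rowContent x ℕ.+_) (ℕ.+-comm (suc x C 2) _) ⟩
    rowContent x + (partsContent xs + suc x C 2) ≡⟨ ℕ.+-assoc (rowContent x) _ _ ⟨
    rowContent x + partsContent xs + suc x C 2   ∎
  top .interaction-bump {w} (_ , x<w ∷ _) = trans (cong (ℚ._* interaction w xs) (bump-lower x<w))
    (solve 3 (λ p q r → p :* q :* r := p :* r :* q) refl ((ι w ℚ.- ι x) ℚ.* recip (ι w ℚ.+ ι x)) ((↓ w ℚ.- ↑ x) ℚ.* (w ⊖ x)) (interaction w xs))
  top .weight-bump = weight-bump-head x> xs↓

  lower : ∀ {ys yc} → Bumps xs ys yc → Bumps (x ∷ xs) (x ∷ ys) (proj₁ yc , proj₂ yc ℚ.* ((↓ x ℚ.- ↑ proj₁ yc) ℚ.* (x ⊖ proj₁ yc)))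
  lower b .content-bump = trans (cong (rowContent x ℕ.+_) (b .content-bump)) (sym (ℕ.+-assoc (rowContent x) _ _))
  lower b .interaction-bump {w} (0<w , _ ∷ xs<w) =
    trans (cong ((ι w ℚ.- ι x) ℚ.* recip (ι w ℚ.+ ι x) ℚ.*_) (b .interaction-bump (0<w , xs<w))) (sym (ℚ.*-assoc ((ι w ℚ.- ι x) ℚ.* recip (ι w ℚ.+ ι x)) _ _))
  lower {ys} {y , c} b .weight-bump = begin
    factor x ℚ.* interaction x ys ℚ.* weight ys
      ≡⟨ cong₂ (λ u v → factor x ℚ.* u ℚ.* v) (b .interaction-bump x>) (b .weight-bump) ⟩
    factor x ℚ.* (interaction x xs ℚ.* ((↓ x ℚ.- ↑ y) ℚ.* (x ⊖ y))) ℚ.* (c ℚ.* weight xs)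
      ≡⟨ solve 5 (λ e i k c v → e :* (i :* k) :* (c :* v) := c :* k :* (e :* i :* v)) refl
           (factor x) (interaction x xs) ((↓ x ℚ.- ↑ y) ℚ.* (x ⊖ y)) c (weight xs) ⟩
    c ℚ.* ((↓ x ℚ.- ↑ y) ℚ.* (x ⊖ y)) ℚ.* weight (x ∷ xs) ∎

-- Sums over all bumps

∑-Pointwise : ∀ {A B : Set} {g : A → ℚ} {h : B → ℚ} {xs ys} →
  Pointwise (λ x y → g x ≡ h y) xs ys → ∑ xs g ≡ ∑ ys h
∑-Pointwise []       = refl
∑-Pointwise (p ∷ ps) = cong₂ ℚ._+_ p (∑-Pointwise ps)

∑-bumps-weight : ∀ {xs} → Strict xs → ∑ (bumps xs) weight ≡ weight xs
∑-bumps-weight {xs} xs↓ = begin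
  ∑ (bumps xs) weight                        ≡⟨ ∑-Pointwise (Pointwise.map (λ {_} {yc} b → trans (b .weight-bump) (ℚ.*-comm (proj₂ yc) (weight xs))) (bumps-coefs xs↓)) ⟩
  ∑ (coefs xs) (λ (_ , c) → weight xs ℚ.* c) ≡⟨ ∑-*ˡ (weight xs) proj₂ (coefs xs) ⟩
  weight xs ℚ.* ∑ (coefs xs) proj₂           ≡⟨ cong (weight xs ℚ.*_) (∑-coefs xs↓) ⟩
  weight xs ℚ.* 1ℚ                           ≡⟨ ℚ.*-identityʳ (weight xs) ⟩
  weight xs                                  ∎

∑-bumps-content : ∀ {xs} → Strict xs →
  (∑[ ys ∈ bumps xs ] weight ys ℚ.* (ι (partsContent ys) ℚ.- ι (partsContent xs))) ≡ ι (sum xs) ℚ.* weight xs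
∑-bumps-content {xs} xs↓ = begin
  ∑ (bumps xs) (λ ys → weight ys ℚ.* (ι (partsContent ys) ℚ.- ι (partsContent xs)))
    ≡⟨ ∑-Pointwise (Pointwise.map (λ {ys} {yc} → term ys yc) (bumps-coefs xs↓)) ⟩
  ∑ (coefs xs) (λ (y , c) → ½ ℚ.* weight xs ℚ.* (c ℚ.* ↑ y))
    ≡⟨ ∑-*ˡ (½ ℚ.* weight xs) _ (coefs xs) ⟩
  ½ ℚ.* weight xs ℚ.* ∑ (coefs xs) (λ (y , c) → c ℚ.* ↑ y)
    ≡⟨ cong (½ ℚ.* weight xs ℚ.*_) (∑-coefs-↑ xs↓) ⟩
  ½ ℚ.* weight xs ℚ.* (ι (sum xs) ℚ.+ ι (sum xs))
    ≡⟨ solve 2 (λ w s → con ½ :* w :* (s :+ s) := s :* w) refl (weight xs) (ι (sum xs)) ⟩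
  ι (sum xs) ℚ.* weight xs ∎
  where
  term : ∀ ys ((y , c) : ℕ × ℚ) → Bumps xs ys (y , c) →
    weight ys ℚ.* (ι (partsContent ys) ℚ.- ι (partsContent xs)) ≡ ½ ℚ.* weight xs ℚ.* (c ℚ.* ↑ y)
  term ys (y , c) b = begin
    weight ys ℚ.* (ι (partsContent ys) ℚ.- ι (partsContent xs))
      ≡⟨ cong₂ (λ u v → u ℚ.* (v ℚ.- ι (partsContent xs))) (b .weight-bump)
           (trans (cong ι (b .content-bump)) (trans (ι-+ (partsContent xs) (suc y C 2)) (cong (λ u → ι (partsContent xs) ℚ.+ u) (ι-C2 y)))) ⟩
    c ℚ.* weight xs ℚ.* (ι (partsContent xs) ℚ.+ ½ ℚ.* ↑ y ℚ.- ι (partsContent xs))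
      ≡⟨ solve 4 (λ c w p a → c :* w :* (p :+ con ½ :* a :- p) := con ½ :* w :* (c :* a)) refl c (weight xs) (ι (partsContent xs)) (↑ y) ⟩
    ½ ℚ.* weight xs ℚ.* (c ℚ.* ↑ y) ∎

-- Bumps that fail to be strict

below? : ∀ x xs → Dec (Below x xs)
below? x xs = (0 <? x) ×-dec All.all? (ℕ._<? x) xs

strict? : ∀ xs → Dec (Strict xs)
strict? []       = yes []
strict? (x ∷ xs) = map′ (λ (b , s) → b ∷ s) (λ { (b ∷ s) → b , s }) (below? x xs ×-dec strict? xs)

-- Two adjacent equal parts y make a factor y - y of the weight vanish.
bump-degenerate : ∀ {xs} → Strict xs → All (λ ys → Strict ys ⊎ weight ys ≡ 0ℚ) (bumps xs)
bump-degenerate [] = inj₁ ((s≤s z≤n , []) ∷ []) ∷ []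
bump-degenerate (x>@(0<x , xs<x) ∷ xs↓) =
  inj₁ ((s≤s z≤n , All.map ℕ.m<n⇒m<1+n xs<x) ∷ xs↓) ∷
  All.map⁺ (All.zipWith (λ (ys≤x , s) → step 0<x ys≤x s) (bumps-≤ x> xs↓ , bump-degenerate xs↓))
  where
  bumps-≤ : ∀ {x xs} → Below x xs → Strict xs → All (All (_≤ x)) (bumps xs)
  bumps-≤ (0<x , []) [] = (0<x ∷ []) ∷ []
  bumps-≤ (0<x , y<x ∷ ys<x) (_ ∷ ys↓) =
    (y<x ∷ All.map ℕ.<⇒≤ ys<x) ∷ All.map⁺ (All.map (ℕ.<⇒≤ y<x ∷_) (bumps-≤ (0<x , ys<x) ys↓))

  step : ∀ {x ys} → 0 < x → All (_≤ x) ys → Strict ys ⊎ weight ys ≡ 0ℚ → Strict (x ∷ ys) ⊎ weight (x ∷ ys) ≡ 0ℚ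
  step {x} {ys} 0<x _ (inj₂ w≡0) = inj₂ (trans (cong (factor x ℚ.* interaction x ys ℚ.*_) w≡0) (ℚ.*-zeroʳ (factor x ℚ.* interaction x ys)))
  step 0<x _ (inj₁ []) = inj₁ ((0<x , []) ∷ [])
  step {x} {y ∷ ys} 0<x (y≤x ∷ _) (inj₁ (b ∷ s)) with ℕ.m≤n⇒m<n∨m≡n y≤x
  ... | inj₁ y<x  = inj₁ ((0<x , y<x ∷ All.map (λ z<y → ℕ.<-trans z<y y<x) (proj₂ b)) ∷ b ∷ s)
  ... | inj₂ refl = inj₂ (solve 5 (λ f y r i w → f :* ((y :- y) :* r :* i) :* w := con 0ℚ) refl
                      (factor y) (ι y) (recip (ι y ℚ.+ ι y)) (interaction y ys) (weight (y ∷ ys)))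

-- Reindexing along a bijection

Unique-resp-↭ : {A : Set} {xs ys : List A} → xs ↭ ys → Unique xs → Unique ys
Unique-resp-↭ {A} xs↭ys = Permutation.Unique-resp-↭ (setoid A) (↭⇒↭ₛ xs↭ys)

∈⇒↭ : {A : Set} {x : A} {xs : List A} → x ∈ xs → ∃ λ ys → xs ↭ x ∷ ys
∈⇒↭ x∈xs with ∈-∃++ x∈xs
... | ys , zs , refl = ys ++ zs , shift _ ys zs

-- The bijection is a relation, so neither direction has to be written as a function, and the
-- resulting permutation serves lengths, sums in ℕ and sums in ℚ alike. The induction removes the
-- head of `xs` together with its partner in `ys`.
reindex : {A B C : Set} {g : A → C} {h : B → C} (_~_ : A → B → Set) {xs : List A} {ys : List B} →
  Unique xs → Unique ys →
  (∀ {x} → x ∈ xs → ∃ λ y → y ∈ ys × x ~ y) →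
  (∀ {y} → y ∈ ys → ∃ λ x → x ∈ xs × x ~ y) →
  (∀ {x y y′} → x ~ y → x ~ y′ → y ≡ y′) →
  (∀ {x x′ y} → x ~ y → x′ ~ y → x ≡ x′) →
  (∀ {x y} → x ∈ xs → y ∈ ys → x ~ y → g x ≡ h y) →
  map g xs ↭ map h ys
reindex _~_ {[]} {[]}    _ _ _ _ _ _ _ = ↭-refl
reindex _~_ {[]} {_ ∷ _} _ _ _ right _ _ _ with right (here refl)
... | _ , () , _
reindex {h = h} _~_ {x ∷ xs} {ys} (x∉xs ∷ xs!) ys! left right functional injective agree
  with left (here refl)
... | y , y∈ys , x~y with ∈⇒↭ y∈ys
... | ys′ , ys↭ with Unique-resp-↭ ys↭ ys!
... | y∉ys′ ∷ ys′! =
  subst (λ c → c ∷ _ ↭ map h ys) (sym (agree (here refl) y∈ys x~y))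
    (↭-trans (↭-prep (h y) (reindex _~_ xs! ys′! left′ right′ functional injective
               (λ x∈ y∈ → agree (there x∈) (∈ys y∈))))
             (↭-sym (↭-map⁺ h ys↭)))
  where
  ∈ys : ∀ {y} → y ∈ ys′ → y ∈ ys
  ∈ys y∈ = ∈-resp-↭ (↭-sym ys↭) (there y∈)

  left′ : ∀ {x′} → x′ ∈ xs → ∃ λ y′ → y′ ∈ ys′ × x′ ~ y′
  left′ x′∈ with left (there x′∈)
  ... | y′ , y′∈ , r with ∈-resp-↭ ys↭ y′∈
  ...   | there y′∈′ = y′ , y′∈′ , r
  ...   | here refl  = contradiction (injective x~y r) (All.lookup x∉xs x′∈)

  right′ : ∀ {y′} → y′ ∈ ys′ → ∃ λ x′ → x′ ∈ xs × x′ ~ y′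
  right′ y′∈ with right (∈ys y′∈)
  ... | x′ , there x′∈ , r = x′ , x′∈ , r
  ... | _  , here refl , r = contradiction (functional x~y r) (All.lookup y∉ys′ y′∈)

length-concatMap : {A B : Set} (g : A → List B) (xs : List A) →
  length (concatMap g xs) ≡ sum (map (length ∘ g) xs)
length-concatMap g []       = refl
length-concatMap g (x ∷ xs) = trans (length-++ (g x)) (cong (length (g x) ℕ.+_) (length-concatMap g xs))

-- Standard fillings

infix 4 _≺_

-- The row and the column condition on standard fillings merged, so that the argument about the
-- smallest entry treats both at once.
_≺_ : Box → Box → Set
b ≺ c = row b ≡ row c × col b < col c ⊎ col b ≡ col c × row b < row c

_≺?_ : ∀ b c → Dec (b ≺ c)
b ≺? c = ((row b ℕ.≟ row c) ×-dec (col b <? col c)) ⊎-dec ((col b ℕ.≟ col c) ×-dec (row b <? row c))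

funToFin-cong : ∀ {m n} {g h : Fin m → Fin n} → (∀ i → g i ≡ h i) → funToFin g ≡ funToFin h
funToFin-cong {zero}  eq = refl
funToFin-cong {suc m} eq = cong₂ Fin.combine (eq zero) (funToFin-cong (eq ∘ suc))

-- Fillings are only known to agree pointwise, while counting without repetition needs propositional
-- equality; passing to codes supplies it.
finToFun-injective : ∀ {m n} {j k : Fin (n ^ m)} → (∀ i → finToFun {n} {m} j i ≡ finToFun k i) → j ≡ k
finToFun-injective {m} {n} {j} {k} eq =
  trans (sym (Fin.funToFin-finToFin {m} {n} j)) (trans (funToFin-cong eq) (Fin.funToFin-finToFin {m} {n} k))

module _ {m : ℕ} (b : Fin m → Box) where

  -- The boxes form a family over `Fin m` rather than a list, so that deleting position `p` is
  -- `b ∘ punchIn p`, indexed by the very type on which the shorter filling lives.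
  Standard : (Fin m → Fin m) → Set
  Standard T = Bijective _≡_ _≡_ T × (∀ p q → b p ≺ b q → T p Fin.< T q)

  standard? : Decidable Standard
  standard? T = (injective? ×-dec surjective?) ×-dec
    Fin.all? λ p → Fin.all? λ q → (b p ≺? b q) →-dec (T p Fin.<? T q)
    where
    injective? : Dec (Injective _≡_ _≡_ T)
    injective? = map′ (λ h {p} {q} → h p q) (λ h p q → h)
      (Fin.all? λ p → Fin.all? λ q → (T p Fin.≟ T q) →-dec (p Fin.≟ q))

    surjective? : Dec (Surjective _≡_ _≡_ T)
    surjective? = map′
      (λ h y → proj₁ (h y) , λ { refl → proj₂ (h y) })
      (λ h y → proj₁ (h y) , proj₂ (h y) refl)
      (Fin.all? λ y → Fin.any? λ p → T p Fin.≟ y)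

  standardCodes : List (Fin (m ^ m))
  standardCodes = filter (λ k → standard? (finToFun k)) (allFin (m ^ m))

  Minimal : Fin m → Set
  Minimal p = ∀ q → ¬ b q ≺ b p

  minimal? : Decidable Minimal
  minimal? p = Fin.all? λ q → ¬? (b q ≺? b p)

  minimals : List (Fin m)
  minimals = filter minimal? (allFin m)

∈-standardCodes⁺ : ∀ {m} {b : Fin m → Box} {k} → Standard b (finToFun k) → k ∈ standardCodes b
∈-standardCodes⁺ {b = b} {k} s = ∈-filter⁺ (λ k → standard? b (finToFun k)) (∈-allFin k) s

∈-standardCodes⁻ : ∀ {m} {b : Fin m → Box} {k} → k ∈ standardCodes b → Standard b (finToFun k)
∈-standardCodes⁻ {m} {b} k∈ = proj₂ (∈-filter⁻ (λ k → standard? b (finToFun k)) {xs = allFin (m ^ m)} k∈)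

Standard-cong : ∀ {m} {b b′ : Fin m → Box} {T T′} → (∀ i → b i ≡ b′ i) → (∀ i → T i ≡ T′ i) → Standard b T → Standard b′ T′
Standard-cong b≗ T≗ ((inj , surj) , mono) =
  ((λ eq → inj (trans (T≗ _) (trans eq (sym (T≗ _))))) ,
   (λ y → proj₁ (surj y) , λ { refl → trans (sym (T≗ _)) (proj₂ (surj y) refl) })) ,
  λ p q lt → subst₂ Fin._<_ (T≗ p) (T≗ q) (mono p q (subst₂ _≺_ (sym (b≗ p)) (sym (b≗ q)) lt))

standardCodes-cong : ∀ {m} {b b′ : Fin m → Box} → (∀ i → b i ≡ b′ i) → standardCodes b ≡ standardCodes b′
standardCodes-cong {b = b} {b′} b≗ = filter-≐ _ _
  (Standard-cong b≗ (λ _ → refl) , Standard-cong (λ i → sym (b≗ i)) (λ _ → refl)) (allFin _)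

countStandard-codes : ∀ bs → countStandard bs ≡ length (standardCodes (lookup bs))
countStandard-codes bs = cong length (filter-≐
  (λ k → isStandard? bs (finToFun k)) (λ k → standard? (lookup bs) (finToFun k))
  ((λ (bij , rows , cols) → bij , λ p q → [ (λ (r , c) → rows p q r c) , (λ (c , r) → cols p q c r) ]′) ,
   (λ (bij , mono) → bij , (λ p q r c → mono p q (inj₁ (r , c))) , (λ p q c r → mono p q (inj₂ (c , r)))))
  (allFin (length bs ^ length bs)))

data InOrOut {m} (p : Fin (suc m)) : Fin (suc m) → Set where
  hole : InOrOut p p
  rest : ∀ i → InOrOut p (punchIn p i)

inOrOut : ∀ {m} (p q : Fin (suc m)) → InOrOut p q
inOrOut p q with p Fin.≟ q
... | yes refl = hole
... | no  p≢q  = subst (InOrOut p) (Fin.punchIn-punchOut p≢q) (rest (punchOut p≢q))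

module _ {m : ℕ} (b : Fin (suc m) → Box) where

  Removes : (Fin (suc m) → Fin (suc m)) → Fin (suc m) → (Fin m → Fin m) → Set
  Removes T p T′ = T p ≡ zero × (∀ i → T (punchIn p i) ≡ suc (T′ i))

  -- The position carrying the smallest entry is minimal because a box before it would need a
  -- smaller one; by injectivity all other entries are non-zero and can drop by one.
  remove : ∀ {T} → Standard b T → ∃ λ p → Minimal b p × ∃ λ T′ → Standard (b ∘ punchIn p) T′ × Removes T p T′
  remove {T} ((inj , surj) , mono) = p , minimal , T′ , ((inj′ , surj′) , mono′) , Tp≡0 , T-in
    where
    p = proj₁ (surj zero)

    Tp≡0 : T p ≡ zero
    Tp≡0 = proj₂ (surj zero) refl

    0≢T : ∀ i → zero ≢ T (punchIn p i)
    0≢T i eq = Fin.punchInᵢ≢i p i (inj (trans (sym eq) (sym Tp≡0)))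

    T′ : Fin m → Fin m
    T′ i = punchOut (0≢T i)

    T-in : ∀ i → T (punchIn p i) ≡ suc (T′ i)
    T-in i = sym (Fin.punchIn-punchOut (0≢T i))

    minimal : Minimal b p
    minimal q q≺p with subst (T q Fin.<_) Tp≡0 (mono q p q≺p)
    ... | ()

    inj′ : Injective _≡_ _≡_ T′
    inj′ eq = Fin.punchIn-injective p _ _ (inj (trans (T-in _) (trans (cong suc eq) (sym (T-in _)))))

    surj′ : Surjective _≡_ _≡_ T′
    surj′ y with surj (suc y)
    ... | q , Tq with inOrOut p q
    ...   | hole   = contradiction (trans (sym Tp≡0) (Tq refl)) λ ()
    ...   | rest i = i , λ { refl → Fin.suc-injective (trans (sym (T-in i)) (Tq refl)) }

    mono′ : ∀ i j → b (punchIn p i) ≺ b (punchIn p j) → T′ i Fin.< T′ j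
    mono′ i j lt = ℕ.s<s⁻¹ (subst₂ Fin._<_ (T-in i) (T-in j) (mono _ _ lt))

  insert : ∀ {p T′} → Minimal b p → Standard (b ∘ punchIn p) T′ → ∃ λ T → Standard b T × Removes T p T′
  insert {p} {T′} minimal ((inj′ , surj′) , mono′) = T , ((inj , surj) , mono) , Tp≡0 , T-in
    where
    value : ∀ {q} → InOrOut p q → Fin (suc m)
    value hole     = zero
    value (rest i) = suc (T′ i)

    T : Fin (suc m) → Fin (suc m)
    T q = value (inOrOut p q)

    value-unique : ∀ {q} (v w : InOrOut p q) → value v ≡ value w
    value-unique {q} v w = go v w refl
      where
      -- Two positions tied by an equation: unification could not solve `punchIn p i` against `p` or
      -- against `punchIn p j`.
      go : ∀ {q q′} (v : InOrOut p q) (w : InOrOut p q′) → q ≡ q′ → value v ≡ value w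
      go hole     hole     _  = refl
      go hole     (rest i) eq = contradiction (sym eq) (Fin.punchInᵢ≢i p i)
      go (rest i) hole     eq = contradiction eq (Fin.punchInᵢ≢i p i)
      go (rest i) (rest j) eq = cong (suc ∘ T′) (Fin.punchIn-injective p i j eq)

    Tp≡0 : T p ≡ zero
    Tp≡0 = value-unique (inOrOut p p) hole

    T-in : ∀ i → T (punchIn p i) ≡ suc (T′ i)
    T-in i = value-unique (inOrOut p (punchIn p i)) (rest i)

    inj : Injective _≡_ _≡_ T
    inj {q} {r} eq with inOrOut p q | inOrOut p r
    ... | hole   | hole   = refl
    ... | rest i | rest j = cong (punchIn p) (inj′ (Fin.suc-injective eq))

    surj : Surjective _≡_ _≡_ T
    surj zero    = p , λ { refl → Tp≡0 }
    surj (suc y) = punchIn p (proj₁ (surj′ y)) , λ { refl → trans (T-in _) (cong suc (proj₂ (surj′ y) refl)) }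

    mono : ∀ q r → b q ≺ b r → T q Fin.< T r
    mono q r lt with inOrOut p q | inOrOut p r
    ... | _      | hole   = contradiction lt (minimal q)
    ... | hole   | rest j = s≤s z≤n
    ... | rest i | rest j = s≤s (mono′ i j lt)

  private
    removals : List (Fin (suc m) × Fin (m ^ m))
    removals = concatMap (λ p → map (p ,_) (standardCodes (b ∘ punchIn p))) (minimals b)

    ∈-removals⁺ : ∀ {p k} → Minimal b p → Standard (b ∘ punchIn p) (finToFun k) → (p , k) ∈ removals
    ∈-removals⁺ {p} min s = ∈-concatMap⁺ (λ p → map (p ,_) (standardCodes (b ∘ punchIn p)))
      (lose (∈-filter⁺ (minimal? b) (∈-allFin p) min) (∈-map⁺ (p ,_) (∈-standardCodes⁺ {b = b ∘ punchIn p} s)))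

    ∈-removals⁻ : ∀ {p k} → (p , k) ∈ removals → Minimal b p × Standard (b ∘ punchIn p) (finToFun k)
    ∈-removals⁻ pk∈ with find (∈-concatMap⁻ (λ p → map (p ,_) (standardCodes (b ∘ punchIn p))) {xs = minimals b} pk∈)
    ... | p , p∈ , pk∈′ with ∈-map⁻ (p ,_) pk∈′
    ... | k , k∈ , refl = proj₂ (∈-filter⁻ (minimal? b) {xs = allFin (suc m)} p∈) , ∈-standardCodes⁻ {b = b ∘ punchIn p} k∈

    removals! : Unique removals
    removals! = Unique.concat⁺
      (All.map⁺ (All.universal (λ p → Unique.map⁺ ,-injectiveʳ (Unique.filter⁺ _ (Unique.allFin⁺ _))) (minimals b)))
      (AllPairs.map⁺ (AllPairs.map disjoint (Unique.filter⁺ (minimal? b) (Unique.allFin⁺ _))))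
      where
      disjoint : ∀ {p q} → p ≢ q → ∀ {x} →
        ¬ (x ∈ map (p ,_) (standardCodes (b ∘ punchIn p)) × x ∈ map (q ,_) (standardCodes (b ∘ punchIn q)))
      disjoint p≢q (x∈p , x∈q) with ∈-map⁻ _ x∈p | ∈-map⁻ _ x∈q
      ... | _ , _ , refl | _ , _ , eq = p≢q (,-injectiveˡ eq)

    -- Standardness is part of the relation because injectivity of the filling is what determines
    -- `p`, the place of its smallest entry.
    data _~_ (k : Fin (suc m ^ suc m)) : Fin (suc m) × Fin (m ^ m) → Set where
      removes : ∀ {p k′} → Standard b (finToFun k) → Removes (finToFun k) p (finToFun k′) → k ~ (p , k′)

  length-standardCodes : length (standardCodes b) ≡ sum (map (λ p → length (standardCodes (b ∘ punchIn p))) (minimals b))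
  length-standardCodes = begin
    -- Only cardinalities matter, so both lists are mapped to zeros to bring them into the form of
    -- `reindex`.
    length (standardCodes b)                 ≡⟨ length-map (λ _ → 0) (standardCodes b) ⟨
    length (map (λ _ → 0) (standardCodes b)) ≡⟨ ↭-length (reindex _~_ (Unique.filter⁺ _ (Unique.allFin⁺ _)) removals! left right functional injective (λ _ _ _ → refl)) ⟩
    length (map (λ _ → 0) removals)          ≡⟨ length-map (λ _ → 0) removals ⟩
    length removals                          ≡⟨ length-concatMap _ (minimals b) ⟩
    sum (map (λ p → length (map (p ,_) (standardCodes (b ∘ punchIn p)))) (minimals b))
      ≡⟨ cong sum (map-cong (λ p → length-map (p ,_) (standardCodes (b ∘ punchIn p))) (minimals b)) ⟩
    sum (map (λ p → length (standardCodes (b ∘ punchIn p))) (minimals b)) ∎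
    where
    left : ∀ {k} → k ∈ standardCodes b → ∃ λ y → y ∈ removals × k ~ y
    left k∈ with ∈-standardCodes⁻ {b = b} k∈
    ... | s with remove s
    ... | p , min , T′ , s′ , Tp≡0 , T-in =
      (p , funToFin T′) , ∈-removals⁺ min (Standard-cong (λ _ → refl) (λ i → sym (Fin.finToFun-funToFin T′ i)) s′) ,
      removes s (Tp≡0 , λ i → trans (T-in i) (cong suc (sym (Fin.finToFun-funToFin T′ i))))

    right : ∀ {y} → y ∈ removals → ∃ λ k → k ∈ standardCodes b × k ~ y
    right {p , k′} y∈ =
      let min , s′ = ∈-removals⁻ y∈
          T , s , Tp≡0 , T-in = insert min s′
          s″ = Standard-cong {b = b} {b} {T} {finToFun (funToFin T)} (λ _ → refl) (λ i → sym (Fin.finToFun-funToFin T i)) s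
      in funToFin T , ∈-standardCodes⁺ {b = b} {funToFin T} s″ ,
         removes s″ (trans (Fin.finToFun-funToFin T p) Tp≡0 , λ i → trans (Fin.finToFun-funToFin T (punchIn p i)) (T-in i))

    functional : ∀ {k y y′} → k ~ y → k ~ y′ → y ≡ y′
    functional {k} (removes {p} {j} ((inj , _) , _) (Tp , T-in)) (removes {p′} {j′} _ (Tp′ , T-in′))
      with inj {p} {p′} (trans Tp (sym Tp′))
    ... | refl = cong (p ,_) (finToFun-injective {m} {m} λ i → Fin.suc-injective (trans (sym (T-in i)) (T-in′ i)))

    injective : ∀ {k k′ y} → k ~ y → k′ ~ y → k ≡ k′
    injective {k} {k′} (removes {p} {j} _ (Tp , T-in)) (removes _ (Tp′ , T-in′)) = finToFun-injective {suc m} {suc m} pointwise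
      where
      pointwise : ∀ q → finToFun {suc m} {suc m} k q ≡ finToFun k′ q
      pointwise q with inOrOut p q
      ... | hole   = trans Tp (sym Tp′)
      ... | rest i = trans (T-in i) (sym (T-in′ i))

lookup-removeAt : {A : Set} (x : A) (xs : List A) (p : Fin (suc (length xs))) .(eq : length (removeAt (x ∷ xs) p) ≡ length xs) →
  ∀ i → lookup (removeAt (x ∷ xs) p) i ≡ lookup (x ∷ xs) (punchIn p (Fin.cast eq i))
lookup-removeAt x xs zero eq i = cong (lookup xs) (sym (Fin.cast-is-id eq i))
lookup-removeAt x (y ∷ xs) (suc p) eq zero    = refl
lookup-removeAt x (y ∷ xs) (suc p) eq (suc i) = lookup-removeAt y xs p (ℕ.suc-injective eq) i

length-standardCodes-cast : ∀ {m n} (b : Fin m → Box) (b′ : Fin n → Box) (eq : m ≡ n) → (∀ i → b i ≡ b′ (Fin.cast eq i)) →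
  length (standardCodes b) ≡ length (standardCodes b′)
length-standardCodes-cast b b′ refl b≗ = cong length (standardCodes-cong λ i → trans (b≗ i) (cong b′ (Fin.cast-is-id refl i)))

countStandard-removeAt : ∀ x xs → countStandard (x ∷ xs) ≡
  sum (map (λ p → countStandard (removeAt (x ∷ xs) p)) (minimals (lookup (x ∷ xs))))
countStandard-removeAt x xs = begin
  countStandard (x ∷ xs)   ≡⟨ countStandard-codes (x ∷ xs) ⟩
  length (standardCodes b) ≡⟨ length-standardCodes b ⟩
  sum (map (λ p → length (standardCodes (b ∘ punchIn p))) (minimals b))
    ≡⟨ cong sum (map-cong remaining (minimals b)) ⟩
  sum (map (λ p → countStandard (removeAt (x ∷ xs) p)) (minimals b)) ∎
  where
  b = lookup (x ∷ xs)

  remaining : ∀ p → length (standardCodes (b ∘ punchIn p)) ≡ countStandard (removeAt (x ∷ xs) p)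
  remaining p = begin
    length (standardCodes (b ∘ punchIn p))
      ≡⟨ length-standardCodes-cast (lookup (removeAt (x ∷ xs) p)) (b ∘ punchIn p) (length-removeAt (x ∷ xs) p)
           (lookup-removeAt x xs p (length-removeAt (x ∷ xs) p)) ⟨
    length (standardCodes (lookup (removeAt (x ∷ xs) p)))
      ≡⟨ countStandard-codes (removeAt (x ∷ xs) p) ⟨
    countStandard (removeAt (x ∷ xs) p) ∎

-- Hook lengths

boxRow : ℕ → ℕ → List Box
boxRow s x = map (λ k → s , s + k) (1⋯ x)

boxesFrom : ℕ → List ℕ → List Box
boxesFrom s []       = []
boxesFrom s (x ∷ xs) = boxRow s x ++ boxesFrom (suc s) xs

boxes-parts : ∀ ν → boxes ν ≡ boxesFrom 1 (parts ν)
boxes-parts ν = go 1 suc (parts ν) (ℕ.+-comm 1) λ _ → refl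
  where
  -- The row numbering `r` is generalised because the recursion sees only a tail of the list,
  -- whereas `part ν` refers to all the parts.
  go : ∀ s (r : ℕ → ℕ) xs → (∀ j → r j ≡ j + s) → (∀ j → part ν (r j) ≡ nth xs (suc j)) →
    concatMap (λ i → boxRow i (part ν i)) (applyUpTo r (length xs)) ≡ boxesFrom s xs
  go s r []       r≡ part≡ = refl
  go s r (x ∷ xs) r≡ part≡ = cong₂ _++_ (cong₂ boxRow (r≡ 0) (part≡ 0))
    (go (suc s) (r ∘ suc) xs (λ j → trans (r≡ (suc j)) (sym (ℕ.+-suc j s))) (part≡ ∘ suc))

1⋯-∷ʳ : ∀ n → 1⋯ (suc n) ≡ 1⋯ n ++ suc n ∷ []
1⋯-∷ʳ n = sym (applyUpTo-∷ʳ suc n)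

1⋯-positive : ∀ n → All (0 <_) (1⋯ n)
1⋯-positive n = All.applyUpTo⁺₂ suc n (λ _ → s≤s z≤n)

1⋯-≤ : ∀ n → All (_≤ n) (1⋯ n)
1⋯-≤ n = All.applyUpTo⁺₁ suc n (λ i<n → i<n)

boxesFrom-bounds : ∀ s xs → All (λ b → s ≤ row b × row b < col b) (boxesFrom s xs)
boxesFrom-bounds s []       = []
boxesFrom-bounds s (x ∷ xs) = All.++⁺
  (All.map⁺ (All.map (λ 0<k → ℕ.≤-refl , ℕ.m<m+n s 0<k) (1⋯-positive x)))
  (All.map (λ (s<r , r<c) → ℕ.<⇒≤ s<r , r<c) (boxesFrom-bounds (suc s) xs))

contentSum-parts : ∀ ν → contentSum ν ≡ partsContent (parts ν)
contentSum-parts ν = trans (cong (λ bs → sum (map (λ b → content b C 2) bs)) (boxes-parts ν)) (go 1 (parts ν))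
  where
  go : ∀ s xs → sum (map (λ b → content b C 2) (boxesFrom s xs)) ≡ partsContent xs
  go s []       = refl
  go s (x ∷ xs) = begin
    sum (map (λ b → content b C 2) (boxRow s x ++ boxesFrom (suc s) xs))
      ≡⟨ cong sum (map-++ _ (boxRow s x) _) ⟩
    sum (map (λ b → content b C 2) (boxRow s x) ++ map (λ b → content b C 2) (boxesFrom (suc s) xs))
      ≡⟨ sum-++ (map (λ b → content b C 2) (boxRow s x)) _ ⟩
    sum (map (λ b → content b C 2) (boxRow s x)) + sum (map (λ b → content b C 2) (boxesFrom (suc s) xs))
      ≡⟨ cong₂ _+_ (cong sum (trans (sym (map-∘ (1⋯ x))) (map-cong (λ k → cong (_C 2) (ℕ.m+n∸m≡n s k)) (1⋯ x)))) (go (suc s) xs) ⟩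
    rowContent x + partsContent xs ∎

-- In what follows, the rows of the diagram with parts xs are numbered from s on.

armFrom legFrom hookFrom : ℕ → List ℕ → Box → ℕ
armFrom s xs b = length (filter (λ c → (row c ℕ.≟ row b) ×-dec (col b <? col c)) (boxesFrom s xs))
legFrom s xs b = length (filter (λ c → (col c ℕ.≟ col b) ×-dec (row b <? row c)) (boxesFrom s xs))
hookFrom s xs b = suc (armFrom s xs b + legFrom s xs b + nth xs (suc (col b) ∸ s))

hooksFrom : ℕ → List ℕ → ℕ
hooksFrom s xs = product (map (hookFrom s xs) (boxesFrom s xs))

H-from : ∀ ν → H ν ≡ hooksFrom 1 (parts ν)
H-from ν = trans (cong product (map-cong hook≡ (boxes ν))) (cong (λ bs → product (map (hookFrom 1 (parts ν)) bs)) (boxes-parts ν))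
  where
  hook≡ : ∀ b → hook ν b ≡ hookFrom 1 (parts ν) b
  hook≡ b = cong (λ bs → suc (length (filter (λ c → (row c ℕ.≟ row b) ×-dec (col b <? col c)) bs) +
                              length (filter (λ c → (col c ℕ.≟ col b) ×-dec (row b <? row c)) bs) + part ν (col b)))
              (boxes-parts ν)

-- The indicator of 1 ≤ k ≤ y, written as a count along a row of length y because that is how
-- filtering a row produces it.
hits : ℕ → ℕ → ℕ
hits zero    k = 0
hits (suc y) k with suc y ℕ.≟ k
... | yes _ = suc (hits y k)
... | no  _ = hits y k

hits-> : ∀ {y k} → y < k → hits y k ≡ 0
hits-> {zero}      _ = refl
hits-> {suc y} {k} 1+y<k with suc y ℕ.≟ k
... | yes refl = contradiction 1+y<k (ℕ.<-irrefl refl)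
... | no  _    = hits-> (ℕ.<⇒≤ 1+y<k)

hits-≤ : ∀ {y k} → 0 < k → k ≤ y → hits y k ≡ 1
hits-≤ {zero}      0<k k≤0 = contradiction (ℕ.<-≤-trans 0<k k≤0) λ ()
hits-≤ {suc y} {k} 0<k k≤1+y with suc y ℕ.≟ k
... | yes refl = cong suc (hits-> {y} ℕ.≤-refl)
... | no  1+y≢k = hits-≤ 0<k (ℕ.≤-pred (ℕ.≤∧≢⇒< k≤1+y (1+y≢k ∘ sym)))

hits-0 : ∀ y → hits y 0 ≡ 0
hits-0 zero    = refl
hits-0 (suc y) = hits-0 y

module _ {P : Pred Box 0ℓ} (P? : Decidable P) where

  length-filter-++ : ∀ bs cs → length (filter P? (bs ++ cs)) ≡ length (filter P? bs) + length (filter P? cs)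
  length-filter-++ bs cs = trans (cong length (filter-++ P? bs cs)) (length-++ (filter P? bs))

  length-filter-none : ∀ {bs} → All (λ b → ¬ P b) bs → length (filter P? bs) ≡ 0
  length-filter-none ¬P = cong length (filter-none P? ¬P)

  length-filter-boxRow-suc : ∀ s x → length (filter P? (boxRow s (suc x))) ≡
    length (filter P? (boxRow s x)) + length (filter P? ((s , s + suc x) ∷ []))
  length-filter-boxRow-suc s x = trans
    (cong (length ∘ filter P?) (trans (cong (map _) (1⋯-∷ʳ x)) (map-++ _ (1⋯ x) _)))
    (length-filter-++ (boxRow s x) _)

  length-filter-> : ∀ s k → (∀ j → P (s , s + j) ⇔ k < j) → ∀ x → length (filter P? (boxRow s x)) ≡ x ∸ k
  length-filter-> s k P⇔ zero    = sym (ℕ.0∸n≡0 k)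
  length-filter-> s k P⇔ (suc x) = trans (length-filter-boxRow-suc s x) (trans (cong (_+ length (filter P? ((s , s + suc x) ∷ []))) (length-filter-> s k P⇔ x)) last)
    where
    last : x ∸ k + length (filter P? ((s , s + suc x) ∷ [])) ≡ suc x ∸ k
    last with k ≤? x
    ... | yes k≤x rewrite filter-accept P? {xs = []} (Equivalence.from (P⇔ (suc x)) (s≤s k≤x)) =
            trans (ℕ.+-comm _ 1) (sym (ℕ.+-∸-assoc 1 k≤x))
    ... | no  k≰x rewrite filter-reject P? {xs = []} (k≰x ∘ ℕ.≤-pred ∘ Equivalence.to (P⇔ (suc x))) =
            trans (ℕ.+-identityʳ _) (trans (ℕ.m≤n⇒m∸n≡0 (ℕ.<⇒≤ (ℕ.≰⇒> k≰x))) (sym (ℕ.m≤n⇒m∸n≡0 (ℕ.≰⇒> k≰x))))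

  length-filter-≡ : ∀ s k → (∀ j → P (s , s + j) ⇔ j ≡ k) → ∀ x → length (filter P? (boxRow s x)) ≡ hits x k
  length-filter-≡ s k P⇔ zero    = refl
  length-filter-≡ s k P⇔ (suc x) = trans (length-filter-boxRow-suc s x) (trans (cong (_+ length (filter P? ((s , s + suc x) ∷ []))) (length-filter-≡ s k P⇔ x)) last)
    where
    last : hits x k + length (filter P? ((s , s + suc x) ∷ [])) ≡ hits (suc x) k
    last with suc x ℕ.≟ k
    ... | yes 1+x≡k rewrite filter-accept P? {xs = []} (Equivalence.from (P⇔ (suc x)) 1+x≡k) = ℕ.+-comm (hits x k) 1
    ... | no  1+x≢k rewrite filter-reject P? {xs = []} (1+x≢k ∘ Equivalence.to (P⇔ (suc x))) = ℕ.+-identityʳ (hits x k)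

-- The leg of the k-th box of a row placed on top of the rows xs.
colCount : List ℕ → ℕ → ℕ
colCount _        zero    = 0
colCount []       (suc k) = 0
colCount (y ∷ ys) (suc k) = hits y k + colCount ys k

-- A fixed column is at distance k from the diagonal in one row and one less in the next. At
-- distance 0 it has met the diagonal, and every box further down lies strictly to its right.
length-filter-column : {P : Pred Box 0ℓ} (P? : Decidable P) → ∀ t k → (∀ {c} → t < row c → P c ⇔ col c ≡ t + k) →
  ∀ xs → length (filter P? (boxesFrom (suc t) xs)) ≡ colCount xs k
length-filter-column P? t zero P⇔ xs = length-filter-none P? (All.map
  (λ (t<r , r<c) Pc → ℕ.<⇒≢ (ℕ.<-trans t<r r<c) (sym (trans (Equivalence.to (P⇔ t<r) Pc) (ℕ.+-identityʳ t))))
  (boxesFrom-bounds (suc t) xs))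
length-filter-column P? t (suc k) P⇔ [] = refl
length-filter-column P? t (suc k) P⇔ (y ∷ ys) = trans (length-filter-++ P? (boxRow (suc t) y) _) (cong₂ _+_
  (length-filter-≡ P? (suc t) k (λ j → mk⇔
    (λ p → ℕ.+-cancelˡ-≡ (suc t) j k (trans (Equivalence.to (P⇔ ℕ.≤-refl) p) (ℕ.+-suc t k)))
    (λ { refl → Equivalence.from (P⇔ ℕ.≤-refl) (sym (ℕ.+-suc t k)) })) y)
  (length-filter-column P? (suc t) k (λ t<r → mk⇔
    (λ p → trans (Equivalence.to (P⇔ (ℕ.<⇒≤ t<r)) p) (ℕ.+-suc t k))
    (λ c≡ → Equivalence.from (P⇔ (ℕ.<⇒≤ t<r)) (trans c≡ (sym (ℕ.+-suc t k))))) ys))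

firstRowHook : ℕ → List ℕ → ℕ → ℕ
firstRowHook x xs k = suc (x ∸ k + colCount xs k + nth xs k)

firstRowHooks : ℕ → List ℕ → ℕ
firstRowHooks x xs = product (map (firstRowHook x xs) (1⋯ x))

nth-∷ : ∀ x xs {k} → 0 < k → nth (x ∷ xs) (suc k) ≡ nth xs k
nth-∷ x xs {suc k} _ = refl

-- The k-th box of row s is in column s + k, and the part with that number is the k-th of `xs`: this
-- is the summand λⱼ of the hook.
hookFrom-first : ∀ s x xs {k} → 0 < k → hookFrom s (x ∷ xs) (s , s + k) ≡ firstRowHook x xs k
hookFrom-first s x xs {k} 0<k = cong suc (cong₂ _+_ (cong₂ _+_ arm≡ leg≡) nth≡)
  where
  b = s , s + k

  arm≡ : armFrom s (x ∷ xs) b ≡ x ∸ k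
  arm≡ = begin
    armFrom s (x ∷ xs) b ≡⟨ length-filter-++ _ (boxRow s x) _ ⟩
    _                    ≡⟨ cong₂ _+_
      (length-filter-> _ s k (λ j → mk⇔ (λ (_ , lt) → ℕ.+-cancelˡ-< s k j lt) (λ lt → refl , ℕ.+-monoʳ-< s lt)) x)
      (length-filter-none _ (All.map (λ (s<r , _) (r≡s , _) → ℕ.<⇒≢ s<r (sym r≡s)) (boxesFrom-bounds (suc s) xs))) ⟩
    x ∸ k + 0 ≡⟨ ℕ.+-identityʳ _ ⟩
    x ∸ k     ∎

  leg≡ : legFrom s (x ∷ xs) b ≡ colCount xs k
  leg≡ = trans (length-filter-++ _ (boxRow s x) _) (cong₂ _+_
    (length-filter-none _ (All.map⁺ (All.universal (λ _ (_ , s<s) → ℕ.<-irrefl refl s<s) (1⋯ x))))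
    (length-filter-column _ s k (λ s<r → mk⇔ proj₁ (_, s<r)) xs))

  nth≡ : nth (x ∷ xs) (suc (s + k) ∸ s) ≡ nth xs k
  nth≡ = trans (cong (nth (x ∷ xs)) (trans (cong (_∸ s) (sym (ℕ.+-suc s k))) (ℕ.m+n∸m≡n s (suc k)))) (nth-∷ x xs 0<k)

-- Arm and leg look only at the row of `b` and further down, and the summand λⱼ belongs to the row
-- numbered `col b`, which is lower still; so the top row has no influence.
hookFrom-rest : ∀ s x xs {b} → s < row b → row b < col b → hookFrom s (x ∷ xs) b ≡ hookFrom (suc s) xs b
hookFrom-rest s x xs {b} s<r r<c = cong suc (cong₂ _+_ (cong₂ _+_ arm≡ leg≡) nth≡)
  where
  arm≡ : armFrom s (x ∷ xs) b ≡ armFrom (suc s) xs b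
  arm≡ = trans (length-filter-++ _ (boxRow s x) _) (cong (_+ _)
    (length-filter-none _ (All.map⁺ (All.universal (λ _ (s≡r , _) → ℕ.<⇒≢ s<r s≡r) (1⋯ x)))))

  leg≡ : legFrom s (x ∷ xs) b ≡ legFrom (suc s) xs b
  leg≡ = trans (length-filter-++ _ (boxRow s x) _) (cong (_+ _)
    (length-filter-none _ (All.map⁺ (All.universal (λ _ (_ , r<s) → ℕ.<-asym s<r r<s) (1⋯ x)))))

  s<c : s < col b
  s<c = ℕ.<-trans s<r r<c

  nth≡ : nth (x ∷ xs) (suc (col b) ∸ s) ≡ nth xs (col b ∸ s)
  nth≡ = trans (cong (nth (x ∷ xs)) (ℕ.+-∸-assoc 1 (ℕ.<⇒≤ s<c))) (nth-∷ x xs (ℕ.m<n⇒0<n∸m s<c))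

hooksFrom-∷ : ∀ s x xs → hooksFrom s (x ∷ xs) ≡ firstRowHooks x xs * hooksFrom (suc s) xs
hooksFrom-∷ s x xs = begin
  product (map (hookFrom s (x ∷ xs)) (boxRow s x ++ boxesFrom (suc s) xs))
    ≡⟨ cong product (map-++ _ (boxRow s x) _) ⟩
  product (map (hookFrom s (x ∷ xs)) (boxRow s x) ++ map (hookFrom s (x ∷ xs)) (boxesFrom (suc s) xs))
    ≡⟨ product-++ (map (hookFrom s (x ∷ xs)) (boxRow s x)) _ ⟩
  product (map (hookFrom s (x ∷ xs)) (boxRow s x)) * product (map (hookFrom s (x ∷ xs)) (boxesFrom (suc s) xs))
    ≡⟨ cong₂ _*_
         (cong product (trans (sym (map-∘ (1⋯ x))) (map-cong-local (All.map (hookFrom-first s x xs) (1⋯-positive x)))))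
         (cong product (map-cong-local (All.map (λ (s<r , r<c) → hookFrom-rest s x xs s<r r<c) (boxesFrom-bounds (suc s) xs)))) ⟩
  firstRowHooks x xs * hooksFrom (suc s) xs ∎

∏ : (ℕ → ℕ) → ℕ → ℕ
∏ g n = product (map g (1⋯ n))

∏-head : ∀ g n → ∏ g (suc n) ≡ g 1 * ∏ (g ∘ suc) n
∏-head g n = cong (λ l → g 1 * product l) (trans (map-applyUpTo (λ k → suc (suc k)) g n) (sym (map-applyUpTo suc (g ∘ suc) n)))

∏-last : ∀ g n → ∏ g (suc n) ≡ ∏ g n * g (suc n)
∏-last g n = begin
  product (map g (1⋯ (suc n)))             ≡⟨ cong (product ∘ map g) (1⋯-∷ʳ n) ⟩
  product (map g (1⋯ n ++ suc n ∷ []))     ≡⟨ cong product (map-++ g (1⋯ n) _) ⟩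
  product (map g (1⋯ n) ++ g (suc n) ∷ []) ≡⟨ product-++ (map g (1⋯ n)) _ ⟩
  ∏ g n * (g (suc n) * 1)                  ≡⟨ cong (∏ g n *_) (ℕ.*-identityʳ _) ⟩
  ∏ g n * g (suc n)                        ∎

∏-+ : ∀ g m n → ∏ g (m + n) ≡ ∏ g m * ∏ (λ k → g (m + k)) n
∏-+ g m zero    = trans (cong (∏ g) (ℕ.+-identityʳ m)) (sym (ℕ.*-identityʳ _))
∏-+ g m (suc n) = begin
  ∏ g (m + suc n)                                 ≡⟨ cong (∏ g) (ℕ.+-suc m n) ⟩
  ∏ g (suc (m + n))                               ≡⟨ ∏-last g (m + n) ⟩
  ∏ g (m + n) * g (suc (m + n))                   ≡⟨ cong₂ _*_ (∏-+ g m n) (cong g (sym (ℕ.+-suc m n))) ⟩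
  ∏ g m * ∏ (λ k → g (m + k)) n * g (m + suc n)   ≡⟨ ℕ.*-assoc (∏ g m) _ _ ⟩
  ∏ g m * (∏ (λ k → g (m + k)) n * g (m + suc n)) ≡⟨ cong (∏ g m *_) (∏-last (λ k → g (m + k)) n) ⟨
  ∏ g m * ∏ (λ k → g (m + k)) (suc n)             ∎

∏-cong : ∀ {g h} n → (∀ {k} → 0 < k → k ≤ n → g k ≡ h k) → ∏ g n ≡ ∏ h n
∏-cong n eq = cong product (map-cong-local (All.zipWith (λ (0<k , k≤n) → eq 0<k k≤n) (1⋯-positive n , 1⋯-≤ n)))

∏-! : ∀ n → ∏ (λ k → suc (n ∸ k)) n ≡ n !
∏-! zero    = refl
∏-! (suc n) = trans (∏-head (λ k → suc (suc n ∸ k)) n) (cong (suc n *_) (∏-! n))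

-- The i-th part of `ys` is at most y - i, while its row meets the column at distance k - i, which
-- is larger. Being positive, the parts are also fewer than y in number, so there is no k-th one.
beyond : ∀ {y ys k} → Below y ys → Strict ys → y < k → colCount ys k ≡ 0 × nth ys k ≡ 0
beyond {ys = []} {suc k} _ _ _ = refl , refl
beyond {y} {z ∷ zs} {suc k} (_ , z<y ∷ _) (z> ∷ zs↓) (s≤s y≤k) with beyond z> zs↓ (ℕ.<-≤-trans z<y y≤k)
... | c≡0 , n≡0 = cong₂ _+_ (hits-> (ℕ.<-≤-trans z<y y≤k)) c≡0 , trans (nth-∷ z zs (ℕ.<-≤-trans (ℕ.≤-<-trans z≤n z<y) y≤k)) n≡0

∏∸ ∏+ : ℕ → List ℕ → ℕ
∏∸ x ys = product (map (x ∸_) ys)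
∏+ x ys = product (map (x ℕ.+_) ys)

-- Deleting the first part y of xs leaves the k-th hook of the row unchanged up to reindexing for
-- k ≤ y; beyond that the hooks are consecutive integers down to 1, with and without y.
firstRowHooks-closed : ∀ {x xs} → Below x xs → Strict xs → firstRowHooks x xs * ∏∸ x xs ≡ x ! * ∏+ x xs
firstRowHooks-closed {x} {[]} _ _ = cong (_* 1) (trans (∏-cong x (λ {k} 0<k _ → hook≡ 0<k)) (∏-! x))
  where
  hook≡ : ∀ {k} → 0 < k → firstRowHook x [] k ≡ suc (x ∸ k)
  hook≡ {suc k} _ = cong suc (trans (ℕ.+-identityʳ _) (ℕ.+-identityʳ _))
firstRowHooks-closed {x} {y ∷ ys} (0<x , y<x ∷ ys<x) (y>@(0<y , _) ∷ ys↓) = begin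
  firstRowHooks x (y ∷ ys) * ((x ∸ y) * ∏∸ x ys)
    ≡⟨ cong (_* ((x ∸ y) * ∏∸ x ys)) hooks∷ ⟩
  (x + y) * (∏ (firstRowHook x ys) y * d !) * ((x ∸ y) * ∏∸ x ys)
    ≡⟨ cong (λ e → (x + y) * (∏ (firstRowHook x ys) y * d !) * (e * ∏∸ x ys)) x∸y ⟩
  (x + y) * (∏ (firstRowHook x ys) y * d !) * (suc d * ∏∸ x ys)
    ≡⟨ (ℕ-solve 5 (λ a p f e q → a ⊗ (p ⊗ f) ⊗ (e ⊗ q) ≋ a ⊗ (p ⊗ (e ⊗ f) ⊗ q)) refl
          (x + y) (∏ (firstRowHook x ys) y) (d !) (suc d) (∏∸ x ys)) ⟩
  (x + y) * (∏ (firstRowHook x ys) y * suc d ! * ∏∸ x ys)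
    ≡⟨ cong (λ p → (x + y) * (p * ∏∸ x ys)) hooks ⟨
  (x + y) * (firstRowHooks x ys * ∏∸ x ys)
    ≡⟨ cong ((x + y) *_) (firstRowHooks-closed (0<x , ys<x) ys↓) ⟩
  (x + y) * (x ! * ∏+ x ys)
    ≡⟨ (ℕ-solve 3 (λ a f q → a ⊗ (f ⊗ q) ≋ f ⊗ (a ⊗ q)) refl (x + y) (x !) (∏+ x ys)) ⟩
  x ! * ((x + y) * ∏+ x ys) ∎
  where
  d = x ∸ suc y

  x≡ : x ≡ suc (y + d)
  x≡ = sym (ℕ.m+[n∸m]≡n y<x)

  x≡′ : x ≡ y + suc d
  x≡′ = trans x≡ (sym (ℕ.+-suc y d))

  x∸y : x ∸ y ≡ suc d
  x∸y = trans (cong (_∸ y) x≡′) (ℕ.m+n∸m≡n y (suc d))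

  hooks : firstRowHooks x ys ≡ ∏ (firstRowHook x ys) y * suc d !
  hooks = begin
    ∏ (firstRowHook x ys) x           ≡⟨ cong (∏ (firstRowHook x ys)) x≡′ ⟩
    ∏ (firstRowHook x ys) (y + suc d) ≡⟨ ∏-+ (firstRowHook x ys) y (suc d) ⟩
    ∏ (firstRowHook x ys) y * ∏ (λ j → firstRowHook x ys (y + j)) (suc d)
      ≡⟨ cong (∏ (firstRowHook x ys) y *_) (trans (∏-cong (suc d) (λ 0<j _ → hook≡ 0<j)) (∏-! (suc d))) ⟩
    ∏ (firstRowHook x ys) y * suc d ! ∎
    where
    hook≡ : ∀ {j} → 0 < j → firstRowHook x ys (y + j) ≡ suc (suc d ∸ j)
    hook≡ {j} 0<j with beyond y> ys↓ (ℕ.m<m+n y 0<j)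
    ... | c≡0 , n≡0 = cong suc (begin
      x ∸ (y + j) + colCount ys (y + j) + nth ys (y + j) ≡⟨ cong₂ (λ c n → x ∸ (y + j) + c + n) c≡0 n≡0 ⟩
      x ∸ (y + j) + 0 + 0                                ≡⟨ trans (ℕ.+-identityʳ _) (ℕ.+-identityʳ _) ⟩
      x ∸ (y + j)                                        ≡⟨ cong (_∸ (y + j)) x≡′ ⟩
      y + suc d ∸ (y + j)                                ≡⟨ ℕ.[m+n]∸[m+o]≡n∸o y (suc d) j ⟩
      suc d ∸ j                                          ∎)

  hooks∷ : firstRowHooks x (y ∷ ys) ≡ (x + y) * (∏ (firstRowHook x ys) y * d !)
  hooks∷ = begin
    ∏ (firstRowHook x (y ∷ ys)) x             ≡⟨ cong (∏ (firstRowHook x (y ∷ ys))) x≡ ⟩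
    ∏ (firstRowHook x (y ∷ ys)) (suc (y + d)) ≡⟨ ∏-head (firstRowHook x (y ∷ ys)) (y + d) ⟩
    firstRowHook x (y ∷ ys) 1 * ∏ (firstRowHook x (y ∷ ys) ∘ suc) (y + d)
      ≡⟨ cong₂ _*_ first (∏-+ (firstRowHook x (y ∷ ys) ∘ suc) y d) ⟩
    (x + y) * (∏ (firstRowHook x (y ∷ ys) ∘ suc) y * ∏ (λ j → firstRowHook x (y ∷ ys) (suc (y + j))) d)
      ≡⟨ cong (λ p → (x + y) * p) (cong₂ _*_ (∏-cong y near) (trans (∏-cong d (λ 0<j _ → far 0<j)) (∏-! d))) ⟩
    (x + y) * (∏ (firstRowHook x ys) y * d !) ∎
    where
    -- The first box has nothing below it in its column, so its hook is the row length x plus the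
    -- summand λⱼ = y.
    first : firstRowHook x (y ∷ ys) 1 ≡ x + y
    first = begin
      suc (x ∸ 1 + (hits y 0 + 0) + y) ≡⟨ cong (λ h → suc (x ∸ 1 + h + y)) (trans (ℕ.+-identityʳ _) (hits-0 y)) ⟩
      suc (x ∸ 1 + 0 + y)              ≡⟨ cong (λ h → suc (h + y)) (ℕ.+-identityʳ (x ∸ 1)) ⟩
      suc (x ∸ 1) + y                  ≡⟨ cong (_+ y) (ℕ.m+[n∸m]≡n 0<x) ⟩
      x + y                            ∎

    -- Compared with the k-th box over `ys`, the arm loses one box and the leg gains the one in the
    -- row of `y`.
    near : ∀ {k} → 0 < k → k ≤ y → firstRowHook x (y ∷ ys) (suc k) ≡ firstRowHook x ys k
    near {k} 0<k k≤y = cong suc (begin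
      x ∸ suc k + (hits y k + colCount ys k) + nth (y ∷ ys) (suc k)
        ≡⟨ cong₂ (λ h n → x ∸ suc k + (h + colCount ys k) + n) (hits-≤ 0<k k≤y) (nth-∷ y ys 0<k) ⟩
      x ∸ suc k + suc (colCount ys k) + nth ys k
        ≡⟨ cong (_+ nth ys k) (ℕ.+-suc (x ∸ suc k) _) ⟩
      suc (x ∸ suc k) + colCount ys k + nth ys k
        ≡⟨ cong (λ e → e + colCount ys k + nth ys k) (sym (ℕ.+-∸-assoc 1 (ℕ.≤-<-trans k≤y y<x))) ⟩
      x ∸ k + colCount ys k + nth ys k ∎)

    far : ∀ {j} → 0 < j → firstRowHook x (y ∷ ys) (suc (y + j)) ≡ suc (d ∸ j)
    far {j} 0<j with beyond y> ys↓ (ℕ.m<m+n y 0<j)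
    ... | c≡0 , n≡0 = cong suc (begin
      x ∸ suc (y + j) + (hits y (y + j) + colCount ys (y + j)) + nth (y ∷ ys) (suc (y + j))
        ≡⟨ cong₂ (λ c n → x ∸ suc (y + j) + c + n) (cong₂ _+_ (hits-> (ℕ.m<m+n y 0<j)) c≡0)
             (trans (nth-∷ y ys (ℕ.<-≤-trans 0<j (ℕ.m≤n+m j y))) n≡0) ⟩
      x ∸ suc (y + j) + 0 + 0 ≡⟨ trans (ℕ.+-identityʳ _) (ℕ.+-identityʳ _) ⟩
      x ∸ suc (y + j)         ≡⟨ cong (_∸ suc (y + j)) x≡ ⟩
      y + d ∸ (y + j)         ≡⟨ ℕ.[m+n]∸[m+o]≡n∸o y d j ⟩
      d ∸ j                   ∎)

interaction-∏ : ∀ {x xs} → Below x xs → interaction x xs ℚ.* ι (∏+ x xs) ≡ ι (∏∸ x xs)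
interaction-∏ {x} {[]}     _ = refl
interaction-∏ {x} {y ∷ ys} (0<x , y<x ∷ ys<x) = begin
  (ι x ℚ.- ι y) ℚ.* recip (ι x ℚ.+ ι y) ℚ.* interaction x ys ℚ.* ι ((x + y) * ∏+ x ys)
    ≡⟨ cong ((ι x ℚ.- ι y) ℚ.* recip (ι x ℚ.+ ι y) ℚ.* interaction x ys ℚ.*_) (trans (ι-* (x + y) (∏+ x ys)) (cong (ℚ._* ι (∏+ x ys)) (ι-+ x y))) ⟩
  (ι x ℚ.- ι y) ℚ.* recip (ι x ℚ.+ ι y) ℚ.* interaction x ys ℚ.* ((ι x ℚ.+ ι y) ℚ.* ι (∏+ x ys))
    ≡⟨ solve 5 (λ a r i b p → a :* r :* i :* (b :* p) := a :* (b :* r) :* (i :* p)) refl (ι x ℚ.- ι y) (recip (ι x ℚ.+ ι y)) (interaction x ys) (ι x ℚ.+ ι y) (ι (∏+ x ys)) ⟩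
  (ι x ℚ.- ι y) ℚ.* ((ι x ℚ.+ ι y) ℚ.* recip (ι x ℚ.+ ι y)) ℚ.* (interaction x ys ℚ.* ι (∏+ x ys))
    ≡⟨ cong₂ (λ u v → (ι x ℚ.- ι y) ℚ.* u ℚ.* v) (*-recip (ι-+-nonZero y 0<x)) (interaction-∏ (0<x , ys<x)) ⟩
  (ι x ℚ.- ι y) ℚ.* 1ℚ ℚ.* ι (∏∸ x ys)
    ≡⟨ cong (ℚ._* ι (∏∸ x ys)) (trans (ℚ.*-identityʳ _) (sym (ι-∸ (ℕ.<⇒≤ y<x)))) ⟩
  ι (x ∸ y) ℚ.* ι (∏∸ x ys)
    ≡⟨ ι-* (x ∸ y) (∏∸ x ys) ⟨
  ι ((x ∸ y) * ∏∸ x ys) ∎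

∏+-nonZero : ∀ {x} xs → 0 < x → ι (∏+ x xs) ≢ 0ℚ
∏+-nonZero {x} []       0<x = ι-nonZero 1
∏+-nonZero {x} (y ∷ ys) 0<x eq =
  *-nonZero (ι-+-nonZero y 0<x) (∏+-nonZero ys 0<x)
    (trans (sym (trans (ι-* (x + y) (∏+ x ys)) (cong (ℚ._* ι (∏+ x ys)) (ι-+ x y)))) eq)

-- The product formula for a single row, obtained by cancelling the non-zero `∏+ x xs` from the
-- cross-multiplied identity in ℕ.
interaction-hooks : ∀ {x xs} → Below x xs → Strict xs → interaction x xs ℚ.* ι (firstRowHooks x xs) ≡ ι (x !)
interaction-hooks {x} {xs} x> xs↓ = *-cancelʳ (ι (∏+ x xs)) (∏+-nonZero xs (proj₁ x>)) (begin
  interaction x xs ℚ.* ι (firstRowHooks x xs) ℚ.* ι (∏+ x xs)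
    ≡⟨ solve 3 (λ i f p → i :* f :* p := f :* (i :* p)) refl (interaction x xs) (ι (firstRowHooks x xs)) (ι (∏+ x xs)) ⟩
  ι (firstRowHooks x xs) ℚ.* (interaction x xs ℚ.* ι (∏+ x xs))
    ≡⟨ cong (ι (firstRowHooks x xs) ℚ.*_) (interaction-∏ x>) ⟩
  ι (firstRowHooks x xs) ℚ.* ι (∏∸ x xs)
    ≡⟨ ι-* (firstRowHooks x xs) (∏∸ x xs) ⟨
  ι (firstRowHooks x xs * ∏∸ x xs)
    ≡⟨ cong ι (firstRowHooks-closed x> xs↓) ⟩
  ι (x ! * ∏+ x xs)
    ≡⟨ ι-* (x !) (∏+ x xs) ⟩
  ι (x !) ℚ.* ι (∏+ x xs) ∎)

-- This is |λ| - ℓ(λ) for positive parts, written row by row so that each row contributes its own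
-- power of 2.
excess : List ℕ → ℕ
excess xs = sum (map (_∸ 1) xs)

weight-hooks : ∀ s {xs} → Strict xs → weight xs ℚ.* ι (hooksFrom s xs) ≡ ι (2 ^ excess xs)
weight-hooks s [] = refl
weight-hooks s {x ∷ xs} (x> ∷ xs↓) = begin
  ι (2 ^ (x ∸ 1)) ℚ.* recip (ι (x !)) ℚ.* interaction x xs ℚ.* weight xs ℚ.* ι (hooksFrom s (x ∷ xs))
    ≡⟨ cong (weight (x ∷ xs) ℚ.*_) (trans (cong ι (hooksFrom-∷ s x xs)) (ι-* (firstRowHooks x xs) _)) ⟩
  ι (2 ^ (x ∸ 1)) ℚ.* recip (ι (x !)) ℚ.* interaction x xs ℚ.* weight xs ℚ.* (ι (firstRowHooks x xs) ℚ.* ι (hooksFrom (suc s) xs))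
    ≡⟨ solve 6 (λ p r i w f h → p :* r :* i :* w :* (f :* h) := p :* ((i :* f) :* r) :* (w :* h)) refl
         (ι (2 ^ (x ∸ 1))) (recip (ι (x !))) (interaction x xs) (weight xs) (ι (firstRowHooks x xs)) (ι (hooksFrom (suc s) xs)) ⟩
  ι (2 ^ (x ∸ 1)) ℚ.* ((interaction x xs ℚ.* ι (firstRowHooks x xs)) ℚ.* recip (ι (x !))) ℚ.* (weight xs ℚ.* ι (hooksFrom (suc s) xs))
    ≡⟨ cong₂ (λ u v → ι (2 ^ (x ∸ 1)) ℚ.* u ℚ.* v)
         (trans (cong (ℚ._* recip (ι (x !))) (interaction-hooks x> xs↓)) (*-recip (ι-nonZero (x !) {{x ℕ.!≢0}})))
         (weight-hooks (suc s) xs↓) ⟩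
  ι (2 ^ (x ∸ 1)) ℚ.* 1ℚ ℚ.* ι (2 ^ excess xs)
    ≡⟨ cong (ℚ._* ι (2 ^ excess xs)) (ℚ.*-identityʳ (ι (2 ^ (x ∸ 1)))) ⟩
  ι (2 ^ (x ∸ 1)) ℚ.* ι (2 ^ excess xs)
    ≡⟨ ι-* (2 ^ (x ∸ 1)) (2 ^ excess xs) ⟨
  ι (2 ^ (x ∸ 1) * 2 ^ excess xs)
    ≡⟨ cong ι (ℕ.^-distribˡ-+-* 2 (x ∸ 1) (excess xs)) ⟨
  ι (2 ^ excess (x ∷ xs)) ∎

-- Adding one box

strict : ∀ ν → Strict (parts ν)
strict ν = go (Linked.Linked⇒AllPairs (λ x>y y>z → ℕ.<-trans y>z x>y) (decreasing ν)) (positive ν)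
  where
  go : ∀ {xs} → AllPairs _>_ xs → All (_> 0) xs → Strict xs
  go []         []       = []
  go (x> ∷ xs↓) (0<x ∷ p) = (0<x , x>) ∷ go xs↓ p

fromStrict : ∀ {xs} → Strict xs → StrictPartition
fromStrict {xs} xs↓ = mkStrict xs (linked xs↓) (pos xs↓)
  where
  linked : ∀ {xs} → Strict xs → Linked _>_ xs
  linked []                                 = []
  linked (_ ∷ [])                           = [-]
  linked ((_ , y<x ∷ _) ∷ xs↓@(_ ∷ _)) = y<x ∷ linked xs↓

  pos : ∀ {xs} → Strict xs → All (_> 0) xs
  pos []              = []
  pos ((0<x , _) ∷ s) = 0<x ∷ pos s

nth-0 : ∀ xs → nth xs 0 ≡ 0
nth-0 []      = refl
nth-0 (_ ∷ _) = refl

infix 4 _≤̇_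

_≤̇_ : List ℕ → List ℕ → Set
xs ≤̇ ys = ∀ i → nth xs i ≤ nth ys i

≤̇-tail : ∀ {x y} xs ys → x ∷ xs ≤̇ y ∷ ys → xs ≤̇ ys
≤̇-tail xs ys h zero    = subst (_≤ nth ys 0) (sym (nth-0 xs)) z≤n
≤̇-tail xs ys h (suc i) = h (suc (suc i))

≤̇-sum : ∀ xs ys → All (_> 0) xs → xs ≤̇ ys → sum xs ≤ sum ys
≤̇-sum []       _        _         _ = z≤n
≤̇-sum (_ ∷ _)  []       (0<x ∷ _) h = contradiction (ℕ.<-≤-trans 0<x (h 1)) λ ()
≤̇-sum (_ ∷ xs) (_ ∷ ys) (_ ∷ pos) h = ℕ.+-mono-≤ (h 1) (≤̇-sum xs ys pos (≤̇-tail xs ys h))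

≤̇-sum-≡ : ∀ xs ys → All (_> 0) xs → All (_> 0) ys → xs ≤̇ ys → sum xs ≡ sum ys → xs ≡ ys
≤̇-sum-≡ []       []       _ _ _ _ = refl
≤̇-sum-≡ []       (suc _ ∷ _) _ _ _ ()
≤̇-sum-≡ []       (zero ∷ _) _ (() ∷ _) _ _
≤̇-sum-≡ (_ ∷ _)  []       (0<x ∷ _) _ h _ = contradiction (ℕ.<-≤-trans 0<x (h 1)) λ ()
≤̇-sum-≡ (x ∷ xs) (y ∷ ys) (_ ∷ px) (_ ∷ py) h eq with ℕ.m≤n⇒m<n∨m≡n (h 1)
... | inj₁ x<y  = contradiction eq (ℕ.<⇒≢ (ℕ.+-mono-<-≤ x<y (≤̇-sum xs ys px (≤̇-tail xs ys h))))
... | inj₂ refl = cong (x ∷_) (≤̇-sum-≡ xs ys px py (≤̇-tail xs ys h) (ℕ.+-cancelˡ-≡ x _ _ eq))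

⊆-size-≡ : ∀ {μ ν} → μ ⊆ ν → size μ ≡ size ν → μ ≡ ν
⊆-size-≡ {μ} {ν} μ⊆ν eq = parts-injective (≤̇-sum-≡ (parts μ) (parts ν) (positive μ) (positive ν) μ⊆ν eq)

⊆-size : ∀ {μ ν} → μ ⊆ ν → size μ ≤ size ν
⊆-size {μ} {ν} = ≤̇-sum (parts μ) (parts ν) (positive μ)

-- Parts are counted from 1.
data BumpAt : ℕ → List ℕ → List ℕ → Set where
  new   : BumpAt 1 [] (1 ∷ [])
  here  : ∀ {x xs} → BumpAt 1 (x ∷ xs) (suc x ∷ xs)
  there : ∀ {i x xs ys} → BumpAt (suc i) xs ys → BumpAt (suc (suc i)) (x ∷ xs) (x ∷ ys)

bump-nth : ∀ {i xs ys} → BumpAt i xs ys → nth ys i ≡ suc (nth xs i)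
bump-nth new       = refl
bump-nth here      = refl
bump-nth (there b) = bump-nth b

bump-nth-≢ : ∀ {i j xs ys} → BumpAt i xs ys → j ≢ i → nth ys j ≡ nth xs j
bump-nth-≢ {j = zero}        {xs} {ys} b _ = trans (nth-0 ys) (sym (nth-0 xs))
bump-nth-≢ {j = suc zero}    new       1≢1 = contradiction refl 1≢1
bump-nth-≢ {j = suc zero}    here      1≢1 = contradiction refl 1≢1
bump-nth-≢ {j = suc zero}    (there _) _   = refl
bump-nth-≢ {j = suc (suc j)} new       _   = refl
bump-nth-≢ {j = suc (suc j)} here      _   = refl
bump-nth-≢ {j = suc (suc j)} (there b) j≢i = bump-nth-≢ b (j≢i ∘ cong suc)

bump-sum : ∀ {i xs ys} → BumpAt i xs ys → sum ys ≡ suc (sum xs)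
bump-sum new               = refl
bump-sum here              = refl
bump-sum (there {x = x} b) = trans (cong (x ℕ.+_) (bump-sum b)) (ℕ.+-suc x _)

bump-≤̇ : ∀ {i xs ys} → BumpAt i xs ys → xs ≤̇ ys
bump-≤̇ {i} {xs} b j with j ℕ.≟ i
... | yes refl = subst (nth xs i ≤_) (sym (bump-nth b)) (ℕ.n≤1+n _)
... | no  j≢i  = ℕ.≤-reflexive (sym (bump-nth-≢ b j≢i))

bump-functional : ∀ {i xs ys zs} → BumpAt i xs ys → BumpAt i xs zs → ys ≡ zs
bump-functional new       new       = refl
bump-functional here      here      = refl
bump-functional (there b) (there c) = cong (_ ∷_) (bump-functional b c)

bump-row-unique : ∀ {i j xs ys} → BumpAt i xs ys → BumpAt j xs ys → i ≡ j
bump-row-unique {i} {j} b c with i ℕ.≟ j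
... | yes i≡j = i≡j
... | no  i≢j = contradiction (trans (sym (bump-nth b)) (bump-nth-≢ c i≢j)) ℕ.1+n≢n

∈-bumps⁺ : ∀ {i xs ys} → BumpAt i xs ys → ys ∈ bumps xs
∈-bumps⁺ new       = here refl
∈-bumps⁺ here      = here refl
∈-bumps⁺ (there b) = there (∈-map⁺ _ (∈-bumps⁺ b))

∈-bumps⁻ : ∀ {xs ys} → ys ∈ bumps xs → ∃ λ i → BumpAt (suc i) xs ys
∈-bumps⁻ {[]}     (here refl) = 0 , new
∈-bumps⁻ {x ∷ xs} (here refl) = 0 , here
∈-bumps⁻ {x ∷ xs} (there ys∈) with ∈-map⁻ (x ∷_) ys∈
... | zs , zs∈ , refl with ∈-bumps⁻ zs∈
... | i , b = suc i , there b

bumps-unique : ∀ xs → Unique (bumps xs)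
bumps-unique []       = [] ∷ []
bumps-unique (x ∷ xs) = All.map⁺ (All.universal (λ _ ()) (bumps xs)) ∷ Unique.map⁺ (λ { refl → refl }) (bumps-unique xs)

-- The first row that differs already uses up the surplus of 1, so equality of sums forces the
-- remaining parts to agree.
cover-bump : ∀ xs ys → All (_> 0) xs → All (_> 0) ys → xs ≤̇ ys → sum ys ≡ suc (sum xs) → ∃ λ i → BumpAt (suc i) xs ys
cover-bump []       (zero ∷ _)         _        (() ∷ _) _ _
cover-bump []       (suc (suc _) ∷ _)  _        _        _ ()
cover-bump []       (suc zero ∷ ys)    _        (_ ∷ py) _ eq with ≤̇-sum-≡ [] ys [] py (λ _ → z≤n) (sym (ℕ.suc-injective eq))
... | refl = 0 , new
cover-bump (x ∷ xs) (y ∷ ys)           (_ ∷ px) (_ ∷ py) h eq with ℕ.m≤n⇒m<n∨m≡n (h 1)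
... | inj₂ refl =
  let i , b = cover-bump xs ys px py (≤̇-tail xs ys h) (ℕ.+-cancelˡ-≡ x (sum ys) (suc (sum xs)) (trans eq (sym (ℕ.+-suc x (sum xs)))))
  in suc i , there b
... | inj₁ x<y
  with ℕ.≤-antisym x<y (ℕ.+-cancelʳ-≤ (sum xs) y (suc x) (ℕ.≤-trans (ℕ.+-monoʳ-≤ y (≤̇-sum xs ys px (≤̇-tail xs ys h))) (ℕ.≤-reflexive eq)))
... | refl with ≤̇-sum-≡ xs ys px py (≤̇-tail xs ys h) (sym (ℕ.+-cancelˡ-≡ (suc x) (sum ys) (sum xs) eq))
... | refl = 0 , here

head-below : ∀ {x ys} → Strict ys → nth ys 1 < x → Below x ys
head-below []            0<x = 0<x , []
head-below ((_ , y>) ∷ _) y<x = ℕ.≤-<-trans z≤n y<x , y<x ∷ All.map (λ z<y → ℕ.<-trans z<y y<x) y>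

nth-1-< : ∀ {x xs} → Below x xs → nth xs 1 < x
nth-1-< (0<x , [])    = 0<x
nth-1-< (_ , y<x ∷ _) = y<x

-- The gap to the row above leaves room for one more box. The top row has its own alternative
-- because `nth` is 0 at index 0; the same default past the last part prevents skipping an empty
-- row.
strict-bump : ∀ {xs} i → Strict xs → (i ≡ 0 ⊎ suc (nth xs (suc i)) < nth xs i) → ∃ λ ys → BumpAt (suc i) xs ys × Strict ys
strict-bump zero [] _ = 1 ∷ [] , new , (s≤s z≤n , []) ∷ []
strict-bump zero ((0<x , x>) ∷ xs↓) _ = _ , here , (s≤s z≤n , All.map ℕ.m<n⇒m<1+n x>) ∷ xs↓
strict-bump (suc i) [] (inj₂ ())
strict-bump {x ∷ xs} (suc zero) (x> ∷ xs↓) (inj₂ gap) with strict-bump zero xs↓ (inj₁ refl)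
... | ys , b , ys↓ = x ∷ ys , there b , head-below ys↓ (subst (_< x) (sym (bump-nth b)) gap) ∷ ys↓
strict-bump {x ∷ xs} (suc (suc i)) (x> ∷ xs↓) (inj₂ gap) with strict-bump (suc i) xs↓ (inj₂ gap)
... | ys , b , ys↓ = x ∷ ys , there b , head-below ys↓ (subst (_< x) (sym (bump-nth-≢ b λ ())) (nth-1-< x>)) ∷ ys↓

-- Row i ends in column i + λᵢ. Strict decrease makes up for the shift, so these ends move weakly to
-- the left going down, as long as the rows are non-empty.
nth-shifted : ∀ {xs r i} → Strict xs → 0 < r → r ≤ i → 0 < nth xs i → i + nth xs i ≤ r + nth xs r
nth-shifted {x ∷ xs} {suc zero} {suc zero} _ _ _ _ = ℕ.≤-refl
nth-shifted {x ∷ xs} {suc zero} {suc (suc i)} (x> ∷ xs↓) _ _ 0<n =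
  s≤s (ℕ.≤-trans (nth-shifted xs↓ (s≤s z≤n) (s≤s z≤n) 0<n) (nth-1-< x>))
nth-shifted {x ∷ xs} {suc (suc r)} {suc (suc i)} (_ ∷ xs↓) _ (s≤s r≤i) 0<n = s≤s (nth-shifted xs↓ (s≤s z≤n) r≤i 0<n)

-- Boxes of diagrams and skew diagrams

InDiagram : StrictPartition → Box → Set
InDiagram ν b = row b < col b × col b ≤ row b + part ν (row b)

∈-boxes⁻ : ∀ {ν b} → b ∈ boxes ν → 0 < row b × InDiagram ν b
∈-boxes⁻ {ν} b∈ with find (∈-concatMap⁻ (λ i → boxRow i (part ν i)) {xs = 1⋯ (ℓ ν)} b∈)
... | i , i∈ , b∈row with ∈-map⁻ (λ k → i , i + k) b∈row | ∈-applyUpTo⁻ suc i∈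
... | k , k∈ , refl | i′ , _ , refl with ∈-applyUpTo⁻ suc k∈
... | k′ , k′< , refl = s≤s z≤n , ℕ.m<m+n i (s≤s z≤n) , ℕ.+-monoʳ-≤ i k′<

∈-boxes⁺ : ∀ {ν b} → InDiagram ν b → b ∈ boxes ν
∈-boxes⁺ {ν} {zero , c} (0<c , c≤) = contradiction (ℕ.<-≤-trans 0<c (subst (c ≤_) (nth-0 (parts ν)) c≤)) λ ()
∈-boxes⁺ {ν} {suc i , c} (i<c , c≤) = ∈-concatMap⁺ (λ i → boxRow i (part ν i)) {xs = 1⋯ (ℓ ν)}
  (lose (∈-applyUpTo⁺ suc i<ℓ) (subst (λ c → (suc i , c) ∈ boxRow (suc i) (part ν (suc i))) c≡ (∈-map⁺ _ (∈-applyUpTo⁺ suc k<))))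
  where
  k = c ∸ suc (suc i)

  c≡ : suc i + suc k ≡ c
  c≡ = trans (ℕ.+-suc (suc i) k) (ℕ.m+[n∸m]≡n i<c)

  k< : k < part ν (suc i)
  k< = ℕ.+-cancelˡ-≤ (suc i) _ _ (subst (_≤ suc i + part ν (suc i)) (sym c≡) c≤)

  i<ℓ : i < ℓ ν
  i<ℓ with i <? ℓ ν
  ... | yes i<ℓ = i<ℓ
  ... | no  i≮ℓ = contradiction (subst (k <_) (nth-beyond (parts ν) (s≤s (ℕ.≮⇒≥ i≮ℓ))) k<) λ ()

boxes-unique : ∀ ν → Unique (boxes ν)
boxes-unique ν = subst Unique (sym (boxes-parts ν)) (go 1 (parts ν))
  where
  go : ∀ s xs → Unique (boxesFrom s xs)
  go s []       = []
  go s (x ∷ xs) = Unique.++⁺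
    (Unique.map⁺ (λ eq → ℕ.+-cancelˡ-≡ s _ _ (cong proj₂ eq)) (Unique.applyUpTo⁺₁ suc x (λ i<j _ eq → ℕ.<⇒≢ i<j (ℕ.suc-injective eq))))
    (go (suc s) xs)
    λ (b∈row , b∈rest) → disjoint (∈-map⁻ _ b∈row) (All.lookup (boxesFrom-bounds (suc s) xs) b∈rest)
    where
    disjoint : ∀ {b} → (∃ λ k → k ∈ 1⋯ x × b ≡ (s , s + k)) → ¬ (suc s ≤ row b × row b < col b)
    disjoint (_ , _ , refl) (s<s , _) = ℕ.<-irrefl refl s<s

-- Leftwards this is immediate; upwards it is `nth-shifted`, since a higher row reaches at least as
-- far. The bounds on `c` keep it in a genuine row and to the right of the diagonal.
≺-closed : ∀ {ν b c} → InDiagram ν b → c ≺ b → 0 < row c → row c < col c → InDiagram ν c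
≺-closed (_ , ≤end) (inj₁ (refl , col<)) _ r<c = r<c , ℕ.≤-trans (ℕ.<⇒≤ col<) ≤end
≺-closed {ν} {i , k} {r , _} (i<k , k≤) (inj₂ (refl , r<i)) 0<r r<c =
  r<c , ℕ.≤-trans k≤ (nth-shifted (strict ν) 0<r (ℕ.<⇒≤ r<i) (ℕ.+-cancelˡ-< i 0 (part ν i) (subst (_< i + part ν i) (sym (ℕ.+-identityʳ i)) (ℕ.<-≤-trans i<k k≤))))

≺-irrefl : ∀ {b c} → b ≺ c → b ≢ c
≺-irrefl (inj₁ (_ , lt)) refl = ℕ.<-irrefl refl lt
≺-irrefl (inj₂ (_ , lt)) refl = ℕ.<-irrefl refl lt

module _ (κ μ : StrictPartition) where

  ∈-skewBoxes⁺ : ∀ {b} → InDiagram κ b → ¬ InDiagram μ b → b ∈ skewBoxes κ μ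
  ∈-skewBoxes⁺ in-κ ∉μ = ∈-filter⁺ (λ b → ¬? (b ∈? boxes μ)) (∈-boxes⁺ {κ} in-κ) (∉μ ∘ proj₂ ∘ ∈-boxes⁻ {μ})

  ∈-skewBoxes⁻ : ∀ {b} → b ∈ skewBoxes κ μ → 0 < row b × InDiagram κ b × ¬ InDiagram μ b
  ∈-skewBoxes⁻ b∈ with ∈-filter⁻ (λ b → ¬? (b ∈? boxes μ)) {xs = boxes κ} b∈
  ... | b∈κ , b∉μ with ∈-boxes⁻ {κ} b∈κ
  ... | 0<r , in-κ = 0<r , in-κ , b∉μ ∘ ∈-boxes⁺ {μ}

  skewBoxes-unique : Unique (skewBoxes κ μ)
  skewBoxes-unique = Unique.filter⁺ _ (boxes-unique κ)

skewBoxes-nonempty : ∀ {κ μ n} → μ ⊆ κ → size κ ≡ size μ + suc n → skewBoxes κ μ ≢ []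
skewBoxes-nonempty {κ} {μ} {n} μ⊆κ |κ| empty = ℕ.m≢1+m+n (size μ) {n} (trans (cong size (⊆-size-≡ {μ} {κ} μ⊆κ (ℕ.≤-antisym (⊆-size {μ} {κ} μ⊆κ) (⊆-size {κ} {μ} κ⊆μ)))) (trans |κ| (ℕ.+-suc _ n)))
  where
  κ⊆μ : κ ⊆ μ
  κ⊆μ i with part κ i ≤? part μ i
  ... | yes ≤μ = ≤μ
  -- The last box of a row in which `κ` is longer than `μ` would lie in the skew diagram.
  ... | no  ≰μ with subst ((i , i + part κ i) ∈_) empty
                     (∈-skewBoxes⁺ κ μ (ℕ.m<m+n i (ℕ.≤-<-trans z≤n (ℕ.≰⇒> ≰μ)) , ℕ.≤-refl) (≰μ ∘ ℕ.+-cancelˡ-≤ i _ _ ∘ proj₂))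
  ... | ()

module _ {i} {μ ν : StrictPartition} (bump : BumpAt i (parts μ) (parts ν)) where

  newBox : Box
  newBox = i , i + part ν i

  newBox-∉ : ¬ InDiagram μ newBox
  newBox-∉ (_ , ≤end) = ℕ.1+n≰n (subst (_≤ part μ i) (bump-nth bump) (ℕ.+-cancelˡ-≤ i _ _ ≤end))

  newBox-∈ : InDiagram ν newBox
  newBox-∈ = ℕ.m<m+n i (subst (0 <_) (sym (bump-nth bump)) (s≤s z≤n)) , ℕ.≤-refl

  bump-⊆ : ∀ {b} → InDiagram μ b → InDiagram ν b
  bump-⊆ {b} (r<c , c≤) = r<c , ℕ.≤-trans c≤ (ℕ.+-monoʳ-≤ (row b) (bump-≤̇ bump (row b)))

  bump-InDiagram : ∀ {b} → InDiagram ν b → b ≢ newBox → InDiagram μ b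
  bump-InDiagram {r , c} (r<c , c≤) b≢ with r ℕ.≟ i
  ... | no  r≢i  = r<c , subst (λ p → c ≤ r + p) (bump-nth-≢ bump r≢i) c≤
  ... | yes refl = r<c , ℕ.≤-pred (subst (c <_) (trans (cong (i ℕ.+_) (bump-nth bump)) (ℕ.+-suc i _)) (ℕ.≤∧≢⇒< c≤ (b≢ ∘ cong (i ,_))))

module _ {A : Set} where

  filter-filter : ∀ {P Q R : A → Set} (P? : Decidable P) (Q? : Decidable Q) (R? : Decidable R) →
    (∀ x → R x ⇔ (P x × Q x)) → ∀ xs → filter P? (filter Q? xs) ≡ filter R? xs
  filter-filter P? Q? R? R⇔ []       = refl
  filter-filter P? Q? R? R⇔ (x ∷ xs) with Q? x
  ... | no ¬q = trans (filter-filter P? Q? R? R⇔ xs) (sym (filter-reject R? (¬q ∘ proj₂ ∘ Equivalence.to (R⇔ x))))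
  ... | yes q with P? x
  ...   | no ¬p = trans (filter-filter P? Q? R? R⇔ xs) (sym (filter-reject R? (¬p ∘ proj₁ ∘ Equivalence.to (R⇔ x))))
  ...   | yes p = trans (cong (x ∷_) (filter-filter P? Q? R? R⇔ xs)) (sym (filter-accept R? (Equivalence.from (R⇔ x) (p , q))))

  lookup-injective : ∀ {xs : List A} → Unique xs → ∀ {p q} → lookup xs p ≡ lookup xs q → p ≡ q
  lookup-injective (_ ∷ _)   {zero}  {zero}  _  = refl
  lookup-injective (x∉ ∷ _)  {zero}  {suc q} eq = contradiction eq (All.lookup x∉ (∈-lookup q))
  lookup-injective (x∉ ∷ _)  {suc p} {zero}  eq = contradiction (sym eq) (All.lookup x∉ (∈-lookup p))
  lookup-injective (_ ∷ xs!) {suc p} {suc q} eq = cong suc (lookup-injective xs! eq)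

  filter-≢-lookup : ∀ {xs : List A} → Unique xs → ∀ p (P? : Decidable (_≢ lookup xs p)) → filter P? xs ≡ removeAt xs p
  filter-≢-lookup {x ∷ xs} (x∉ ∷ _) zero P? =
    trans (filter-reject P? (λ x≢x → x≢x refl)) (filter-all P? (All.map (λ x≢y y≡x → x≢y (sym y≡x)) x∉))
  filter-≢-lookup {x ∷ xs} (x∉ ∷ xs!) (suc p) P? =
    trans (filter-accept P? (All.lookup x∉ (∈-lookup p))) (cong (x ∷_) (filter-≢-lookup xs! p P?))

-- Covers of μ inside κ and minimal boxes of κ/μ

countStandard-minimals : ∀ {bs} → bs ≢ [] →
  countStandard bs ≡ sum (map (λ p → countStandard (removeAt bs p)) (minimals (lookup bs)))
countStandard-minimals {[]}     ≢[] = contradiction refl ≢[]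
countStandard-minimals {x ∷ xs} _   = countStandard-removeAt x xs

-- The correspondence handed to `reindex`: `ν` determines the row of its new box and hence `p`,
-- while `p` gives the row to be raised and hence `ν`.
data AddsBox (bs : List Box) (μ ν : StrictPartition) (p : Fin (length bs)) : Set where
  adds : ∀ {i} (bump : BumpAt i (parts μ) (parts ν)) → lookup bs p ≡ newBox {μ = μ} {ν} bump → AddsBox bs μ ν p

module _ {κ μ : StrictPartition} {n : ℕ} (μ⊆κ : μ ⊆ κ) (|κ| : size κ ≡ size μ + suc n) where

  private
    bs : List Box
    bs = skewBoxes κ μ

    coversBelow : List StrictPartition
    coversBelow = filter (_⊆? κ) (extensions μ 1)

    bs-∈ : ∀ p → 0 < row (lookup bs p) × InDiagram κ (lookup bs p) × ¬ InDiagram μ (lookup bs p)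
    bs-∈ p = ∈-skewBoxes⁻ κ μ (∈-lookup p)

    bs-index : ∀ {b} → InDiagram κ b → ¬ InDiagram μ b → ∃ λ p → lookup bs p ≡ b
    bs-index in-κ ∉μ = Any.index b∈ , sym (lookup-index b∈)
      where b∈ = ∈-skewBoxes⁺ κ μ in-κ ∉μ

    left : ∀ {ν} → ν ∈ coversBelow → ∃ λ p → p ∈ minimals (lookup bs) × AddsBox bs μ ν p
    left {ν} ν∈ with ∈-filter⁻ (_⊆? κ) {xs = extensions μ 1} ν∈
    ... | ν∈ext , ν⊆κ with Equivalence.to (∈-extensions μ 1 ν) ν∈ext
    ... | μ⊆ν , |ν| with cover-bump (parts μ) (parts ν) (positive μ) (positive ν) μ⊆ν (trans |ν| (ℕ.+-comm (size μ) 1))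
    ... | i , bump with bs-index (proj₁ (newBox-∈ {μ = μ} {ν} bump) , ℕ.+-monoʳ-≤ (suc i) (ν⊆κ (suc i))) (newBox-∉ {μ = μ} {ν} bump)
    ... | p , p≡ = p , ∈-filter⁺ (minimal? (lookup bs)) (∈-allFin p) minimal , adds bump p≡
      where
      -- A box before the new one lies in `ν` and differs from the new one, hence lies in `μ` and
      -- not in the skew diagram.
      minimal : Minimal (lookup bs) p
      minimal q q≺p with bs-∈ q
      ... | 0<r , (r<c , _) , ∉μ = ∉μ (bump-InDiagram {μ = μ} {ν} bump
        (≺-closed {ν} (newBox-∈ {μ = μ} {ν} bump) (subst (lookup bs q ≺_) p≡ q≺p) 0<r r<c)
        (≺-irrefl (subst (lookup bs q ≺_) p≡ q≺p)))

    right : ∀ {p} → p ∈ minimals (lookup bs) → ∃ λ ν → ν ∈ coversBelow × AddsBox bs μ ν p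
    right {p} p∈ = go (lookup bs p) refl (bs-∈ p)
      where
      minimal : ∀ {b} → InDiagram κ b → ¬ InDiagram μ b → ¬ b ≺ lookup bs p
      minimal in-κ ∉μ b≺p with bs-index in-κ ∉μ
      ... | q , refl = proj₂ (∈-filter⁻ (minimal? (lookup bs)) {xs = allFin (length bs)} p∈) q b≺p

      go : ∀ b → lookup bs p ≡ b → 0 < row b × InDiagram κ b × ¬ InDiagram μ b → ∃ λ ν → ν ∈ coversBelow × AddsBox bs μ ν p
      go (suc i , c) p≡ (_ , in-κ@(i<c , c≤) , ∉μ) = ν , ν∈ , adds bump (trans p≡ (cong (suc i ,_) (trans c≡ (cong (suc i ℕ.+_) (sym (bump-nth bump))))))
        where
        m = part μ (suc i)

        above-μ : suc i + suc m ≤ c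
        above-μ with c ≤? suc i + m
        ... | yes c≤ = contradiction (i<c , c≤) ∉μ
        ... | no  c≰ = subst (_≤ c) (sym (ℕ.+-suc (suc i) m)) (ℕ.≰⇒> c≰)

        -- Otherwise the first box after the end of this row of `μ` would precede the minimal one.
        c≡ : c ≡ suc i + suc m
        c≡ with ℕ.m≤n⇒m<n∨m≡n above-μ
        ... | inj₂ eq = sym eq
        ... | inj₁ lt = contradiction (subst ((suc i , suc i + suc m) ≺_) (sym p≡) (inj₁ (refl , lt)))
          (minimal (ℕ.m<m+n (suc i) (s≤s z≤n) , ℕ.≤-trans (ℕ.<⇒≤ lt) c≤)
                   (ℕ.1+n≰n ∘ ℕ.+-cancelˡ-≤ (suc i) _ _ ∘ proj₂))

        -- If the row above left no room, the box directly above would lie in `κ` but outside `μ`,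
        -- contradicting minimality.
        gap : ∀ i → c ≡ suc i + suc (part μ (suc i)) → InDiagram κ (suc i , c) → lookup bs p ≡ (suc i , c) → i ≡ 0 ⊎ suc (part μ (suc i)) < part μ i
        gap zero    _  _ _ = inj₁ refl
        gap (suc i) c≡ in-κ p≡ with suc (part μ (suc (suc i))) <? part μ (suc i)
        ... | yes lt = inj₂ lt
        ... | no  ≮  = contradiction (subst ((suc i , c) ≺_) (sym p≡) up)
          (minimal (≺-closed {κ} in-κ up (s≤s z≤n) (ℕ.<-trans (ℕ.n<1+n _) (proj₁ in-κ)))
            λ (_ , ≤end) → ℕ.1+n≰n (ℕ.≤-trans (subst (_≤ suc i + part μ (suc i)) c≡ ≤end) (ℕ.+-monoʳ-≤ (suc i) (ℕ.≮⇒≥ ≮))))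
          where
          up : (suc i , c) ≺ (suc (suc i) , c)
          up = inj₂ (refl , ℕ.≤-refl)

        bumped = strict-bump i (strict μ) (gap i c≡ in-κ p≡)
        bump = proj₁ (proj₂ bumped)

        ν : StrictPartition
        ν = fromStrict (proj₂ (proj₂ bumped))

        ν⊆κ : ν ⊆ κ
        ν⊆κ j with j ℕ.≟ suc i
        ... | yes refl = subst (_≤ part κ (suc i)) (sym (bump-nth bump)) (ℕ.+-cancelˡ-≤ (suc i) _ _ (subst (_≤ _) c≡ c≤))
        ... | no  j≢i  = subst (_≤ part κ j) (sym (bump-nth-≢ bump j≢i)) (μ⊆κ j)

        ν∈ : ν ∈ coversBelow
        ν∈ = ∈-filter⁺ (_⊆? κ)
          (Equivalence.from (∈-extensions μ 1 ν) (bump-≤̇ bump , trans (bump-sum bump) (ℕ.+-comm 1 (size μ)))) ν⊆κ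

    functional : ∀ {ν p q} → AddsBox bs μ ν p → AddsBox bs μ ν q → p ≡ q
    functional (adds b p≡) (adds c q≡) with bump-row-unique b c
    ... | refl = lookup-injective (skewBoxes-unique κ μ) (trans p≡ (sym q≡))

    injective : ∀ {ν ν′ p} → AddsBox bs μ ν p → AddsBox bs μ ν′ p → ν ≡ ν′
    injective (adds b p≡) (adds c p≡′) with ,-injectiveˡ (trans (sym p≡) p≡′)
    ... | refl = parts-injective (bump-functional b c)

    -- Both sides arise by filtering the same list `boxes κ`, so they agree even in the order of the
    -- boxes.
    skewBoxes-removeAt : ∀ {ν p} → AddsBox bs μ ν p → skewBoxes κ ν ≡ removeAt bs p
    skewBoxes-removeAt {ν} {p} (adds bump p≡) = begin
      filter (λ b → ¬? (b ∈? boxes ν)) (boxes κ)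
        ≡⟨ filter-filter ≢p? (λ b → ¬? (b ∈? boxes μ)) (λ b → ¬? (b ∈? boxes ν)) (λ b → mk⇔ to from) (boxes κ) ⟨
      filter ≢p? bs
        ≡⟨ filter-≢-lookup (skewBoxes-unique κ μ) p ≢p? ⟩
      removeAt bs p ∎
      where
      ≢p? : Decidable (_≢ lookup bs p)
      ≢p? b = ¬? (≡-dec ℕ._≟_ ℕ._≟_ b (lookup bs p))

      to : ∀ {b} → ¬ b ∈ boxes ν → b ≢ lookup bs p × ¬ b ∈ boxes μ
      to b∉ν = (λ { refl → b∉ν (∈-boxes⁺ {ν} (subst (InDiagram ν) (sym p≡) (newBox-∈ {μ = μ} {ν} bump))) }) ,
               λ b∈μ → b∉ν (∈-boxes⁺ {ν} (bump-⊆ {μ = μ} {ν} bump (proj₂ (∈-boxes⁻ {μ} b∈μ))))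

      from : ∀ {b} → b ≢ lookup bs p × ¬ b ∈ boxes μ → ¬ b ∈ boxes ν
      from (b≢p , b∉μ) b∈ν = b∉μ (∈-boxes⁺ {μ} (bump-InDiagram {μ = μ} {ν} bump (proj₂ (∈-boxes⁻ {ν} b∈ν)) λ b≡ → b≢p (trans b≡ (sym p≡))))

  -- c is a variable so that typechecking does not unfold countStandard.
  ∑-removeAt-minimals : ∀ (c : List Box → ℕ) →
    sum (map (λ p → c (removeAt bs p)) (minimals (lookup bs))) ≡ sum (map (λ ν → c (skewBoxes κ ν)) coversBelow)
  ∑-removeAt-minimals c = sym (sum-↭ (reindex (AddsBox bs μ)
    (Unique.filter⁺ (_⊆? κ) (extensions-unique μ 1)) (Unique.filter⁺ (minimal? (lookup bs)) (Unique.allFin⁺ (length bs)))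
    left right functional injective (λ _ _ a → cong c (skewBoxes-removeAt a))))

  f-covers : f κ μ ≡ sum (map (f κ) (filter (_⊆? κ) (extensions μ 1)))
  f-covers = trans (countStandard-minimals (skewBoxes-nonempty {κ} {μ} {n} μ⊆κ |κ|)) (∑-removeAt-minimals countStandard)

-- Summation over extensions

-- Turns a restricted range of summation into zero terms, so that the order of two summations can be
-- exchanged.
guard : {P : Set} → Dec P → ℚ → ℚ
guard P? q = if does P? then q else 0ℚ

module _ {A : Set} where

  ∑-filter : {P : A → Set} (P? : Decidable P) (g : A → ℚ) → ∀ xs → ∑ (filter P? xs) g ≡ ∑ xs (λ x → guard (P? x) (g x))
  ∑-filter P? g []       = refl
  ∑-filter P? g (x ∷ xs) with does (P? x)
  ... | true  = cong (λ s → g x ℚ.+ s) (∑-filter P? g xs)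
  ... | false = trans (∑-filter P? g xs) (sym (ℚ.+-identityˡ _))

  ∑-∈-cong : ∀ {g h : A → ℚ} {xs} → (∀ {x} → x ∈ xs → g x ≡ h x) → ∑ xs g ≡ ∑ xs h
  ∑-∈-cong eq = ∑-cong (All.tabulate eq)

  ∑-zero : ∀ (xs : List A) → ∑ xs (λ _ → 0ℚ) ≡ 0ℚ
  ∑-zero []       = refl
  ∑-zero (_ ∷ xs) = trans (ℚ.+-identityˡ _) (∑-zero xs)

  ι-sum : ∀ (g : A → ℕ) xs → ι (sum (map g xs)) ≡ ∑ xs (λ x → ι (g x))
  ι-sum g []       = refl
  ι-sum g (x ∷ xs) = trans (ι-+ (g x) _) (cong (λ s → ι (g x) ℚ.+ s) (ι-sum g xs))

module _ {A B : Set} where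

  ∑-swap : ∀ (g : A → B → ℚ) xs ys → ∑ xs (λ x → ∑ ys (g x)) ≡ ∑ ys (λ y → ∑ xs (λ x → g x y))
  ∑-swap g []       ys = sym (∑-zero ys)
  ∑-swap g (x ∷ xs) ys = trans (cong (λ s → ∑ ys (g x) ℚ.+ s) (∑-swap g xs ys)) (sym (∑-+ (g x) _ ys))

  ∑-↭ : ∀ {g : A → ℚ} {h : B → ℚ} {xs ys} → map g xs ↭ map h ys → ∑ xs g ≡ ∑ ys h
  ∑-↭ p = Permutation.foldr-commMonoid (setoid ℚ) ℚ.+-0-isCommutativeMonoid (↭⇒↭ₛ p)

-- Weights and the coefficients of the theorem

wt : StrictPartition → ℚ
wt ν = weight (parts ν)

Φ : StrictPartition → ℚ
Φ ν = ι (contentSum ν)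

wt-H : ∀ ν → wt ν ℚ.* ι (H ν) ≡ ι (2 ^ excess (parts ν))
wt-H ν = trans (cong (λ h → wt ν ℚ.* ι h) (H-from ν)) (weight-hooks 1 (strict ν))

wt-nonZero : ∀ ν → wt ν ≢ 0ℚ
wt-nonZero ν eq = ι-nonZero (2 ^ excess (parts ν)) {{ℕ.m^n≢0 2 (excess (parts ν))}}
  (trans (sym (wt-H ν)) (trans (cong (ℚ._* ι (H ν)) eq) (ℚ.*-zeroˡ (ι (H ν)))))

excess-length : ∀ {xs} → All (_> 0) xs → sum xs ≡ excess xs + length xs
excess-length []                          = refl
excess-length {suc x ∷ xs} (s≤s z≤n ∷ px) = begin
  suc (x + sum xs)                ≡⟨ cong (suc x ℕ.+_) (excess-length px) ⟩
  suc x + (excess xs + length xs) ≡⟨ ℕ.+-assoc (suc x) (excess xs) _ ⟨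
  suc x + excess xs + length xs   ≡⟨ ℕ.+-suc (x + excess xs) (length xs) ⟨
  x + excess xs + suc (length xs) ∎

excess-mono : ∀ xs ys → All (_> 0) xs → xs ≤̇ ys → excess xs ≤ excess ys
excess-mono []       _        _         _ = z≤n
excess-mono (_ ∷ _)  []       (0<x ∷ _) h = contradiction (ℕ.<-≤-trans 0<x (h 1)) λ ()
excess-mono (_ ∷ xs) (_ ∷ ys) (_ ∷ px)  h = ℕ.+-mono-≤ (ℕ.∸-monoˡ-≤ 1 (h 1)) (excess-mono xs ys px (≤̇-tail xs ys h))

exponent-excess : ∀ {μ ν} → μ ⊆ ν → exponent ν μ + excess (parts μ) ≡ excess (parts ν)
exponent-excess {μ} {ν} μ⊆ν = begin
  (size ν + ℓ μ) ∸ (ℓ ν + size μ) + eμ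
    ≡⟨ cong₂ (λ s t → (s + ℓ μ) ∸ (ℓ ν + t) + eμ) (trans (excess-length (positive ν)) (ℕ.+-comm eν (ℓ ν))) (excess-length (positive μ)) ⟩
  (ℓ ν + eν + ℓ μ) ∸ (ℓ ν + (eμ + ℓ μ)) + eμ
    ≡⟨ cong (λ s → s ∸ (ℓ ν + (eμ + ℓ μ)) + eμ) (ℕ.+-assoc (ℓ ν) eν (ℓ μ)) ⟩
  (ℓ ν + (eν + ℓ μ)) ∸ (ℓ ν + (eμ + ℓ μ)) + eμ
    ≡⟨ cong (_+ eμ) (ℕ.[m+n]∸[m+o]≡n∸o (ℓ ν) _ _) ⟩
  (eν + ℓ μ) ∸ (eμ + ℓ μ) + eμ
    ≡⟨ cong (_+ eμ) (trans (cong₂ _∸_ (ℕ.+-comm eν (ℓ μ)) (ℕ.+-comm eμ (ℓ μ))) (ℕ.[m+n]∸[m+o]≡n∸o (ℓ μ) eν eμ)) ⟩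
  eν ∸ eμ + eμ
    ≡⟨ ℕ.m∸n+n≡m (excess-mono (parts μ) (parts ν) (positive μ) μ⊆ν) ⟩
  eν ∎
  where
  eμ = excess (parts μ)
  eν = excess (parts ν)

-- By `wt-H` each hook product is a power of 2 over a weight, and the exponent of the theorem is the
-- difference of the two powers. So the coefficient is `k` times w(ν)/w(μ), stated here without the
-- quotient.
coefficient-wt : ∀ {μ ν} k → μ ⊆ ν →
  (_/_ (+ (2 ^ exponent ν μ * k * H μ)) (H ν) {{H-nonZero ν}}) ℚ.* wt μ ≡ ι k ℚ.* wt ν
coefficient-wt {μ} {ν} k μ⊆ν = *-cancelʳ (ι (H ν)) (ι-nonZero (H ν) {{H-nonZero ν}}) (begin
  q ℚ.* wt μ ℚ.* ι (H ν)
    ≡⟨ solve 3 (λ q w h → q :* w :* h := q :* h :* w) refl q (wt μ) (ι (H ν)) ⟩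
  q ℚ.* ι (H ν) ℚ.* wt μ
    ≡⟨ cong (ℚ._* wt μ) (/-*-cancel (+ (2 ^ exponent ν μ * k * H μ)) (H ν) {{H-nonZero ν}}) ⟩
  ι (2 ^ exponent ν μ * k * H μ) ℚ.* wt μ
    ≡⟨ cong (ℚ._* wt μ) (trans (ι-* (2 ^ exponent ν μ * k) (H μ)) (cong (ℚ._* ι (H μ)) (ι-* (2 ^ exponent ν μ) k))) ⟩
  ι (2 ^ exponent ν μ) ℚ.* ι k ℚ.* ι (H μ) ℚ.* wt μ
    ≡⟨ solve 4 (λ e k h w → e :* k :* h :* w := k :* (e :* (w :* h))) refl (ι (2 ^ exponent ν μ)) (ι k) (ι (H μ)) (wt μ) ⟩
  ι k ℚ.* (ι (2 ^ exponent ν μ) ℚ.* (wt μ ℚ.* ι (H μ)))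
    ≡⟨ cong (λ e → ι k ℚ.* (ι (2 ^ exponent ν μ) ℚ.* e)) (wt-H μ) ⟩
  ι k ℚ.* (ι (2 ^ exponent ν μ) ℚ.* ι (2 ^ excess (parts μ)))
    ≡⟨ cong (ι k ℚ.*_) (trans (cong ι (ℕ.^-distribˡ-+-* 2 (exponent ν μ) (excess (parts μ)))) (ι-* (2 ^ exponent ν μ) (2 ^ excess (parts μ)))) ⟨
  ι k ℚ.* ι (2 ^ (exponent ν μ + excess (parts μ)))
    ≡⟨ cong (λ e → ι k ℚ.* ι (2 ^ e)) (exponent-excess {μ} {ν} μ⊆ν) ⟩
  ι k ℚ.* ι (2 ^ excess (parts ν))
    ≡⟨ cong (ι k ℚ.*_) (wt-H ν) ⟨
  ι k ℚ.* (wt ν ℚ.* ι (H ν))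
    ≡⟨ ℚ.*-assoc (ι k) (wt ν) (ι (H ν)) ⟨
  ι k ℚ.* wt ν ℚ.* ι (H ν) ∎)
  where q = _/_ (+ (2 ^ exponent ν μ * k * H μ)) (H ν) {{H-nonZero ν}}

-- A summand that vanishes with the weight ignores non-strict bumps, so these may be added to the
-- sum over the covers of `μ`, and the identities for `bumps` become available.
∑-extensions-1 : ∀ μ (g : List ℕ → ℚ) → (∀ {xs} → weight xs ≡ 0ℚ → g xs ≡ 0ℚ) →
  (∑[ ν ∈ extensions μ 1 ] g (parts ν)) ≡ ∑ (bumps (parts μ)) g
∑-extensions-1 μ g g-zero = begin
  ∑ (extensions μ 1) (g ∘ parts)
    ≡⟨ ∑-↭ {g = g ∘ parts} {g} (reindex (λ ν xs → parts ν ≡ xs) (extensions-unique μ 1) (Unique.filter⁺ strict? (bumps-unique (parts μ)))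
         left right (λ { refl refl → refl }) (λ p q → parts-injective (trans p (sym q))) (λ _ _ → cong g)) ⟩
  ∑ (filter strict? (bumps (parts μ))) g
    ≡⟨ ∑-filter strict? g (bumps (parts μ)) ⟩
  ∑ (bumps (parts μ)) (λ xs → guard (strict? xs) (g xs))
    ≡⟨ ∑-cong (All.map unguard (bump-degenerate (strict μ))) ⟩
  ∑ (bumps (parts μ)) g ∎
  where
  left : ∀ {ν} → ν ∈ extensions μ 1 → ∃ λ xs → xs ∈ filter strict? (bumps (parts μ)) × parts ν ≡ xs
  left {ν} ν∈ =
    let μ⊆ν , |ν| = Equivalence.to (∈-extensions μ 1 ν) ν∈
        _ , bump = cover-bump (parts μ) (parts ν) (positive μ) (positive ν) μ⊆ν (trans |ν| (ℕ.+-comm (size μ) 1))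
    in parts ν , ∈-filter⁺ strict? (∈-bumps⁺ bump) (strict ν) , refl

  right : ∀ {xs} → xs ∈ filter strict? (bumps (parts μ)) → ∃ λ ν → ν ∈ extensions μ 1 × parts ν ≡ xs
  right {xs} xs∈ =
    let xs∈bumps , xs↓ = ∈-filter⁻ strict? {xs = bumps (parts μ)} xs∈
        _ , bump = ∈-bumps⁻ xs∈bumps
    in fromStrict xs↓ ,
       Equivalence.from (∈-extensions μ 1 (fromStrict xs↓)) (bump-≤̇ bump , trans (bump-sum bump) (ℕ.+-comm 1 (size μ))) ,
       refl

  unguard : ∀ {xs} → Strict xs Data.Sum.⊎ weight xs ≡ 0ℚ → guard (strict? xs) (g xs) ≡ g xs
  unguard {xs} d with strict? xs | d
  ... | yes _  | _          = refl
  ... | no  _  | inj₂ w≡0   = sym (g-zero w≡0)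
  ... | no  ¬s | inj₁ s     = contradiction s ¬s

∑-wt-1 : ∀ μ → ∑ (extensions μ 1) wt ≡ wt μ
∑-wt-1 μ = trans (∑-extensions-1 μ weight (λ eq → eq)) (∑-bumps-weight (strict μ))

∑-content-1 : ∀ μ → (∑[ ν ∈ extensions μ 1 ] wt ν ℚ.* (Φ ν ℚ.- Φ μ)) ≡ ι (size μ) ℚ.* wt μ
∑-content-1 μ = begin
  ∑ (extensions μ 1) (λ ν → wt ν ℚ.* (Φ ν ℚ.- Φ μ))
    ≡⟨ ∑-ext (extensions μ 1) (λ ν → cong₂ (λ p q → wt ν ℚ.* (ι p ℚ.- ι q)) (contentSum-parts ν) (contentSum-parts μ)) ⟩
  ∑ (extensions μ 1) (λ ν → g (parts ν))
    ≡⟨ ∑-extensions-1 μ g (λ {xs} eq → trans (cong (ℚ._* (ι (partsContent xs) ℚ.- ι (partsContent (parts μ)))) eq) (ℚ.*-zeroˡ (ι (partsContent xs) ℚ.- ι (partsContent (parts μ))))) ⟩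
  ∑ (bumps (parts μ)) g
    ≡⟨ ∑-bumps-content (strict μ) ⟩
  ι (size μ) ℚ.* wt μ ∎
  where
  g : List ℕ → ℚ
  g xs = weight xs ℚ.* (ι (partsContent xs) ℚ.- ι (partsContent (parts μ)))

-- Splitting off the first box

extensions-via : ∀ {μ ν n} (g : StrictPartition → ℚ) → ν ∈ extensions μ 1 →
  ∑ (filter (ν ⊆?_) (extensions μ (suc n))) g ≡ ∑ (extensions ν n) g
extensions-via {μ} {ν} {n} g ν∈ = ∑-↭ {g = g} {g} (reindex _≡_ (Unique.filter⁺ (ν ⊆?_) (extensions-unique μ (suc n))) (extensions-unique ν n)
  left right (λ { refl refl → refl }) (λ { refl refl → refl }) (λ _ _ → cong g))
  where
  μ⊆ν = proj₁ (Equivalence.to (∈-extensions μ 1 ν) ν∈)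

  |ν| : size ν + n ≡ size μ + suc n
  |ν| = trans (cong (_+ n) (proj₂ (Equivalence.to (∈-extensions μ 1 ν) ν∈))) (ℕ.+-assoc (size μ) 1 n)

  left : ∀ {κ} → κ ∈ filter (ν ⊆?_) (extensions μ (suc n)) → ∃ λ κ′ → κ′ ∈ extensions ν n × κ ≡ κ′
  left {κ} κ∈ =
    let κ∈ext , ν⊆κ = ∈-filter⁻ (ν ⊆?_) {xs = extensions μ (suc n)} κ∈
        _ , |κ| = Equivalence.to (∈-extensions μ (suc n) κ) κ∈ext
    in κ , Equivalence.from (∈-extensions ν n κ) (ν⊆κ , trans |κ| (sym |ν|)) , refl

  right : ∀ {κ} → κ ∈ extensions ν n → ∃ λ κ′ → κ′ ∈ filter (ν ⊆?_) (extensions μ (suc n)) × κ′ ≡ κ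
  right {κ} κ∈ =
    let ν⊆κ , |κ| = Equivalence.to (∈-extensions ν n κ) κ∈
    in κ , ∈-filter⁺ (ν ⊆?_) (Equivalence.from (∈-extensions μ (suc n) κ) ((λ i → ℕ.≤-trans (μ⊆ν i) (ν⊆κ i)) , trans |κ| |ν|)) ν⊆κ , refl

guard-* : ∀ {P : Set} (P? : Dec P) p q → guard P? p ℚ.* q ≡ guard P? (p ℚ.* q)
guard-* (yes _) p q = refl
guard-* (no  _) p q = ℚ.*-zeroˡ q

∑-*ʳ : {A : Set} (g : A → ℚ) (q : ℚ) (xs : List A) → ∑ xs g ℚ.* q ≡ ∑ xs (λ x → g x ℚ.* q)
∑-*ʳ g q xs = begin
  ∑ xs g ℚ.* q           ≡⟨ ℚ.*-comm (∑ xs g) q ⟩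
  q ℚ.* ∑ xs g           ≡⟨ ∑-*ˡ q g xs ⟨
  ∑ xs (λ x → q ℚ.* g x) ≡⟨ ∑-ext xs (λ x → ℚ.*-comm q (g x)) ⟩
  ∑ xs (λ x → g x ℚ.* q) ∎

-- `f-covers` sorts fillings by their first box, and guarding with `ν ⊆ κ` lets the two sums be
-- exchanged. As `g` is any function of `κ`, both inductions below can use it.
∑-first-box : ∀ μ n (g : StrictPartition → ℚ) →
  (∑[ κ ∈ extensions μ (suc n) ] ι (f κ μ) ℚ.* g κ) ≡ (∑[ ν ∈ extensions μ 1 ] (∑[ κ ∈ extensions ν n ] ι (f κ ν) ℚ.* g κ))
∑-first-box μ n g = begin
  ∑ (extensions μ (suc n)) (λ κ → ι (f κ μ) ℚ.* g κ)
    ≡⟨ ∑-∈-cong {xs = extensions μ (suc n)} split ⟩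
  ∑ (extensions μ (suc n)) (λ κ → ∑ (extensions μ 1) (λ ν → guard (ν ⊆? κ) (ι (f κ ν) ℚ.* g κ)))
    ≡⟨ ∑-swap (λ κ ν → guard (ν ⊆? κ) (ι (f κ ν) ℚ.* g κ)) (extensions μ (suc n)) (extensions μ 1) ⟩
  ∑ (extensions μ 1) (λ ν → ∑ (extensions μ (suc n)) (λ κ → guard (ν ⊆? κ) (ι (f κ ν) ℚ.* g κ)))
    ≡⟨ ∑-∈-cong {xs = extensions μ 1} (λ {ν} ν∈ → trans
         (sym (∑-filter (ν ⊆?_) (λ κ → ι (f κ ν) ℚ.* g κ) (extensions μ (suc n))))
         (extensions-via {μ} {ν} {n} (λ κ → ι (f κ ν) ℚ.* g κ) ν∈)) ⟩
  ∑ (extensions μ 1) (λ ν → ∑ (extensions ν n) (λ κ → ι (f κ ν) ℚ.* g κ)) ∎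
  where
  split : ∀ {κ} → κ ∈ extensions μ (suc n) → ι (f κ μ) ℚ.* g κ ≡ ∑ (extensions μ 1) (λ ν → guard (ν ⊆? κ) (ι (f κ ν) ℚ.* g κ))
  split {κ} κ∈ = begin
    ι (f κ μ) ℚ.* g κ
      ≡⟨ cong (λ k → ι k ℚ.* g κ) (f-covers {κ} {μ} {n} (proj₁ μκ) (proj₂ μκ)) ⟩
    ι (sum (map (f κ) (filter (_⊆? κ) (extensions μ 1)))) ℚ.* g κ
      ≡⟨ cong (ℚ._* g κ) (ι-sum (f κ) (filter (_⊆? κ) (extensions μ 1))) ⟩
    ∑ (filter (_⊆? κ) (extensions μ 1)) (λ ν → ι (f κ ν)) ℚ.* g κ
      ≡⟨ cong (ℚ._* g κ) (∑-filter (_⊆? κ) (λ ν → ι (f κ ν)) (extensions μ 1)) ⟩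
    ∑ (extensions μ 1) (λ ν → guard (ν ⊆? κ) (ι (f κ ν))) ℚ.* g κ
      ≡⟨ ∑-*ʳ (λ ν → guard (ν ⊆? κ) (ι (f κ ν))) (g κ) (extensions μ 1) ⟩
    ∑ (extensions μ 1) (λ ν → guard (ν ⊆? κ) (ι (f κ ν)) ℚ.* g κ)
      ≡⟨ ∑-ext (extensions μ 1) (λ ν → guard-* (ν ⊆? κ) (ι (f κ ν)) (g κ)) ⟩
    ∑ (extensions μ 1) (λ ν → guard (ν ⊆? κ) (ι (f κ ν) ℚ.* g κ)) ∎
    where μκ = Equivalence.to (∈-extensions μ (suc n) κ) κ∈

-- Induction on the number of added boxes

f-refl : ∀ μ → f μ μ ≡ 1
f-refl μ = cong countStandard (filter-none _ {xs = boxes μ} (All.tabulate λ b∈ b∉ → b∉ b∈))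

∈-extensions-0 : ∀ {μ ν} → ν ∈ extensions μ 0 → μ ≡ ν
∈-extensions-0 {μ} {ν} ν∈ =
  let μ⊆ν , |ν| = Equivalence.to (∈-extensions μ 0 ν) ν∈
  in ⊆-size-≡ {μ} {ν} μ⊆ν (sym (trans |ν| (ℕ.+-identityʳ (size μ))))

∑-extensions-0 : ∀ μ (g : StrictPartition → ℚ) → ∑ (extensions μ 0) g ≡ g μ
∑-extensions-0 μ g = trans
  (∑-↭ {g = g} {g} {ys = μ ∷ []} (reindex _≡_ (extensions-unique μ 0) ([] ∷ [])
    (λ ν∈ → μ , here refl , sym (∈-extensions-0 ν∈))
    (λ { (here refl) → μ , Equivalence.from (∈-extensions μ 0 μ) ((λ _ → ℕ.≤-refl) , sym (ℕ.+-identityʳ (size μ))) , refl })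
    (λ { refl refl → refl }) (λ { refl refl → refl }) (λ { _ _ refl → refl })))
  (ℚ.+-identityʳ (g μ))

∑-wt : ∀ μ n → (∑[ κ ∈ extensions μ n ] ι (f κ μ) ℚ.* wt κ) ≡ wt μ
∑-wt μ zero = trans (∑-extensions-0 μ (λ κ → ι (f κ μ) ℚ.* wt κ)) (trans (cong (λ k → ι k ℚ.* wt μ) (f-refl μ)) (ℚ.*-identityˡ (wt μ)))
∑-wt μ (suc n) = begin
  ∑ (extensions μ (suc n)) (λ κ → ι (f κ μ) ℚ.* wt κ)
    ≡⟨ ∑-first-box μ n wt ⟩
  ∑ (extensions μ 1) (λ ν → ∑ (extensions ν n) (λ κ → ι (f κ ν) ℚ.* wt κ))
    ≡⟨ ∑-ext (extensions μ 1) (λ ν → ∑-wt ν n) ⟩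
  ∑ (extensions μ 1) wt
    ≡⟨ ∑-wt-1 μ ⟩
  wt μ ∎

rhs : ℕ → ℕ → ℕ
rhs n s = n C 2 + n * s

-- Replacing s by s + 1 gains n, which Pascal's rule absorbs into binom(n, 2); the extra s completes
-- (n + 1)s.
rhs-suc : ∀ n s → ι (rhs n (s + 1)) ℚ.+ ι s ≡ ι (rhs (suc n) s)
rhs-suc n s = begin
  ι (n C 2 + n * (s + 1)) ℚ.+ ι s ≡⟨ ι-+ (n C 2 + n * (s + 1)) s ⟨
  ι (n C 2 + n * (s + 1) + s)     ≡⟨ cong ι (begin
    n C 2 + n * (s + 1) + s   ≡⟨ cong (λ e → n C 2 + e + s) (trans (cong (n *_) (ℕ.+-comm s 1)) (ℕ.*-suc n s)) ⟩
    n C 2 + (n + n * s) + s   ≡⟨ cong (_+ s) (ℕ.+-assoc (n C 2) n _) ⟨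
    n C 2 + n + n * s + s     ≡⟨ ℕ.+-assoc (n C 2 + n) _ s ⟩
    n C 2 + n + (n * s + s)   ≡⟨ cong₂ _+_ (ℕ.+-comm (n C 2) n) (ℕ.+-comm (n * s) s) ⟩
    n + n C 2 + suc n * s     ≡⟨ cong (λ e → e + n C 2 + suc n * s) (nC1≡n n) ⟨
    n C 1 + n C 2 + suc n * s ≡⟨ cong (_+ suc n * s) (nCk+nC[k+1]≡[n+1]C[k+1] n 1) ⟩
    suc n C 2 + suc n * s     ∎) ⟩
  ι (rhs (suc n) s) ∎

∑-content : ∀ μ n → (∑[ κ ∈ extensions μ n ] ι (f κ μ) ℚ.* (wt κ ℚ.* (Φ κ ℚ.- Φ μ))) ≡ ι (rhs n (size μ)) ℚ.* wt μ
∑-content μ zero = trans (∑-extensions-0 μ (λ κ → ι (f κ μ) ℚ.* (wt κ ℚ.* (Φ κ ℚ.- Φ μ))))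
  (solve 3 (λ k w p → k :* (w :* (p :- p)) := con 0ℚ :* w) refl (ι (f μ μ)) (wt μ) (Φ μ))
∑-content μ (suc n) = begin
  ∑ (extensions μ (suc n)) (λ κ → ι (f κ μ) ℚ.* (wt κ ℚ.* (Φ κ ℚ.- Φ μ)))
    ≡⟨ ∑-first-box μ n (λ κ → wt κ ℚ.* (Φ κ ℚ.- Φ μ)) ⟩
  ∑ (extensions μ 1) (λ ν → ∑ (extensions ν n) (λ κ → ι (f κ ν) ℚ.* (wt κ ℚ.* (Φ κ ℚ.- Φ μ))))
    ≡⟨ ∑-∈-cong {xs = extensions μ 1} through ⟩
  ∑ (extensions μ 1) (λ ν → ι (rhs n (size μ + 1)) ℚ.* wt ν ℚ.+ wt ν ℚ.* (Φ ν ℚ.- Φ μ))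
    ≡⟨ ∑-+ (λ ν → ι (rhs n (size μ + 1)) ℚ.* wt ν) (λ ν → wt ν ℚ.* (Φ ν ℚ.- Φ μ)) (extensions μ 1) ⟩
  ∑ (extensions μ 1) (λ ν → ι (rhs n (size μ + 1)) ℚ.* wt ν) ℚ.+ ∑ (extensions μ 1) (λ ν → wt ν ℚ.* (Φ ν ℚ.- Φ μ))
    ≡⟨ cong₂ ℚ._+_ (trans (∑-*ˡ (ι (rhs n (size μ + 1))) wt (extensions μ 1)) (cong (ι (rhs n (size μ + 1)) ℚ.*_) (∑-wt-1 μ))) (∑-content-1 μ) ⟩
  ι (rhs n (size μ + 1)) ℚ.* wt μ ℚ.+ ι (size μ) ℚ.* wt μ
    ≡⟨ ℚ.*-distribʳ-+ (wt μ) (ι (rhs n (size μ + 1))) (ι (size μ)) ⟨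
  (ι (rhs n (size μ + 1)) ℚ.+ ι (size μ)) ℚ.* wt μ
    ≡⟨ cong (ℚ._* wt μ) (rhs-suc n (size μ)) ⟩
  ι (rhs (suc n) (size μ)) ℚ.* wt μ ∎
  where
  through : ∀ {ν} → ν ∈ extensions μ 1 →
    ∑ (extensions ν n) (λ κ → ι (f κ ν) ℚ.* (wt κ ℚ.* (Φ κ ℚ.- Φ μ))) ≡ ι (rhs n (size μ + 1)) ℚ.* wt ν ℚ.+ wt ν ℚ.* (Φ ν ℚ.- Φ μ)
  through {ν} ν∈ = begin
    ∑ (extensions ν n) (λ κ → ι (f κ ν) ℚ.* (wt κ ℚ.* (Φ κ ℚ.- Φ μ)))
      -- Splits Φ κ - Φ μ at `ν`: the part Φ κ - Φ ν falls under the induction hypothesis for `ν`,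
      -- and Φ ν - Φ μ does not depend on `κ`, so `∑-wt` sums it.
      ≡⟨ ∑-ext (extensions ν n) (λ κ → solve 5 (λ k w p q r → k :* (w :* (p :- r)) := k :* (w :* (p :- q)) :+ (q :- r) :* (k :* w)) refl
           (ι (f κ ν)) (wt κ) (Φ κ) (Φ ν) (Φ μ)) ⟩
    ∑ (extensions ν n) (λ κ → ι (f κ ν) ℚ.* (wt κ ℚ.* (Φ κ ℚ.- Φ ν)) ℚ.+ (Φ ν ℚ.- Φ μ) ℚ.* (ι (f κ ν) ℚ.* wt κ))
      ≡⟨ ∑-+ (λ κ → ι (f κ ν) ℚ.* (wt κ ℚ.* (Φ κ ℚ.- Φ ν))) (λ κ → (Φ ν ℚ.- Φ μ) ℚ.* (ι (f κ ν) ℚ.* wt κ)) (extensions ν n) ⟩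
    ∑ (extensions ν n) (λ κ → ι (f κ ν) ℚ.* (wt κ ℚ.* (Φ κ ℚ.- Φ ν))) ℚ.+ ∑ (extensions ν n) (λ κ → (Φ ν ℚ.- Φ μ) ℚ.* (ι (f κ ν) ℚ.* wt κ))
      ≡⟨ cong₂ ℚ._+_ (∑-content ν n) (trans (∑-*ˡ (Φ ν ℚ.- Φ μ) (λ κ → ι (f κ ν) ℚ.* wt κ) (extensions ν n)) (cong ((Φ ν ℚ.- Φ μ) ℚ.*_) (∑-wt ν n))) ⟩
    ι (rhs n (size ν)) ℚ.* wt ν ℚ.+ (Φ ν ℚ.- Φ μ) ℚ.* wt ν
      ≡⟨ cong₂ (λ s t → ι (rhs n s) ℚ.* wt ν ℚ.+ t) (proj₂ (Equivalence.to (∈-extensions μ 1 ν) ν∈)) (ℚ.*-comm (Φ ν ℚ.- Φ μ) (wt ν)) ⟩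
    ι (rhs n (size μ + 1)) ℚ.* wt ν ℚ.+ wt ν ℚ.* (Φ ν ℚ.- Φ μ) ∎

theorem1p3 : (μ : StrictPartition) (n : ℕ) →
    (∑[ ν ∈ extensions μ n ]
    (_/_ (+ (2 ^ exponent ν μ * f ν μ * H μ)) (H ν) {{H-nonZero ν}}
    ℚ.* ((+ contentSum ν ℤ.- + contentSum μ) / 1)))
    ≡ + (n C 2 + n * size μ) / 1
-- Multiplying by the non-zero w(μ) replaces every ratio w(ν)/w(μ) by w(ν), the form in which the
-- induction runs.
theorem1p3 μ n = *-cancelʳ (wt μ) (wt-nonZero μ) (begin
  ∑ (extensions μ n) summand ℚ.* wt μ
    ≡⟨ ∑-*ʳ summand (wt μ) (extensions μ n) ⟩
  ∑ (extensions μ n) (λ ν → summand ν ℚ.* wt μ)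
    ≡⟨ ∑-∈-cong {xs = extensions μ n} term ⟩
  ∑ (extensions μ n) (λ ν → ι (f ν μ) ℚ.* (wt ν ℚ.* (Φ ν ℚ.- Φ μ)))
    ≡⟨ ∑-content μ n ⟩
  ι (rhs n (size μ)) ℚ.* wt μ ∎)
  where
  coefficient summand : StrictPartition → ℚ
  coefficient ν = _/_ (+ (2 ^ exponent ν μ * f ν μ * H μ)) (H ν) {{H-nonZero ν}}
  summand ν = coefficient ν ℚ.* ((+ contentSum ν ℤ.- + contentSum μ) / 1)

  term : ∀ {ν} → ν ∈ extensions μ n → summand ν ℚ.* wt μ ≡ ι (f ν μ) ℚ.* (wt ν ℚ.* (Φ ν ℚ.- Φ μ))
  term {ν} ν∈ = begin
    coefficient ν ℚ.* ((+ contentSum ν ℤ.- + contentSum μ) / 1) ℚ.* wt μ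
      ≡⟨ cong (λ d → coefficient ν ℚ.* d ℚ.* wt μ) (/1-homo-‿- (contentSum ν) (contentSum μ)) ⟩
    coefficient ν ℚ.* (Φ ν ℚ.- Φ μ) ℚ.* wt μ
      ≡⟨ solve 3 (λ c d w → c :* d :* w := c :* w :* d) refl (coefficient ν) (Φ ν ℚ.- Φ μ) (wt μ) ⟩
    coefficient ν ℚ.* wt μ ℚ.* (Φ ν ℚ.- Φ μ)
      ≡⟨ cong (ℚ._* (Φ ν ℚ.- Φ μ)) (coefficient-wt {μ} {ν} (f ν μ) (proj₁ (Equivalence.to (∈-extensions μ n ν) ν∈))) ⟩
    ι (f ν μ) ℚ.* wt ν ℚ.* (Φ ν ℚ.- Φ μ)
      ≡⟨ ℚ.*-assoc (ι (f ν μ)) (wt ν) (Φ ν ℚ.- Φ μ) ⟩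
    ι (f ν μ) ℚ.* (wt ν ℚ.* (Φ ν ℚ.- Φ μ)) ∎
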